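{- Let $I=\{i_1<\dots<i_k\}$ be the pivot indices for the plabic network $(\mathcal N,\mathcal O,\mathfrak l)$. Let $E_e$ be the system of edge vectors on $(\mathcal N,\mathcal O,\mathfrak l)$ satisfying the boundary conditions given by the canonical basis vectors $E_j$ at the boundary sinks $b_j$, $j\in\bar I$. Assume that we change the orientation along a simple closed directed cycle $\mathcal Q_0$ and let $(\mathcal N,\hat{\mathcal O},\mathfrak l)$ be the newly oriented network. Then the system of vectors $$\hat E_e=\begin{cases}(-1)^{\gamma(e)}E_e & e\notin\mathcal Q_0,\\[1mm] \dfrac{(-1)^{\gamma(e)}}{w_e}E_e & e\in\mathcal Q_0,\end{cases}$$ with $\gamma(e)$ as defined in the context, is the system of edge vectors on $(\mathcal N,\hat{\mathcal O},\mathfrak l)$ satisfying the same boundary conditions $E_j$ at the boundary sinks $b_j$, $j\in\bar I$.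
   Context: **Plabic networks.** Let $D$ be a closed convex disk whose boundary contains a straight segment. A plabic graph $\mathcal G$ is a finite directed planar graph embedded in $D$ with straight edges. It has boundary vertices $b_1,\dots,b_n$ on the segment, labelled clockwise, each of degree 1 (a source if its edge is outgoing, a sink otherwise). The remaining (internal) vertices lie inside $D$ and have degree 2 or 3. No component is isolated from the boundary. The graph is perfect: each internal vertex has exactly one incoming edge (then it is white) or exactly one outgoing edge (then it is black); bivalent vertices have one incoming and one outgoing edge and either color. Perfect orientations are those compatible with the coloring. $I$ is the set of indices of the boundary sources (pivot indices), $\bar I=[n]\setminus I$. A network has a positive weight $w_e$ on each directed edge. When the orientation changes, reversed edges get the reciprocal weight and the others keep theirs. ($w_e$ in the claim is the weight in the initial orientation.) **Gauge rays.** A gauge ray direction $\mathfrak l$ is an oriented direction, not parallel to any edge, such that the rays with direction $\mathfrak l$ starting at boundary vertices point inside $D$ and contain no internal vertices. The gauge rays are those starting at the boundary sources, and $\mathrm{int}(e)$ is the number of their intersections with $e$ (base points not counted). **Winding.** $s(a,b)=+1,0,-1$ if the ordered pair $(a,b)$ is positively oriented, parallel, negatively oriented. For consecutive directed edges: $\mathrm{wind}(e,f)=\pm1$ if $s(e,f)=s(e,\mathfrak l)=s(\mathfrak l,f)=\pm1$; otherwise $0$. **System of edge vectors** with boundary conditions $B_j$ at the sinks: the unique solution of $E_e=(-1)^{\mathrm{int}(e)}w_e\sum_f(-1)^{\mathrm{wind}(e,f)}E_f$ (for every edge $e$ ending at an internal vertex $V$, $f$ running over the edges outgoing at $V$), with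 $E_{e_j}=(-1)^{\mathrm{int}(e_j)}w_{e_j}B_j$ at the edge $e_j$ ending at the sink $b_j$ (all quantities computed in the orientation considered). **Index $\gamma(e)$** (computed in the initial orientation $\mathcal O$). The cycle $\mathcal Q_0$ divides the interior of $D$ into two regions: the external one is marked $+$ and the internal one $-$. If $e\notin\mathcal Q_0$: $\gamma(e)=0$ (resp. $1$) if the starting vertex of $e$ lies in the $+$ (resp. $-$) region; if the starting vertex lies on $\mathcal Q_0$, it is first shifted infinitesimally in the direction of $e$. If $e\in\mathcal Q_0$: $\gamma(e)=\gamma_1(e)+\gamma_2(e)+\mathrm{int}(e)$, where $\gamma_1(e)=0$ (resp. $1$) if the region immediately to the left of $e$ near its ending point is marked $+$ (resp. $-$), and $\gamma_2(e)=\frac{1-s(e,\mathfrak l)}2$. -}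

module Defs where

open import Level using (Level; _⊔_; suc)
open import Algebra.Bundles using (CommutativeRing)
open import Algebra.Properties.Semiring.Exp using (_^_)
import Algebra.Properties.Ring as RingProperties
import Algebra.Solver.Ring.NaturalCoefficients.Default as SemiringSolver
open import Data.Bool using (Bool; true; false; not; if_then_else_)
open import Data.Fin using (Fin) renaming (_<_ to _<ᶠ_)
import Data.Fin.Properties as Fin
open import Data.Integer using (ℤ; ∣_∣; 0ℤ; 1ℤ; -1ℤ)
  renaming (_-_ to _-ℤ_)
open import Data.Integer.DivMod using (_/ℕ_)
import Data.Integer.Properties as ℤ
open import Data.List using (List; []; _∷_; allFin; filter; foldr; length; map)
open import Data.List.Membership.Propositional using (_∈_; _∉_)
import Data.List.Membership.DecPropositional as DecMembership
open import Data.List.Relation.Unary.Unique.Propositional using (Unique)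
open import Data.Nat using (ℕ) renaming (_+_ to _+ℕ_)
open import Data.Product using (∃-syntax; _×_; _,_)
open import Data.Sign using (Sign)
open import Data.Sum using (_⊎_; inj₁; inj₂)
import Data.Sum.Properties as Sum
open import Data.Vec.Functional using (Vector)
open import Relation.Binary using (Rel; IsStrictTotalOrder; tri<; tri≈; tri>)
import Relation.Binary.Construct.StrictToNonStrict as ToNonStrict
open import Relation.Binary.Construct.Closure.ReflexiveTransitive using (Star)
import Relation.Binary.Reasoning.Setoid as SetoidReasoning
open import Relation.Binary.PropositionalEquality using (_≡_; _≢_)
open import Relation.Nullary using (¬_; Dec; yes; no; does)
open import Relation.Nullary.Decidable using (map′; _×-dec_; _⊎-dec_)
open import Relation.Unary using (Pred)

-- The real numbers are used below only through this structure.
record OrderedField (c ℓ₁ ℓ₂ : Level) : Set (suc (c ⊔ ℓ₁ ⊔ ℓ₂)) where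
  infix 4 _<_
  infix 8 _⁻¹
  field
    commutativeRing : CommutativeRing c ℓ₁
  open CommutativeRing commutativeRing public
  field
    _<_                : Rel Carrier ℓ₂
    isStrictTotalOrder : IsStrictTotalOrder _≈_ _<_
    0<1                : 0# < 1#
    +-monoˡ-<          : ∀ z {x y} → x < y → x + z < y + z
    *-pos              : ∀ {x y} → 0# < x → 0# < y → 0# < x * y
    -- total; the value at 0# is irrelevant
    _⁻¹                : Carrier → Carrier
    ⁻¹-inverseʳ        : ∀ {x} → ¬ (x ≈ 0#) → x * x ⁻¹ ≈ 1#

  open IsStrictTotalOrder isStrictTotalOrder public
    using (compare; _≟_; _<?_; <-respʳ-≈; <-respˡ-≈)
  open ToNonStrict _≈_ _<_ public using (_≤_)

  _≤?_ : ∀ x y → Dec (x ≤ y)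
  _≤?_ = ToNonStrict.decidable _≈_ _<_ _≟_ _<?_

  ≤-respʳ-≈ : ∀ {x y z} → y ≈ z → x ≤ y → x ≤ z
  ≤-respʳ-≈ = ToNonStrict.≤-respʳ-≈ _≈_ _<_ trans <-respʳ-≈

  ≤-respˡ-≈ : ∀ {x y z} → y ≈ z → y ≤ x → z ≤ x
  ≤-respˡ-≈ = ToNonStrict.≤-respˡ-≈ _≈_ _<_ sym trans <-respˡ-≈

  sgn : Carrier → ℤ
  sgn x with compare x 0#
  ... | tri< _ _ _ = -1ℤ
  ... | tri≈ _ _ _ = 0ℤ
  ... | tri> _ _ _ = 1ℤ

  parity : ℕ → Carrier
  parity k = _^_ semiring (- 1#) k

-- Cramer's rule for the intersection of a line and a segment.
module Cramer {a ℓ : Level} (R : CommutativeRing a ℓ) where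
  open CommutativeRing R
  open RingProperties ring using (x[y-z]≈xy-xz; [y-z]x≈yx-zx)
  open SemiringSolver commutativeSemiring using (solve; _:=_; _:+_; _:*_)
  open SetoidReasoning setoid

  cancel : ∀ x y → (x + y) - y ≈ x
  cancel x y = trans (+-assoc x y (- y)) (trans (+-congˡ (-‿inverseʳ y)) (+-identityʳ x))

  cancel′ : ∀ x y → (x - y) + y ≈ x
  cancel′ x y = trans (+-assoc x (- y) y) (trans (+-congˡ (-‿inverseˡ y)) (+-identityʳ x))

  swap : ∀ x y z → x * y * z ≈ x * (z * y)
  swap x y z = trans (*-assoc x y z) (*-congˡ (*-comm y z))

  swap′ : ∀ x y z → x * y * z ≈ x * z * y
  swap′ x y z = trans (swap x y z) (sym (*-assoc x z y))

  transpose : ∀ {x y z w} → x + w ≈ z + y → x - y ≈ z - w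
  transpose {x} {y} {z} {w} eq = begin
    x - y              ≈⟨ cancel (x - y) w ⟨
    (x - y + w) - w    ≈⟨ +-congʳ (trans (+-assoc x (- y) w) (trans (+-congˡ (+-comm (- y) w)) (sym (+-assoc x w (- y))))) ⟩
    (x + w - y) - w    ≈⟨ +-congʳ (+-congʳ eq) ⟩
    (z + y - y) - w    ≈⟨ +-congʳ (cancel z y) ⟩
    z - w              ∎

  module _ {t u l₁ l₂ c₁ c₂ d₁ d₂ : Carrier}
           (eq₁ : t * l₁ ≈ c₁ + u * d₁) (eq₂ : t * l₂ ≈ c₂ + u * d₂) where

    solve-t : t * (l₁ * d₂ - l₂ * d₁) ≈ c₁ * d₂ - c₂ * d₁
    solve-t = trans (x[y-z]≈xy-xz t (l₁ * d₂) (l₂ * d₁)) (transpose (begin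
      t * (l₁ * d₂) + c₂ * d₁             ≈⟨ +-congʳ (*-assoc t l₁ d₂) ⟨
      t * l₁ * d₂ + c₂ * d₁               ≈⟨ +-congʳ (*-congʳ eq₁) ⟩
      (c₁ + u * d₁) * d₂ + c₂ * d₁
        ≈⟨ solve 5 (λ u c₁ c₂ d₁ d₂ → (c₁ :+ u :* d₁) :* d₂ :+ c₂ :* d₁
             := c₁ :* d₂ :+ (c₂ :+ u :* d₂) :* d₁) refl u c₁ c₂ d₁ d₂ ⟩
      c₁ * d₂ + (c₂ + u * d₂) * d₁        ≈⟨ +-congˡ (*-congʳ eq₂) ⟨
      c₁ * d₂ + t * l₂ * d₁               ≈⟨ +-congˡ (*-assoc t l₂ d₁) ⟩
      c₁ * d₂ + t * (l₂ * d₁)             ∎))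

    solve-u : u * (l₁ * d₂ - l₂ * d₁) ≈ c₁ * l₂ - c₂ * l₁
    solve-u = trans (x[y-z]≈xy-xz u (l₁ * d₂) (l₂ * d₁)) (transpose (begin
      u * (l₁ * d₂) + c₂ * l₁
        ≈⟨ solve 4 (λ u l₁ c₂ d₂ → u :* (l₁ :* d₂) :+ c₂ :* l₁
             := (c₂ :+ u :* d₂) :* l₁) refl u l₁ c₂ d₂ ⟩
      (c₂ + u * d₂) * l₁                  ≈⟨ *-congʳ eq₂ ⟨
      t * l₂ * l₁
        ≈⟨ solve 3 (λ t l₁ l₂ → t :* l₂ :* l₁ := t :* l₁ :* l₂) refl t l₁ l₂ ⟩
      t * l₁ * l₂                         ≈⟨ *-congʳ eq₁ ⟩
      (c₁ + u * d₁) * l₂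
        ≈⟨ solve 4 (λ u l₂ c₁ d₁ → (c₁ :+ u :* d₁) :* l₂
             := c₁ :* l₂ :+ u :* (l₂ :* d₁)) refl u l₂ c₁ d₁ ⟩
      c₁ * l₂ + u * (l₂ * d₁)             ∎))

  telescope : ∀ x y z → (x - y) + (y - z) ≈ x - z
  telescope x y z = trans (sym (+-assoc (x - y) y (- z))) (+-congʳ (cancel′ x y))

  module _ (l₁ l₂ c₁ c₂ d₁ d₂ : Carrier) where
    identity₁ : (c₁ * d₂ - c₂ * d₁) * l₁
                ≈ c₁ * (l₁ * d₂ - l₂ * d₁) + (c₁ * l₂ - c₂ * l₁) * d₁
    identity₁ = begin
      (c₁ * d₂ - c₂ * d₁) * l₁
        ≈⟨ [y-z]x≈yx-zx l₁ (c₁ * d₂) (c₂ * d₁) ⟩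
      c₁ * d₂ * l₁ - c₂ * d₁ * l₁
        ≈⟨ telescope (c₁ * d₂ * l₁) (c₁ * l₂ * d₁) (c₂ * d₁ * l₁) ⟨
      (c₁ * d₂ * l₁ - c₁ * l₂ * d₁) + (c₁ * l₂ * d₁ - c₂ * d₁ * l₁)
        ≈⟨ +-cong (+-cong (swap c₁ d₂ l₁) (-‿cong (*-assoc c₁ l₂ d₁)))
                  (+-congˡ (-‿cong (swap′ c₂ d₁ l₁))) ⟩
      (c₁ * (l₁ * d₂) - c₁ * (l₂ * d₁)) + (c₁ * l₂ * d₁ - c₂ * l₁ * d₁)
        ≈⟨ +-cong (x[y-z]≈xy-xz c₁ (l₁ * d₂) (l₂ * d₁)) ([y-z]x≈yx-zx d₁ (c₁ * l₂) (c₂ * l₁)) ⟨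
      c₁ * (l₁ * d₂ - l₂ * d₁) + (c₁ * l₂ - c₂ * l₁) * d₁ ∎

    identity₂ : (c₁ * d₂ - c₂ * d₁) * l₂
                ≈ c₂ * (l₁ * d₂ - l₂ * d₁) + (c₁ * l₂ - c₂ * l₁) * d₂
    identity₂ = begin
      (c₁ * d₂ - c₂ * d₁) * l₂
        ≈⟨ [y-z]x≈yx-zx l₂ (c₁ * d₂) (c₂ * d₁) ⟩
      c₁ * d₂ * l₂ - c₂ * d₁ * l₂
        ≈⟨ telescope (c₁ * d₂ * l₂) (c₂ * l₁ * d₂) (c₂ * d₁ * l₂) ⟨
      (c₁ * d₂ * l₂ - c₂ * l₁ * d₂) + (c₂ * l₁ * d₂ - c₂ * d₁ * l₂)
        ≈⟨ +-cong (+-congʳ (swap′ c₁ d₂ l₂))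
                  (+-cong (*-assoc c₂ l₁ d₂) (-‿cong (swap c₂ d₁ l₂))) ⟩
      (c₁ * l₂ * d₂ - c₂ * l₁ * d₂) + (c₂ * (l₁ * d₂) - c₂ * (l₂ * d₁))
        ≈⟨ +-cong ([y-z]x≈yx-zx d₂ (c₁ * l₂) (c₂ * l₁)) (x[y-z]≈xy-xz c₂ (l₁ * d₂) (l₂ * d₁)) ⟨
      (c₁ * l₂ - c₂ * l₁) * d₂ + c₂ * (l₁ * d₂ - l₂ * d₁)
        ≈⟨ +-comm _ _ ⟩
      c₂ * (l₁ * d₂ - l₂ * d₁) + (c₁ * l₂ - c₂ * l₁) * d₂ ∎

  divide : ∀ {x y z z⁻¹} → z * z⁻¹ ≈ 1# → x * z ≈ y → x ≈ y * z⁻¹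
  divide {x} {y} {z} {z⁻¹} inv eq = begin
    x               ≈⟨ *-identityʳ x ⟨
    x * 1#          ≈⟨ *-congˡ inv ⟨
    x * (z * z⁻¹)   ≈⟨ *-assoc x z z⁻¹ ⟨
    x * z * z⁻¹     ≈⟨ *-congʳ eq ⟩
    y * z⁻¹         ∎

  divide′ : ∀ {x y z z⁻¹ c l d} → z * z⁻¹ ≈ 1# → x * l ≈ c * z + y * d →
            (x * z⁻¹) * l ≈ c + (y * z⁻¹) * d
  divide′ {x} {y} {z} {z⁻¹} {c} {l} {d} inv eq = begin
    x * z⁻¹ * l                   ≈⟨ swap′ x z⁻¹ l ⟩
    x * l * z⁻¹                   ≈⟨ *-congʳ eq ⟩
    (c * z + y * d) * z⁻¹         ≈⟨ distribʳ z⁻¹ (c * z) (y * d) ⟩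
    c * z * z⁻¹ + y * d * z⁻¹     ≈⟨ +-cong (sym (divide inv refl)) (swap′ y d z⁻¹) ⟩
    c + y * z⁻¹ * d               ∎

  shift : ∀ {b x p y} → b + x ≈ p + y → x ≈ (p - b) + y
  shift {b} {x} {p} {y} eq = begin
    x              ≈⟨ cancel x b ⟨
    x + b - b      ≈⟨ +-congʳ (trans (+-comm x b) eq) ⟩
    p + y - b      ≈⟨ trans (+-assoc p y (- b)) (trans (+-congˡ (+-comm y (- b))) (sym (+-assoc p (- b) y))) ⟩
    (p - b) + y    ∎

  unshift : ∀ {b x p y} → x ≈ (p - b) + y → b + x ≈ p + y
  unshift {b} {x} {p} {y} eq = begin
    b + x               ≈⟨ +-congˡ eq ⟩
    b + ((p - b) + y)   ≈⟨ +-assoc b (p - b) y ⟨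
    b + (p - b) + y     ≈⟨ +-congʳ (trans (+-comm b (p - b)) (cancel′ p b)) ⟩
    p + y               ∎

module Plane {c ℓ₁ ℓ₂ : Level} (K : OrderedField c ℓ₁ ℓ₂) where
  open OrderedField K

  infixl 6 _+ₚ_ _-ₚ_
  infixl 7 _*ₚ_
  infix  4 _≈ₚ_

  Point : Set c
  Point = Carrier × Carrier

  _≈ₚ_ : Point → Point → Set ℓ₁
  (x , y) ≈ₚ (x′ , y′) = x ≈ x′ × y ≈ y′

  _+ₚ_ _-ₚ_ : Point → Point → Point
  (x , y) +ₚ (x′ , y′) = x + x′ , y + y′
  (x , y) -ₚ (x′ , y′) = x - x′ , y - y′

  _*ₚ_ : Carrier → Point → Point
  t *ₚ (x , y) = t * x , t * y

  det : Point → Point → Carrier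
  det (x , y) (x′ , y′) = x * y′ - y * x′

  s : Point → Point → ℤ
  s a b = sgn (det a b)

  -- Counterclockwise rotation by a right angle: it points to the left.
  rotate : Point → Point
  rotate (x , y) = - y , x

  -- r lies on the closed segment [p , q]
  OnSegment : Point → Point → Point → Set (c ⊔ ℓ₁ ⊔ ℓ₂)
  OnSegment p q r = ∃[ t ] 0# ≤ t × t ≤ 1# × r ≈ₚ p +ₚ t *ₚ (q -ₚ p)

  -- The ray from b in direction l, without b itself, meets [p , q].
  RayMeets : Point → Point → Point → Point → Set (c ⊔ ℓ₁ ⊔ ℓ₂)
  RayMeets b l p q = ∃[ t ] 0# < t × OnSegment p q (b +ₚ t *ₚ l)

  Within : Carrier → Point → Point → Set ℓ₂
  Within ε (x , y) (x′ , y′) =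
    (x - ε < x′ × x′ < x + ε) × (y - ε < y′ × y′ < y + ε)

  Interior : ∀ {d} → Pred Point d → Pred Point (c ⊔ ℓ₂ ⊔ d)
  Interior D p = ∃[ ε ] 0# < ε × (∀ q → Within ε p q → D q)

  module _ (b l p q : Point) (δ≉0 : ¬ (det l (q -ₚ p) ≈ 0#)) where
    private
      open Cramer commutativeRing

      δ⁻¹ t₀ u₀ : Carrier
      δ⁻¹ = det l (q -ₚ p) ⁻¹
      t₀  = det (p -ₚ b) (q -ₚ p) * δ⁻¹
      u₀  = det (p -ₚ b) l * δ⁻¹

      inv : det l (q -ₚ p) * δ⁻¹ ≈ 1#
      inv = ⁻¹-inverseʳ δ≉0

      meets : b +ₚ t₀ *ₚ l ≈ₚ p +ₚ u₀ *ₚ (q -ₚ p)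
      meets = unshift (divide′ inv (identity₁ _ _ _ _ _ _))
            , unshift (divide′ inv (identity₂ _ _ _ _ _ _))

      t≈t₀ : ∀ {t u} → b +ₚ t *ₚ l ≈ₚ p +ₚ u *ₚ (q -ₚ p) → t ≈ t₀
      t≈t₀ (eq₁ , eq₂) = divide inv (solve-t (shift eq₁) (shift eq₂))

      u≈u₀ : ∀ {t u} → b +ₚ t *ₚ l ≈ₚ p +ₚ u *ₚ (q -ₚ p) → u ≈ u₀
      u≈u₀ (eq₁ , eq₂) = divide inv (solve-u (shift eq₁) (shift eq₂))

    abstract
      rayMeets? : Dec (RayMeets b l p q)
      rayMeets? = map′
        (λ (0<t , 0≤u , u≤1) → t₀ , 0<t , u₀ , 0≤u , u≤1 , meets)
        (λ (t , 0<t , u , 0≤u , u≤1 , eq) →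
            <-respʳ-≈ (t≈t₀ eq) 0<t , ≤-respʳ-≈ (u≈u₀ eq) 0≤u , ≤-respˡ-≈ (u≈u₀ eq) u≤1)
        (0# <? t₀ ×-dec 0# ≤? u₀ ×-dec u₀ ≤? 1#)

-- A compact convex set with nonempty interior, together with a segment [a , b]
-- of its boundary whose ends are named so that the disk lies to the right of
-- a → b, i.e. clockwise along the boundary.
record Disk {c ℓ₁ ℓ₂ : Level} (K : OrderedField c ℓ₁ ℓ₂) (d : Level)
       : Set (c ⊔ ℓ₁ ⊔ ℓ₂ ⊔ suc d) where
  open OrderedField K
  open Plane K

  field
    D        : Pred Point d
    convex   : ∀ {p q r} → D p → D q → OnSegment p q r → D r
    closed   : ∀ p → (∀ ε → 0# < ε → ∃[ q ] Within ε p q × D q) → D p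
    bounded  : ∃[ ρ ] (∀ p → D p → Within ρ (0# , 0#) p)
    nonempty : ∃[ p ] Interior D p

  Boundary : Pred Point (c ⊔ ℓ₂ ⊔ d)
  Boundary p = D p × ¬ Interior D p

  field
    a b         : Point
    a≉b         : ¬ (a ≈ₚ b)
    onBoundary  : ∀ p → OnSegment a b p → Boundary p
    clockwise   : ∀ p → D p → det (b -ₚ a) (p -ₚ a) ≤ 0#

data Colour : Set where
  white black : Colour

-- The reference end points of an edge are indexed by Bool; an orientation
-- names the end which is the starting vertex.
Orientation : ℕ → Set
Orientation r = Fin r → Bool

module Graph {n m r : ℕ} (end : Fin r → Bool → Fin n ⊎ Fin m) where
  Vertex Edge : Set
  Vertex = Fin n ⊎ Fin m
  Edge = Fin r

  _≟ᵛ_ : (u v : Vertex) → Dec (u ≡ v)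
  _≟ᵛ_ = Sum.≡-dec Fin._≟_ Fin._≟_

  _∈ₑ?_ : (e : Edge) (Q : List Edge) → Dec (e ∈ Q)
  _∈ₑ?_ = DecMembership._∈?_ Fin._≟_

  Incident : Vertex → Edge → Set
  Incident v e = end e false ≡ v ⊎ end e true ≡ v

  degree : Vertex → ℕ
  degree v = length (filter (λ e → (end e false ≟ᵛ v) ⊎-dec (end e true ≟ᵛ v)) (allFin r))

  Adjacent : Vertex → Vertex → Set
  Adjacent u v = ∃[ e ] ∃[ x ] end e x ≡ u × end e (not x) ≡ v

  module Oriented (o : Orientation r) where
    source target : Edge → Vertex
    source e = end e (o e)
    target e = end e (not (o e))

    outEdges inEdges : Vertex → List Edge
    outEdges v = filter (λ e → source e ≟ᵛ v) (allFin r)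
    inEdges  v = filter (λ e → target e ≟ᵛ v) (allFin r)

    IsPivot : Fin n → Set
    IsPivot j = ∃[ e ] source e ≡ inj₁ j

    isPivot? : ∀ j → Dec (IsPivot j)
    isPivot? j = Fin.any? (λ e → source e ≟ᵛ inj₁ j)

    pivots : List (Fin n)
    pivots = filter isPivot? (allFin n)

    record IsPerfect (colour : Fin m → Colour) : Set where
      field
        white-in : ∀ v → colour v ≡ white → length (inEdges (inj₂ v)) ≡ 1
        black-out : ∀ v → colour v ≡ black → length (outEdges (inj₂ v)) ≡ 1
        bivalent : ∀ v → degree (inj₂ v) ≡ 2 →
                   length (inEdges (inj₂ v)) ≡ 1 × length (outEdges (inj₂ v)) ≡ 1

    data Walk : Vertex → List Edge → Vertex → Set where
      []  : ∀ {v} → Walk v [] v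
      _∷_ : ∀ {v Q} e → Walk (target e) Q v → Walk (source e) (e ∷ Q) v

    record IsSimpleCycle (Q : List Edge) : Set where
      field
        nonempty : Q ≢ []
        walk     : ∃[ v ] Walk v Q v
        simple   : Unique (map source Q)

  reverse : List Edge → Orientation r → Orientation r
  reverse Q o e = if does (e ∈ₑ? Q) then not (o e) else o e

record PlabicGraph {c ℓ₁ ℓ₂ d : Level} {K : OrderedField c ℓ₁ ℓ₂} (disk : Disk K d)
                   (n m r : ℕ) : Set (c ⊔ ℓ₁ ⊔ ℓ₂ ⊔ d) where
  open OrderedField K
  open Plane K
  open Disk disk

  field
    end    : Fin r → Bool → Fin n ⊎ Fin m
    colour : Fin m → Colour
  open Graph end public

  field
    pos : Vertex → Point

    -- b_j is the point with parameter τ j on the segment.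
    τ            : Fin n → Carrier
    τ-bounds     : ∀ j → 0# ≤ τ j × τ j ≤ 1#
    τ-increasing : ∀ {i j} → i <ᶠ j → τ i < τ j
    pos-boundary : ∀ j → pos (inj₁ j) ≈ₚ a +ₚ τ j *ₚ (b -ₚ a)
    pos-internal : ∀ v → Interior D (pos (inj₂ v))
    pos-distinct : ∀ {u v} → pos u ≈ₚ pos v → u ≡ v

    degree-boundary : ∀ j → degree (inj₁ j) ≡ 1
    degree-internal : ∀ v → degree (inj₂ v) ≡ 2 ⊎ degree (inj₂ v) ≡ 3
    no-isolated     : ∀ v → ∃[ j ] Star Adjacent v (inj₁ j)
    no-loop         : ∀ e → end e false ≢ end e true

  OnEdge : Edge → Point → Set (c ⊔ ℓ₁ ⊔ ℓ₂)
  OnEdge e p = OnSegment (pos (end e false)) (pos (end e true)) p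

  field
    vertices-off-edges : ∀ {e v} → OnEdge e (pos v) → Incident v e
    edges-disjoint     : ∀ {e f p} → e ≢ f → OnEdge e p → OnEdge f p →
                         ∃[ v ] Incident v e × Incident v f × p ≈ₚ pos v

  chord : Edge → Point
  chord e = pos (end e true) -ₚ pos (end e false)

-- A direction and not yet a set of rays: the conditions do not involve the
-- orientation of the graph, which only selects the rays that are drawn.
record GaugeDirection {c ℓ₁ ℓ₂ d : Level} {K : OrderedField c ℓ₁ ℓ₂} {disk : Disk K d}
                      {n m r : ℕ} (G : PlabicGraph disk n m r) : Set (c ⊔ ℓ₁ ⊔ ℓ₂ ⊔ d) where
  open OrderedField K
  open Plane K
  open Disk disk using (D)
  open PlabicGraph G

  field
    l           : Point
    nonparallel : ∀ e → ¬ (det l (chord e) ≈ 0#)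
    inward      : ∀ j → ∃[ ε ] 0# < ε ×
                  (∀ t → 0# < t → t ≤ ε → Interior D (pos (inj₁ j) +ₚ t *ₚ l))
    generic     : ∀ j v t → 0# ≤ t → ¬ (pos (inj₁ j) +ₚ t *ₚ l ≈ₚ pos (inj₂ v))

module EdgeVectors {c ℓ₁ ℓ₂ d : Level} {K : OrderedField c ℓ₁ ℓ₂} {disk : Disk K d}
                   {n m r : ℕ} (G : PlabicGraph disk n m r) (gauge : GaugeDirection G) where
  open OrderedField K
  open Plane K
  open Disk disk using (D; Boundary)
  open PlabicGraph G
  open GaugeDirection gauge

  Weight : Set c
  Weight = Edge → Carrier

  EdgeSystem : Set c
  EdgeSystem = Edge → Vector Carrier n

  wind′ : Point → Point → ℤ
  wind′ x y with s x y ℤ.≟ s x l | s x y ℤ.≟ s l y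
  ... | yes _ | yes _ = s x y
  ... | _     | _     = 0ℤ

  basis : Fin n → Vector Carrier n
  basis i j = if does (i Fin.≟ j) then 1# else 0#

  ∑ : List Edge → (Edge → Carrier) → Carrier
  ∑ es f = foldr _+_ 0# (map f es)

  module _ (o : Orientation r) where
    open Oriented o

    dir : Edge → Point
    dir e = pos (target e) -ₚ pos (source e)

    wind : Edge → Edge → ℤ
    wind e f = wind′ (dir e) (dir f)

    -- A ray meets an edge in at most one point, because they are not parallel,
    -- and different rays are disjoint; so intersections are counted by rays.
    int : Edge → ℕ
    int e = length (filter
      (λ i → rayMeets? (pos (inj₁ i)) l (pos (end e false)) (pos (end e true)) (nonparallel e))
      pivots)

    record Solves (w : Weight) (B : Fin n → Vector Carrier n) (E : EdgeSystem)
           : Set (c ⊔ ℓ₁) where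
      field
        atInternal : ∀ e v → target e ≡ inj₂ v → ∀ k →
          E e k ≈ parity (int e) * w e *
                  ∑ (outEdges (inj₂ v)) (λ f → parity ∣ wind e f ∣ * E f k)
        atSink : ∀ e j → target e ≡ inj₁ j → ∀ k →
          E e k ≈ parity (int e) * w e * B j k

    record IsSystemOfEdgeVectors (w : Weight) (B : Fin n → Vector Carrier n) (E : EdgeSystem)
           : Set (c ⊔ ℓ₁) where
      field
        solves : Solves w B E
        unique : ∀ E′ → Solves w B E′ → ∀ e k → E′ e k ≈ E e k

  module _ (Q : List Edge) where
    OnCycle : Point → Set (c ⊔ ℓ₁ ⊔ ℓ₂)
    OnCycle p = ∃[ e ] e ∈ Q × OnEdge e p

    OffCycle : Point → Set (c ⊔ ℓ₁ ⊔ ℓ₂ ⊔ d)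
    OffCycle p = D p × ¬ OnCycle p

    Joined : Point → Point → Set (c ⊔ ℓ₁ ⊔ ℓ₂ ⊔ d)
    Joined = Star (λ p q → ∀ x → OnSegment p q x → OffCycle x)

    -- The two regions into which the cycle divides D, by the Jordan curve
    -- theorem for polygons.  The fields determine mark on D minus the cycle; its
    -- values elsewhere are irrelevant.  External is the region containing the
    -- boundary of D, which is included so that boundary vertices have a mark.
    record Regions : Set (c ⊔ ℓ₁ ⊔ ℓ₂ ⊔ d) where
      field
        mark      : Point → Sign
        separated : ∀ {p q} → Joined p q → mark p ≡ mark q
        connected : ∀ {p q} → OffCycle p → OffCycle q → mark p ≡ mark q → Joined p q
        external  : ∀ p → Boundary p → mark p ≡ Sign.+
        internal  : ∃[ p ] OffCycle p × mark p ≡ Sign.-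

    bit : Sign → ℕ
    bit Sign.+ = 0
    bit Sign.- = 1

    module _ (o : Orientation r) (regions : Regions) where
      open Oriented o
      open Regions regions

      -- All points close enough to the starting vertex of e, along e.
      MarkedAtStart : Edge → Sign → Set (c ⊔ ℓ₂)
      MarkedAtStart e σ = ∃[ ε ] 0# < ε × (∀ t → 0# < t → t < ε →
        mark (pos (source e) +ₚ t *ₚ dir o e) ≡ σ)

      -- All points slightly to the left of e slightly before its ending point,
      -- the first displacement being small with respect to the second.
      MarkedAtLeft : Edge → Sign → Set (c ⊔ ℓ₂)
      MarkedAtLeft e σ = ∃[ ε ] 0# < ε × (∀ t → 0# < t → t < ε →
        ∃[ ε′ ] 0# < ε′ × (∀ t′ → 0# < t′ → t′ < ε′ →
          mark (pos (target e) -ₚ t *ₚ dir o e +ₚ t′ *ₚ rotate (dir o e)) ≡ σ))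

      γ₂ : Edge → ℕ
      γ₂ e = ∣ (1ℤ -ℤ s (dir o e) l) /ℕ 2 ∣

      data IsIndex (e : Edge) : ℕ → Set (c ⊔ ℓ₁ ⊔ ℓ₂) where
        start-off : e ∉ Q → ¬ OnCycle (pos (source e)) →
                    IsIndex e (bit (mark (pos (source e))))
        start-on  : ∀ {σ} → e ∉ Q → OnCycle (pos (source e)) → MarkedAtStart e σ →
                    IsIndex e (bit σ)
        on-cycle  : ∀ {σ} → e ∈ Q → MarkedAtLeft e σ →
                    IsIndex e (bit σ +ℕ γ₂ e +ℕ int o e)

    reweight : Weight → Weight
    reweight w e = if does (e ∈ₑ? Q) then w e ⁻¹ else w e

    transform : (Edge → ℕ) → Weight → EdgeSystem → EdgeSystem
    transform γ w E e k =
      if does (e ∈ₑ? Q) then parity (γ e) * w e ⁻¹ * E e k else parity (γ e) * E e k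

-- The map E ↦ Ê is invertible, so it suffices that it preserves, in both directions, the
-- relations at every vertex; this also yields uniqueness. A vertex off the cycle is surrounded
-- by a single mark. At a vertex V of the cycle, between the cycle edges e and f, the relations
-- correspond if certain sums of windings, γ₂ and marks next to V are even. Windings depend only
-- on the signs of the determinants of l and the directions at V; these signs satisfy a Plücker
-- relation, under which the sums can be checked by enumeration, once the mark next to a third
-- edge at V is known to tell on which side of the cycle that edge lies.
--
-- Following the cycle, through thin strips along its edges and small sectors at its vertices,
-- one mark is found on its whole left side and one on its whole right side. A segment from any
-- point to the cycle first hits it from one of the two sides, so no other marks occur; as both
-- signs occur as marks, the two sides are marked differently.
{-# OPTIONS --safe #-}
module Submission where

open import Algebra.Bundles using (CommutativeRing)
import Algebra.Properties.Ring as RingProperties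
import Algebra.Properties.Semiring.Mult.TCOptimised as Multiples
import Algebra.Solver.Ring as RingSolver
open import Algebra.Solver.Ring.AlmostCommutativeRing
  using (AlmostCommutativeRing; fromCommutativeRing; _-Raw-AlmostCommutative⟶_)
open import Data.Bool using (Bool; true; false; not; _xor_; _∧_; _∨_; if_then_else_)
open import Data.Bool.Properties using (not-involutive)
open import Data.Empty using (⊥; ⊥-elim)
open import Data.Fin using (Fin)
import Data.Fin.Properties as Fin
import Data.Integer as ℤ
open import Data.Integer using (ℤ; 0ℤ; 1ℤ; -1ℤ; ∣_∣) renaming (_-_ to _-ℤ_)
open import Data.Integer.DivMod using (_/ℕ_)
import Data.Integer.Properties as ℤ
open import Data.List using (List; []; _∷_; _++_; allFin; filter; foldr; length; map)
open import Data.List.Membership.Propositional using (_∈_; _∉_; find; lose)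
open import Data.List.Membership.Propositional.Properties
  using (∈-map⁺; ∈-map⁻; ∈-filter⁺; ∈-filter⁻; ∈-allFin)
open import Data.List.Properties using (filter-≐)
open import Data.List.Relation.Binary.Permutation.Propositional
  using (_↭_; ↭-sym; ↭-trans; ↭-reflexive; ↭⇒↭ₛ)
open import Data.List.Relation.Binary.Permutation.Propositional.Properties
  using (drop-∷; ++-comm; ∈-resp-↭)
import Data.List.Relation.Binary.Permutation.Setoid.Properties as PermutationSetoid
open import Data.List.Relation.Unary.All as All using (All; []; _∷_)
open import Data.List.Relation.Unary.AllPairs using (_∷_)
open import Data.List.Relation.Unary.Any using (here; there; any?)
open import Data.List.Relation.Unary.Unique.Propositional using (Unique)
open import Data.List.Relation.Unary.Unique.Propositional.Properties using (allFin⁺)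
open import Data.Maybe using (Maybe; just; nothing)
open import Data.Nat as ℕ using (ℕ; zero; suc) renaming (_+_ to _+ℕ_)
open import Data.Nat.Properties using (+-suc)
open import Data.Product using (∃-syntax; _×_; _,_; proj₁; proj₂)
open import Data.Sign using (Sign)
import Data.Sum as Sum
open import Data.Sum using (_⊎_; inj₁; inj₂)
open import Level using (Level; _⊔_)
open import Relation.Binary using (tri<; tri≈; tri>; IsStrictTotalOrder)
open import Relation.Binary.Construct.Closure.ReflexiveTransitive using (Star; _◅_; _◅◅_)
  renaming (ε to nil)
open import Relation.Binary.PropositionalEquality as ≡ using (_≡_; _≢_)
import Relation.Binary.Reasoning.Setoid as SetoidReasoning
open import Relation.Nullary using (¬_; Dec; yes; no; does)
open import Relation.Nullary.Decidable using (_×-dec_; ¬?)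
open import Relation.Unary using (Pred; Decidable)
open import Defs

-- Origin of the factors: the vector of a cycle edge `e` is its sign and weight times the
-- combination of vectors leaving its end, and int together with the inverse weight undoes exactly
-- these two. So, up to the remaining signs, the new vector of `e` is that combination itself. If
-- `f` follows `e`, the old relation of `e`, solved for the vector of `f`, becomes the new relation
-- of `f`. The mark in γ₁ is constant along the cycle: it cancels between `e` and `f` and matters
-- only against a third edge. Jordan's theorem is given as data: marks that are constant on
-- polygonal paths avoiding the cycle. Nothing in these data mentions left or right, and this link
-- is the geometric obstacle. The field is any ordered field, so no completeness argument is
-- available: "close enough" always means an explicit bound, mostly obtained from an affine
-- functional that is nonpositive on an edge and positive at the points considered. There are
-- finitely many edges, so such bounds have a positive minimum.

-- A ring solver with integer coefficients.

module IntegerSolver {c ℓ : Level} (R : CommutativeRing c ℓ) where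
  open CommutativeRing R
  open RingProperties ring
    using (-‿involutive; -‿distribˡ-*; -‿distribʳ-*; -0#≈0#; -‿anti-homo-+)
  open Multiples semiring using (×-homo-+; ×1-homo-*; 1+×) renaming (_×_ to _·_)

  open SetoidReasoning setoid

  private
    ⟦_⟧ℤ : ℤ → Carrier
    ⟦ ℤ.+ n ⟧ℤ      = n · 1#
    ⟦ ℤ.-[1+ n ] ⟧ℤ = - (suc n · 1#)

    cancel-1 : ∀ x y → (1# + x) - (1# + y) ≈ x - y
    cancel-1 x y = begin
      (1# + x) - (1# + y)      ≈⟨ +-cong (+-comm 1# x) (-‿anti-homo-+ 1# y) ⟩
      (x + 1#) + (- y - 1#)    ≈⟨ +-congˡ (+-comm (- y) (- 1#)) ⟩
      (x + 1#) + (- 1# - y)    ≈⟨ +-assoc x 1# _ ⟩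
      x + (1# + (- 1# - y))    ≈⟨ +-congˡ (+-assoc 1# (- 1#) (- y)) ⟨
      x + ((1# - 1#) - y)      ≈⟨ +-congˡ (+-congʳ (-‿inverseʳ 1#)) ⟩
      x + (0# - y)             ≈⟨ +-congˡ (+-identityˡ (- y)) ⟩
      x - y                    ∎

    ⊖-homo : ∀ m n → ⟦ m ℤ.⊖ n ⟧ℤ ≈ m · 1# - n · 1#
    ⊖-homo zero    zero    = sym (-‿inverseʳ 0#)
    ⊖-homo (suc m) zero    = sym (trans (+-congˡ -0#≈0#) (+-identityʳ _))
    ⊖-homo zero    (suc n) = sym (+-identityˡ _)
    ⊖-homo (suc m) (suc n) = begin
      ⟦ suc m ℤ.⊖ suc n ⟧ℤ              ≡⟨ ≡.cong ⟦_⟧ℤ (ℤ.[1+m]⊖[1+n]≡m⊖n m n) ⟩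
      ⟦ m ℤ.⊖ n ⟧ℤ                      ≈⟨ ⊖-homo m n ⟩
      m · 1# - n · 1#                   ≈⟨ cancel-1 _ _ ⟨
      (1# + m · 1#) - (1# + n · 1#)     ≈⟨ +-cong (1+× m 1#) (-‿cong (1+× n 1#)) ⟨
      suc m · 1# - suc n · 1#           ∎

    +-homoℤ : ∀ i j → ⟦ i ℤ.+ j ⟧ℤ ≈ ⟦ i ⟧ℤ + ⟦ j ⟧ℤ
    +-homoℤ (ℤ.+ m)      (ℤ.+ n)      = ×-homo-+ 1# m n
    +-homoℤ (ℤ.+ m)      ℤ.-[1+ n ]   = ⊖-homo m (suc n)
    +-homoℤ ℤ.-[1+ m ]   (ℤ.+ n)      = trans (⊖-homo n (suc m)) (+-comm _ _)
    +-homoℤ ℤ.-[1+ m ]   ℤ.-[1+ n ]   = begin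
      - (suc (suc (m ℕ.+ n)) · 1#)      ≡⟨ ≡.cong (λ k → - (suc k · 1#)) (≡.sym (+-suc m n)) ⟩
      - ((suc m ℕ.+ suc n) · 1#)        ≈⟨ -‿cong (×-homo-+ 1# (suc m) (suc n)) ⟩
      - (suc m · 1# + suc n · 1#)       ≈⟨ -‿anti-homo-+ _ _ ⟩
      - (suc n · 1#) - suc m · 1#       ≈⟨ +-comm _ _ ⟩
      - (suc m · 1#) - suc n · 1#       ∎

    -‿homoℤ : ∀ i → ⟦ ℤ.- i ⟧ℤ ≈ - ⟦ i ⟧ℤ
    -‿homoℤ (ℤ.+ zero)  = sym -0#≈0#
    -‿homoℤ ℤ.+[1+ n ]  = refl
    -‿homoℤ ℤ.-[1+ n ]  = sym (-‿involutive _)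

    *-homo⁺ : ∀ m j → ⟦ ℤ.+ m ℤ.* j ⟧ℤ ≈ m · 1# * ⟦ j ⟧ℤ
    *-homo⁺ m (ℤ.+ n)    = trans (reflexive (≡.cong ⟦_⟧ℤ (≡.sym (ℤ.pos-* m n)))) (×1-homo-* m n)
    *-homo⁺ m ℤ.-[1+ n ] = begin
      ⟦ ℤ.+ m ℤ.* ℤ.-[1+ n ] ⟧ℤ         ≡⟨ ≡.cong ⟦_⟧ℤ (≡.sym (ℤ.neg-distribʳ-* (ℤ.+ m) ℤ.+[1+ n ])) ⟩
      ⟦ ℤ.- (ℤ.+ m ℤ.* ℤ.+[1+ n ]) ⟧ℤ   ≈⟨ -‿homoℤ (ℤ.+ m ℤ.* ℤ.+[1+ n ]) ⟩
      - ⟦ ℤ.+ m ℤ.* ℤ.+[1+ n ] ⟧ℤ       ≈⟨ -‿cong (*-homo⁺ m ℤ.+[1+ n ]) ⟩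
      - (m · 1# * (suc n · 1#))         ≈⟨ -‿distribʳ-* _ _ ⟩
      m · 1# * - (suc n · 1#)           ∎

    *-homoℤ : ∀ i j → ⟦ i ℤ.* j ⟧ℤ ≈ ⟦ i ⟧ℤ * ⟦ j ⟧ℤ
    *-homoℤ (ℤ.+ m)    j = *-homo⁺ m j
    *-homoℤ ℤ.-[1+ m ] j = begin
      ⟦ ℤ.-[1+ m ] ℤ.* j ⟧ℤ             ≡⟨ ≡.cong ⟦_⟧ℤ (≡.sym (ℤ.neg-distribˡ-* ℤ.+[1+ m ] j)) ⟩
      ⟦ ℤ.- (ℤ.+[1+ m ] ℤ.* j) ⟧ℤ       ≈⟨ -‿homoℤ (ℤ.+[1+ m ] ℤ.* j) ⟩
      - ⟦ ℤ.+[1+ m ] ℤ.* j ⟧ℤ           ≈⟨ -‿cong (*-homo⁺ (suc m) j) ⟩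
      - (suc m · 1# * ⟦ j ⟧ℤ)           ≈⟨ -‿distribˡ-* _ _ ⟩
      - (suc m · 1#) * ⟦ j ⟧ℤ           ∎

    almost : AlmostCommutativeRing c ℓ
    almost = fromCommutativeRing R

    -- Equality of integers is decidable, so normal forms cancel terms even where equality of the
    -- ring is not decidable. With the optimised multiples `1 · 1#` reduces to `1#`, hence `con 1ℤ`
    -- stands for `1#` on the nose.
    morphism : ℤ.+-*-rawRing -Raw-AlmostCommutative⟶ almost
    morphism = record
      { ⟦_⟧ = ⟦_⟧ℤ ; +-homo = +-homoℤ ; *-homo = *-homoℤ ; -‿homo = -‿homoℤ
      ; 0-homo = refl ; 1-homo = refl }

    coeff≟ : ∀ i j → Maybe (⟦ i ⟧ℤ ≈ ⟦ j ⟧ℤ)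
    coeff≟ i j with i ℤ.≟ j
    ... | yes i≡j = just (reflexive (≡.cong ⟦_⟧ℤ i≡j))
    ... | no _    = nothing

  open RingSolver ℤ.+-*-rawRing almost morphism coeff≟ public
    using (solve; _:=_; _:+_; _:*_; _:-_; :-_; con; Polynomial)


-- Ordered fields and statements about small positive numbers.

module OrderedFieldProperties {c ℓ₁ ℓ₂ : Level} (K : OrderedField c ℓ₁ ℓ₂) where
  open OrderedField K
  open IntegerSolver commutativeRing
  open IsStrictTotalOrder isStrictTotalOrder public
    using () renaming (trans to <-trans; irrefl to <-irrefl; asym to <-asym)

  0<≈ : ∀ {x y} → x ≈ y → 0# < x → 0# < y
  0<≈ = <-respʳ-≈

  0≤≈ : ∀ {x y} → x ≈ y → 0# ≤ x → 0# ≤ y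
  0≤≈ = ≤-respʳ-≈

  <⇒0<- : ∀ {x y} → x < y → 0# < y - x
  <⇒0<- {x} {y} x<y = <-respˡ-≈ (-‿inverseʳ x) (+-monoˡ-< (- x) x<y)

  0<-⇒< : ∀ {x y} → 0# < y - x → x < y
  0<-⇒< {x} {y} 0<y-x = <-respʳ-≈ (solve 2 (λ x y → (y :- x) :+ x := y) refl x y)
    (<-respˡ-≈ (+-identityˡ x) (+-monoˡ-< x 0<y-x))

  <0⇒0<- : ∀ {x} → x < 0# → 0# < - x
  <0⇒0<- {x} x<0 = 0<≈ (+-identityˡ (- x)) (<⇒0<- x<0)

  0<-⇒<0 : ∀ {x} → 0# < - x → x < 0#
  0<-⇒<0 {x} 0<-x = 0<-⇒< (0<≈ (sym (+-identityˡ (- x))) 0<-x)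

  0<⇒-<0 : ∀ {x} → 0# < x → - x < 0#
  0<⇒-<0 {x} 0<x = 0<-⇒<0 (0<≈ (solve 1 (λ x → x := :- (:- x)) refl x) 0<x)

  <⇒≤ : ∀ {x y} → x < y → x ≤ y
  <⇒≤ = inj₁

  ≤-refl : ∀ {x} → x ≤ x
  ≤-refl = inj₂ refl

  ≤⇒0≤- : ∀ {x y} → x ≤ y → 0# ≤ y - x
  ≤⇒0≤- (inj₁ x<y) = inj₁ (<⇒0<- x<y)
  ≤⇒0≤- {x} (inj₂ x≈y) = inj₂ (sym (trans (+-congʳ (sym x≈y)) (-‿inverseʳ x)))

  0≤-⇒≤ : ∀ {x y} → 0# ≤ y - x → x ≤ y
  0≤-⇒≤ (inj₁ p) = inj₁ (0<-⇒< p)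
  0≤-⇒≤ {x} {y} (inj₂ p) = inj₂ (trans (sym (+-identityˡ x)) (trans (+-congʳ p)
    (solve 2 (λ x y → (y :- x) :+ x := y) refl x y)))

  ≤0⇒0≤- : ∀ {x} → x ≤ 0# → 0# ≤ - x
  ≤0⇒0≤- {x} x≤0 = 0≤≈ (+-identityˡ (- x)) (≤⇒0≤- x≤0)

  0≤-⇒≤0 : ∀ {x} → 0# ≤ - x → x ≤ 0#
  0≤-⇒≤0 {x} 0≤-x = 0≤-⇒≤ (0≤≈ (sym (+-identityˡ (- x))) 0≤-x)

  <-≤-absurd : ∀ {x y} → x < y → y ≤ x → ⊥
  <-≤-absurd x<y (inj₁ y<x) = <-asym x<y y<x
  <-≤-absurd x<y (inj₂ y≈x) = <-irrefl (sym y≈x) x<y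

  ≮⇒≥ : ∀ {x y} → ¬ (x < y) → y ≤ x
  ≮⇒≥ {x} {y} x≮y with compare x y
  ... | tri< x<y _ _ = ⊥-elim (x≮y x<y)
  ... | tri≈ _ x≈y _ = inj₂ (sym x≈y)
  ... | tri> _ _ y<x = inj₁ y<x

  <-or-≥ : ∀ x y → x < y ⊎ y ≤ x
  <-or-≥ x y with x <? y
  ... | yes x<y = inj₁ x<y
  ... | no x≮y  = inj₂ (≮⇒≥ x≮y)

  ≤-<-trans : ∀ {x y z} → x ≤ y → y < z → x < z
  ≤-<-trans (inj₁ x<y) y<z = <-trans x<y y<z
  ≤-<-trans (inj₂ x≈y) y<z = <-respˡ-≈ (sym x≈y) y<z

  <-≤-trans : ∀ {x y z} → x < y → y ≤ z → x < z
  <-≤-trans x<y (inj₁ y<z) = <-trans x<y y<z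
  <-≤-trans x<y (inj₂ y≈z) = <-respʳ-≈ y≈z x<y

  0<⇒≉0 : ∀ {x} → 0# < x → ¬ (x ≈ 0#)
  0<⇒≉0 0<x x≈0 = <-irrefl (sym x≈0) 0<x

  0<+ : ∀ {x y} → 0# < x → 0# < y → 0# < x + y
  0<+ {x} {y} 0<x 0<y = <-trans 0<y (<-respˡ-≈ (+-identityˡ y) (+-monoˡ-< y 0<x))

  0≤+0< : ∀ {x y} → 0# ≤ x → 0# < y → 0# < x + y
  0≤+0< (inj₁ 0<x) 0<y = 0<+ 0<x 0<y
  0≤+0< {x} {y} (inj₂ 0≈x) 0<y = 0<≈ (trans (sym (+-identityˡ y)) (+-congʳ 0≈x)) 0<y

  0<+0≤ : ∀ {x y} → 0# < x → 0# ≤ y → 0# < x + y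
  0<+0≤ {x} {y} 0<x 0≤y = 0<≈ (+-comm y x) (0≤+0< 0≤y 0<x)

  0≤+ : ∀ {x y} → 0# ≤ x → 0# ≤ y → 0# ≤ x + y
  0≤+ {x} {y} 0≤x (inj₁ 0<y) = inj₁ (0≤+0< 0≤x 0<y)
  0≤+ {x} {y} 0≤x (inj₂ 0≈y) = 0≤≈ (trans (sym (+-identityʳ x)) (+-congˡ 0≈y)) 0≤x

  0≤* : ∀ {x y} → 0# ≤ x → 0# ≤ y → 0# ≤ x * y
  0≤* (inj₁ 0<x) (inj₁ 0<y) = inj₁ (*-pos 0<x 0<y)
  0≤* {x} {y} (inj₂ 0≈x) _  = inj₂ (sym (trans (*-congʳ (sym 0≈x)) (zeroˡ y)))
  0≤* {x} {y} _ (inj₂ 0≈y)  = inj₂ (sym (trans (*-congˡ (sym 0≈y)) (zeroʳ x)))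

  *-neg-neg : ∀ {x y} → x < 0# → y < 0# → 0# < x * y
  *-neg-neg {x} {y} x<0 y<0 =
    0<≈ (solve 2 (λ x y → (:- x) :* (:- y) := x :* y) refl x y) (*-pos (<0⇒0<- x<0) (<0⇒0<- y<0))

  0≤sq : ∀ x → 0# ≤ x * x
  0≤sq x with compare x 0#
  ... | tri< x<0 _ _ = inj₁ (*-neg-neg x<0 x<0)
  ... | tri≈ _ x≈0 _ = inj₂ (sym (trans (*-congʳ x≈0) (zeroˡ x)))
  ... | tri> _ _ 0<x = inj₁ (*-pos 0<x 0<x)

  0<sq : ∀ {x} → ¬ (x ≈ 0#) → 0# < x * x
  0<sq {x} x≉0 with compare x 0#
  ... | tri< x<0 _ _ = *-neg-neg x<0 x<0
  ... | tri≈ _ x≈0 _ = ⊥-elim (x≉0 x≈0)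
  ... | tri> _ _ 0<x = *-pos 0<x 0<x

  0<-cancelˡ : ∀ {x y} → 0# < x → 0# < x * y → 0# < y
  0<-cancelˡ {x} {y} 0<x 0<xy with <-or-≥ 0# y
  ... | inj₁ 0<y = 0<y
  ... | inj₂ y≤0 = ⊥-elim (<-≤-absurd 0<xy (0≤-⇒≤0
    (0≤≈ (solve 2 (λ x y → x :* (:- y) := :- (x :* y)) refl x y) (0≤* (inj₁ 0<x) (≤0⇒0≤- y≤0)))))

  ⁻¹-inverse : ∀ {x} → 0# < x → x * x ⁻¹ ≈ 1#
  ⁻¹-inverse 0<x = ⁻¹-inverseʳ (0<⇒≉0 0<x)

  0<⁻¹ : ∀ {x} → 0# < x → 0# < x ⁻¹
  0<⁻¹ {x} 0<x = 0<-cancelˡ 0<x (0<≈ (sym (⁻¹-inverse 0<x)) 0<1)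

  *-cancelˡ-0 : ∀ {x y} → ¬ (x ≈ 0#) → x * y ≈ 0# → y ≈ 0#
  *-cancelˡ-0 {x} {y} x≉0 xy≈0 = begin
    y                ≈⟨ *-identityˡ y ⟨
    1# * y           ≈⟨ *-congʳ (⁻¹-inverseʳ x≉0) ⟨
    x * x ⁻¹ * y     ≈⟨ solve 3 (λ x i y → x :* i :* y := i :* (x :* y)) refl x (x ⁻¹) y ⟩
    x ⁻¹ * (x * y)   ≈⟨ *-congˡ xy≈0 ⟩
    x ⁻¹ * 0#        ≈⟨ zeroʳ _ ⟩
    0#               ∎
    where open SetoidReasoning setoid

  -‿≈0 : ∀ {x y} → x ≈ y → x - y ≈ 0#
  -‿≈0 {x} {y} x≈y = trans (+-congʳ x≈y) (-‿inverseʳ y)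

  ≈0⇒≈ : ∀ {x y} → x - y ≈ 0# → x ≈ y
  ≈0⇒≈ {x} {y} e = trans (solve 2 (λ x y → x := (x :- y) :+ y) refl x y) (trans (+-congʳ e) (+-identityˡ y))

  neg-≈0 : ∀ {x} → x ≈ 0# → - x ≈ 0#
  neg-≈0 x≈0 = trans (-‿cong x≈0) (solve 0 (:- con 0ℤ := con 0ℤ) refl)

  half : ∀ {x} → 0# < x → ∃[ h ] 0# < h × h < x
  half {x} 0<x = h , 0<h , 0<-⇒< (0<≈ (begin
      h            ≈⟨ solve 1 (λ h → h := (h :+ h) :- h) refl h ⟩
      (h + h) - h  ≈⟨ +-congʳ eq ⟩
      x - h        ∎) 0<h)
    where
    open SetoidReasoning setoid
    0<2 = 0<+ 0<1 0<1
    h   = x * (1# + 1#) ⁻¹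
    0<h = *-pos 0<x (0<⁻¹ 0<2)
    eq : h + h ≈ x
    eq = trans (solve 2 (λ x i → x :* i :+ x :* i := x :* ((con 1ℤ :+ con 1ℤ) :* i)) refl x ((1# + 1#) ⁻¹))
               (trans (*-congˡ (⁻¹-inverse 0<2)) (*-identityʳ x))

  min : ∀ {x y} → 0# < x → 0# < y → ∃[ m ] 0# < m × m ≤ x × m ≤ y
  min {x} {y} 0<x 0<y with <-or-≥ x y
  ... | inj₁ x<y = x , 0<x , ≤-refl , inj₁ x<y
  ... | inj₂ y≤x = y , 0<y , y≤x , ≤-refl

  -- Replaces limits from the right at 0: such statements are closed under conjunction, and each has
  -- an instance.
  Eventually : ∀ {p} → (Carrier → Set p) → Set _
  Eventually P = ∃[ ε ] 0# < ε × (∀ t → 0# < t → t < ε → P t)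

  infixr 5 _∧ᵉ_
  _∧ᵉ_ : ∀ {p q} {P : Carrier → Set p} {Q : Carrier → Set q} →
         Eventually P → Eventually Q → Eventually (λ t → P t × Q t)
  (ε , 0<ε , P) ∧ᵉ (δ , 0<δ , Q) = let (m , 0<m , m≤ε , m≤δ) = min 0<ε 0<δ in
    m , 0<m , λ t 0<t t<m → P t 0<t (<-≤-trans t<m m≤ε) , Q t 0<t (<-≤-trans t<m m≤δ)

  mapᵉ : ∀ {p q} {P : Carrier → Set p} {Q : Carrier → Set q} →
         (∀ {t} → 0# < t → P t → Q t) → Eventually P → Eventually Q
  mapᵉ f (ε , 0<ε , P) = ε , 0<ε , λ t 0<t t<ε → f 0<t (P t 0<t t<ε)

  instance-of : ∀ {p} {P : Carrier → Set p} → Eventually P → ∃[ t ] 0# < t × P t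
  instance-of (ε , 0<ε , P) = let (t , 0<t , t<ε) = half 0<ε in t , 0<t , P t 0<t t<ε

  <ᵉ : ∀ {b} → 0# < b → Eventually (_< b)
  <ᵉ {b} 0<b = b , 0<b , λ _ _ t<b → t<b

  -- Only a negative slope restricts `t`; the bound is then the zero `x * (- y) ⁻¹` of the function.
  affineᵉ : ∀ {x} → 0# < x → ∀ y → Eventually (λ t → 0# < x + t * y)
  affineᵉ {x} 0<x y with <-or-≥ y 0#
  ... | inj₂ 0≤y = 1# , 0<1 , λ t 0<t _ → 0<+0≤ 0<x (0≤* (inj₁ 0<t) 0≤y)
  ... | inj₁ y<0 = x * i , *-pos 0<x (0<⁻¹ 0<-y) , λ t 0<t t<xi →
      0<≈ (trans (solve 4 (λ x y t i → (x :* i :- t) :* (:- y) := x :* ((:- y) :* i) :+ t :* y) refl x y t i)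
                 (+-congʳ (trans (*-congˡ (⁻¹-inverse 0<-y)) (*-identityʳ x))))
          (*-pos (<⇒0<- t<xi) 0<-y)
    where
    0<-y = <0⇒0<- y<0
    i    = (- y) ⁻¹

  -- `β` is the absolute value of `b`, and the estimate says that `δ * b` is at least `- (ε * β)`
  -- when `δ` is smaller than `ε` in absolute value.
  abs-bound : ∀ b → ∃[ β ] 0# ≤ β × (∀ ε δ → - ε < δ → δ < ε → 0# ≤ ε * β + δ * b)
  abs-bound b with <-or-≥ b 0#
  ... | inj₁ b<0 = - b , inj₁ (<0⇒0<- b<0) , λ ε δ _ δ<ε →
    0≤≈ (solve 3 (λ e d b → (e :- d) :* (:- b) := e :* (:- b) :+ d :* b) refl ε δ b)
        (0≤* (inj₁ (<⇒0<- δ<ε)) (inj₁ (<0⇒0<- b<0)))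
  ... | inj₂ 0≤b = b , 0≤b , λ ε δ -ε<δ _ →
    0≤≈ (solve 3 (λ e d b → (d :- (:- e)) :* b := e :* b :+ d :* b) refl ε δ b)
        (0≤* (inj₁ (<⇒0<- -ε<δ)) 0≤b)

-- Determinants, dot products, segments and affine functionals.

module PlaneProperties {c ℓ₁ ℓ₂ : Level} (K : OrderedField c ℓ₁ ℓ₂) where
  open OrderedField K
  open OrderedFieldProperties K
  open Plane K
  open IntegerSolver commutativeRing
  open SetoidReasoning setoid

  dot : Point → Point → Carrier
  dot (x , y) (x′ , y′) = x * x′ + y * y′

  module _ {n : ℕ} where
    infixl 7 _:+ₚ_ _:-ₚ_
    infixl 8 _:*ₚ_
    _:+ₚ_ _:-ₚ_ : (p q : Polynomial n × Polynomial n) → Polynomial n × Polynomial n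
    (x , y) :+ₚ (x′ , y′) = x :+ x′ , y :+ y′
    (x , y) :-ₚ (x′ , y′) = x :- x′ , y :- y′

    _:*ₚ_ : Polynomial n → Polynomial n × Polynomial n → Polynomial n × Polynomial n
    t :*ₚ (x , y) = t :* x , t :* y

    :rotate : Polynomial n × Polynomial n → Polynomial n × Polynomial n
    :rotate (x , y) = :- y , x

    :det :dot : (p q : Polynomial n × Polynomial n) → Polynomial n
    :det (x , y) (x′ , y′) = x :* y′ :- y :* x′
    :dot (x , y) (x′ , y′) = x :* x′ :+ y :* y′

  ≈ₚ-refl : ∀ {p} → p ≈ₚ p
  ≈ₚ-refl = refl , refl

  ≈ₚ-sym : ∀ {p q} → p ≈ₚ q → q ≈ₚ p
  ≈ₚ-sym (e , e′) = sym e , sym e′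

  ≈ₚ-trans : ∀ {p q r} → p ≈ₚ q → q ≈ₚ r → p ≈ₚ r
  ≈ₚ-trans (e , e′) (f , f′) = trans e f , trans e′ f′

  +ₚ-cong : ∀ {p q p′ q′} → p ≈ₚ p′ → q ≈ₚ q′ → p +ₚ q ≈ₚ p′ +ₚ q′
  +ₚ-cong (e , e′) (f , f′) = +-cong e f , +-cong e′ f′

  -ₚ-cong : ∀ {p q p′ q′} → p ≈ₚ p′ → q ≈ₚ q′ → p -ₚ q ≈ₚ p′ -ₚ q′
  -ₚ-cong (e , e′) (f , f′) = +-cong e (-‿cong f) , +-cong e′ (-‿cong f′)

  *ₚ-cong : ∀ {t t′ p p′} → t ≈ t′ → p ≈ₚ p′ → t *ₚ p ≈ₚ t′ *ₚ p′
  *ₚ-cong e (f , f′) = *-cong e f , *-cong e f′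

  det-cong : ∀ {p q p′ q′} → p ≈ₚ p′ → q ≈ₚ q′ → det p q ≈ det p′ q′
  det-cong (e , e′) (f , f′) = +-cong (*-cong e f′) (-‿cong (*-cong e′ f))

  dot-cong : ∀ {p q p′ q′} → p ≈ₚ p′ → q ≈ₚ q′ → dot p q ≈ dot p′ q′
  dot-cong (e , e′) (f , f′) = +-cong (*-cong e f) (*-cong e′ f′)

  det-antisym : ∀ p q → - det p q ≈ det q p
  det-antisym (a , b) (c , d) =
    solve 4 (λ a b c d → :- :det (a , b) (c , d) := :det (c , d) (a , b)) refl a b c d

  dot-comm : ∀ p q → dot p q ≈ dot q p
  dot-comm (a , b) (c , d) =
    solve 4 (λ a b c d → :dot (a , b) (c , d) := :dot (c , d) (a , b)) refl a b c d

  -- Lagrange's identity: for nonzero vectors the determinant and the dot product cannot both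
  -- vanish.
  det-dot : ∀ p q → dot p q * dot p q + det p q * det p q ≈ dot p p * dot q q
  det-dot (a , b) (c , d) = solve 4 (λ a b c d → let p = a , b; q = c , d in
    :dot p q :* :dot p q :+ :det p q :* :det p q := :dot p p :* :dot q q) refl a b c d

  -- Expansion of r in the orthogonal frame p, rotate p, under det(q , -) and dot(q , -).
  det-expand : ∀ p q r → dot p p * det q r ≈ dot p r * det q p + det p r * dot q p
  det-expand (a , b) (c , d) (e , f) = solve 6 (λ a b c d e f →
    let p = a , b; q = c , d; r = e , f in
    :dot p p :* :det q r := :dot p r :* :det q p :+ :det p r :* :dot q p) refl a b c d e f

  dot-expand : ∀ p q r → dot p p * dot q r ≈ dot p r * dot q p + det p r * det p q
  dot-expand (a , b) (c , d) (e , f) = solve 6 (λ a b c d e f →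
    let p = a , b; q = c , d; r = e , f in
    :dot p p :* :dot q r := :dot p r :* :dot q p :+ :det p r :* :det p q) refl a b c d e f

  0<dot : ∀ {p q} → ¬ (p ≈ₚ q) → 0# < dot (q -ₚ p) (q -ₚ p)
  0<dot {x , y} {x′ , y′} p≉q with (x′ - x) ≟ 0# | (y′ - y) ≟ 0#
  ... | no ≉0 | _      = 0<+0≤ (0<sq ≉0) (0≤sq _)
  ... | yes _ | no ≉0  = 0≤+0< (0≤sq _) (0<sq ≉0)
  ... | yes e | yes e′ = ⊥-elim (p≉q (sym (≈0⇒≈ e) , sym (≈0⇒≈ e′)))

  det-self : ∀ p → det p p ≈ 0#
  det-self (a , b) = solve 2 (λ a b → :det (a , b) (a , b) := con 0ℤ) refl a b

  det-zero-sym : ∀ {p q} → det p q ≈ 0# → det q p ≈ 0#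
  det-zero-sym {p} {q} e = trans (sym (det-antisym p q)) (neg-≈0 e)

  det-nullʳ : ∀ d p → det d (p -ₚ p) ≈ 0#
  det-nullʳ (d , d′) (p , p′) = solve 4 (λ d d′ p p′ →
    :det (d , d′) ((p , p′) :-ₚ (p , p′)) := con 0ℤ) refl d d′ p p′

  det-nullˡ : ∀ d p → det (p -ₚ p) d ≈ 0#
  det-nullˡ d p = det-zero-sym (det-nullʳ d p)

  dot-nullʳ : ∀ d p → dot d (p -ₚ p) ≈ 0#
  dot-nullʳ (d , d′) (p , p′) = solve 4 (λ d d′ p p′ →
    :dot (d , d′) ((p , p′) :-ₚ (p , p′)) := con 0ℤ) refl d d′ p p′

  Diverging : Point → Point → Set _
  Diverging p q = ¬ (det p q ≈ 0# × 0# < dot p q)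

  diverging-sym : ∀ {p q} → Diverging p q → Diverging q p
  diverging-sym {p} {q} div (e , 0<d) = div (det-zero-sym e , 0<≈ (dot-comm q p) 0<d)

  diverging-opposite : ∀ {p q} → 0# < dot p p → 0# < dot q q → Diverging p q →
                       det p q ≈ 0# → dot p q < 0#
  diverging-opposite {p} {q} 0<p 0<q div e with compare (dot p q) 0#
  ... | tri< <0 _ _  = <0
  ... | tri> _ _ 0<d = ⊥-elim (div (e , 0<d))
  ... | tri≈ _ d≈0 _ = ⊥-elim (<-irrefl refl (0<≈ (begin
      dot p p * dot q q                            ≈⟨ det-dot p q ⟨
      dot p q * dot p q + det p q * det p q        ≈⟨ +-cong (*-congʳ d≈0) (*-congʳ e) ⟩
      0# * dot p q + 0# * det p q                  ≈⟨ +-cong (zeroˡ _) (zeroˡ _) ⟩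
      0# + 0#                                      ≈⟨ +-identityˡ 0# ⟩
      0#                                           ∎) (*-pos 0<p 0<q)))

  OnSegment-resp : ∀ {p q x p′ q′ x′} → p ≈ₚ p′ → q ≈ₚ q′ → x ≈ₚ x′ →
                   OnSegment p q x → OnSegment p′ q′ x′
  OnSegment-resp ep eq ex (t , 0≤t , t≤1 , e) = t , 0≤t , t≤1 ,
    ≈ₚ-trans (≈ₚ-sym ex) (≈ₚ-trans e (+ₚ-cong ep (*ₚ-cong refl (-ₚ-cong eq ep))))

  OnSegment-swap : ∀ {p q x} → OnSegment p q x → OnSegment q p x
  OnSegment-swap {a , b} {c , d} (t , 0≤t , t≤1 , e , e′) = 1# - t , ≤⇒0≤- t≤1
    , 0≤-⇒≤ (0≤≈ (solve 1 (λ t → t := con 1ℤ :- (con 1ℤ :- t)) refl t) 0≤t)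
    , trans e (eq a c) , trans e′ (eq b d)
    where
    eq : ∀ a c → a + t * (c - a) ≈ c + (1# - t) * (a - c)
    eq = solve 3 (λ t a c → a :+ t :* (c :- a) := c :+ (con 1ℤ :- t) :* (a :- c)) refl t

  OnSegment-start : ∀ {p q} → OnSegment p q p
  OnSegment-start {a , b} {c , d} = 0# , ≤-refl , inj₁ 0<1 , eq a c , eq b d
    where
    eq = solve 2 (λ a c → a := a :+ con 0ℤ :* (c :- a)) refl

  OnSegment-end : ∀ {p q} → OnSegment p q q
  OnSegment-end = OnSegment-swap OnSegment-start

  OnSegment-≈ : ∀ {p q x} → p ≈ₚ q → OnSegment p q x → p ≈ₚ x
  OnSegment-≈ (e , e′) (t , _ , _ , f , f′) = sym (eq e f) , sym (eq e′ f′)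
    where
    eq : ∀ {a b x} → a ≈ b → x ≈ a + t * (b - a) → x ≈ a
    eq {a} a≈b f = trans f (trans (+-congˡ (trans (*-congˡ (-‿≈0 (sym a≈b))) (zeroʳ t))) (+-identityʳ a))

  -- Explicit coefficients provide both the behaviour along a segment and the bound near a point
  -- under which positivity persists.
  Affine : (Point → Carrier) → Set _
  Affine f = ∃[ α ] ∃[ β ] ∃[ κ ] (∀ x → f x ≈ α * proj₁ x + β * proj₂ x + κ)

  affine-between : ∀ {f} → Affine f → ∀ {p q x} t → x ≈ₚ p +ₚ t *ₚ (q -ₚ p) →
                   f x ≈ (1# - t) * f p + t * f q
  affine-between {f} (α , β , κ , eq) {p@(a , b)} {q@(c , d)} {x} t (e , e′) = begin
    f x                                                ≈⟨ eq x ⟩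
    α * proj₁ x + β * proj₂ x + κ                      ≈⟨ +-congʳ (+-cong (*-congˡ e) (*-congˡ e′)) ⟩
    α * (a + t * (c - a)) + β * (b + t * (d - b)) + κ
      ≈⟨ solve 8 (λ α β κ t a b c d →
           α :* (a :+ t :* (c :- a)) :+ β :* (b :+ t :* (d :- b)) :+ κ :=
           (con 1ℤ :- t) :* (α :* a :+ β :* b :+ κ) :+ t :* (α :* c :+ β :* d :+ κ))
           refl α β κ t a b c d ⟩
    (1# - t) * (α * a + β * b + κ) + t * (α * c + β * d + κ)
      ≈⟨ +-cong (*-congˡ (eq p)) (*-congˡ (eq q)) ⟨
    (1# - t) * f p + t * f q                           ∎

  convex-0< : ∀ {t u v} → 0# ≤ t → t ≤ 1# → 0# < u → 0# < v → 0# < (1# - t) * u + t * v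
  convex-0< 0≤t (inj₁ t<1) 0<u 0<v = 0<+0≤ (*-pos (<⇒0<- t<1) 0<u) (0≤* 0≤t (inj₁ 0<v))
  convex-0< 0≤t (inj₂ t≈1) 0<u 0<v =
    0≤+0< (0≤* (≤⇒0≤- (inj₂ t≈1)) (inj₁ 0<u)) (*-pos (<-respʳ-≈ (sym t≈1) 0<1) 0<v)

  affine-0< : ∀ {f} → Affine f → ∀ {p q x} → OnSegment p q x → 0# < f p → 0# < f q → 0# < f x
  affine-0< af (t , 0≤t , t≤1 , e) 0<p 0<q =
    0<≈ (sym (affine-between af t e)) (convex-0< 0≤t t≤1 0<p 0<q)

  affine-0≤ : ∀ {f} → Affine f → ∀ {p q x} → OnSegment p q x → 0# ≤ f p → 0# ≤ f q → 0# ≤ f x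
  affine-0≤ af (t , 0≤t , t≤1 , e) 0≤p 0≤q = 0≤≈ (sym (affine-between af t e))
    (0≤+ (0≤* (≤⇒0≤- t≤1) 0≤p) (0≤* 0≤t 0≤q))

  affine-neg : ∀ {f} → Affine f → Affine (λ x → - f x)
  affine-neg (α , β , κ , eq) = - α , - β , - κ , λ x → trans (-‿cong (eq x))
    (solve 5 (λ α β κ x y → :- (α :* x :+ β :* y :+ κ) := (:- α) :* x :+ (:- β) :* y :+ (:- κ))
      refl α β κ (proj₁ x) (proj₂ x))

  affine-≤0 : ∀ {f} → Affine f → ∀ {p q x} → OnSegment p q x → f p ≤ 0# → f q ≤ 0# → f x ≤ 0#
  affine-≤0 af on ≤p ≤q = 0≤-⇒≤0 (affine-0≤ (affine-neg af) on (≤0⇒0≤- ≤p) (≤0⇒0≤- ≤q))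

  affine-const- : ∀ {f} κ → Affine f → Affine (λ x → κ - f x)
  affine-const- k (α , β , κ , eq) = - α , - β , k - κ , λ x → trans (+-congˡ (-‿cong (eq x)))
    (solve 6 (λ k α β κ x y → k :- (α :* x :+ β :* y :+ κ) := (:- α) :* x :+ (:- β) :* y :+ (k :- κ))
      refl k α β κ (proj₁ x) (proj₂ x))

  detˡ-affine : ∀ d p → Affine (λ x → det d (x -ₚ p))
  detˡ-affine (d , d′) (p , p′) = - d′ , d , d′ * p - d * p′ , λ x →
    solve 6 (λ d d′ p p′ x x′ → :det (d , d′) ((x , x′) :-ₚ (p , p′)) :=
      (:- d′) :* x :+ d :* x′ :+ (d′ :* p :- d :* p′)) refl d d′ p p′ (proj₁ x) (proj₂ x)

  detʳ-affine : ∀ d p → Affine (λ x → det (x -ₚ p) d)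
  detʳ-affine (d , d′) (p , p′) = d′ , - d , d * p′ - d′ * p , λ x →
    solve 6 (λ d d′ p p′ x x′ → :det ((x , x′) :-ₚ (p , p′)) (d , d′) :=
      d′ :* x :+ (:- d) :* x′ :+ (d :* p′ :- d′ :* p)) refl d d′ p p′ (proj₁ x) (proj₂ x)

  dot-affine : ∀ d p → Affine (λ x → dot d (x -ₚ p))
  dot-affine (d , d′) (p , p′) = d , d′ , - (d * p + d′ * p′) , λ x →
    solve 6 (λ d d′ p p′ x x′ → :dot (d , d′) ((x , x′) :-ₚ (p , p′)) :=
      d :* x :+ d′ :* x′ :+ (:- (d :* p :+ d′ :* p′))) refl d d′ p p′ (proj₁ x) (proj₂ x)

  functional-separates : ∀ {f} → Affine f → ∀ {p q a b x} → 0# < f p → 0# < f q → f a ≤ 0# → f b ≤ 0# →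
              OnSegment p q x → ¬ OnSegment a b x
  functional-separates af 0<p 0<q ≤a ≤b on-pq on-ab =
    <-≤-absurd (affine-0< af on-pq 0<p 0<q) (affine-≤0 af on-ab ≤a ≤b)

  -- Square neighbourhoods.

  Near : ∀ {p} → Point → (Point → Set p) → Set _
  Near z P = ∃[ ε ] 0# < ε × (∀ x → Within ε z x → P x)

  Within-mono : ∀ {ε δ z x} → ε ≤ δ → Within ε z x → Within δ z x
  Within-mono {ε} {δ} ε≤δ ((a , b) , (a′ , b′)) = (lo a , hi b) , (lo a′ , hi b′)
    where
    lo : ∀ {z x} → z - ε < x → z - δ < x
    lo {z} {x} l = 0<-⇒< (0<≈ (solve 4 (λ e d z x → (x :- (z :- e)) :+ (d :- e) := x :- (z :- d)) refl ε δ z x)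
      (0<+0≤ (<⇒0<- l) (≤⇒0≤- ε≤δ)))
    hi : ∀ {z x} → x < z + ε → x < z + δ
    hi {z} {x} l = 0<-⇒< (0<≈ (solve 4 (λ e d z x → ((z :+ e) :- x) :+ (d :- e) := (z :+ d) :- x) refl ε δ z x)
      (0<+0≤ (<⇒0<- l) (≤⇒0≤- ε≤δ)))

  infixr 5 _∧ⁿ_
  _∧ⁿ_ : ∀ {p q z} {P : Point → Set p} {Q : Point → Set q} →
         Near z P → Near z Q → Near z (λ x → P x × Q x)
  (ε , 0<ε , P) ∧ⁿ (δ , 0<δ , Q) = let (m , 0<m , m≤ε , m≤δ) = min 0<ε 0<δ in
    m , 0<m , λ x w → P x (Within-mono m≤ε w) , Q x (Within-mono m≤δ w)

  mapⁿ : ∀ {p q z} {P : Point → Set p} {Q : Point → Set q} → (∀ x → P x → Q x) → Near z P → Near z Q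
  mapⁿ f (ε , 0<ε , P) = ε , 0<ε , λ x w → f x (P x w)

  Within-convex : ∀ {ε z p q x} → Within ε z p → Within ε z q → OnSegment p q x → Within ε z x
  Within-convex {ε} {z , z′} {p , p′} {q , q′} {x , x′}
                ((a , b) , (a′ , b′)) ((c , d) , (c′ , d′)) (t , 0≤t , t≤1 , e , e′) =
    (lo a c e , hi b d e) , (lo a′ c′ e′ , hi b′ d′ e′)
    where
    lo : ∀ {z p q x} → z - ε < p → z - ε < q → x ≈ p + t * (q - p) → z - ε < x
    lo {z} {p} {q} {x} l m e = <-respʳ-≈ (sym e) (0<-⇒< (0<≈
      (solve 5 (λ t z e p q → (con 1ℤ :- t) :* (p :- (z :- e)) :+ t :* (q :- (z :- e)) :=
        (p :+ t :* (q :- p)) :- (z :- e)) refl t z ε p q) (convex-0< 0≤t t≤1 (<⇒0<- l) (<⇒0<- m))))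
    hi : ∀ {z p q x} → p < z + ε → q < z + ε → x ≈ p + t * (q - p) → x < z + ε
    hi {z} {p} {q} {x} l m e = <-respˡ-≈ (sym e) (0<-⇒< (0<≈
      (solve 5 (λ t z e p q → (con 1ℤ :- t) :* ((z :+ e) :- p) :+ t :* ((z :+ e) :- q) :=
        (z :+ e) :- (p :+ t :* (q :- p))) refl t z ε p q) (convex-0< 0≤t t≤1 (<⇒0<- l) (<⇒0<- m))))

  Within-open : ∀ {ε z x} → Within ε z x → ∀ n → Eventually (λ t → Within ε z (x +ₚ t *ₚ n))
  Within-open {ε} {z , z′} {x , x′} ((a , b) , (a′ , b′)) (n , n′) =
    mapᵉ (λ _ ((a , b) , (a′ , b′)) → (a , b) , (a′ , b′)) ((lo a ∧ᵉ hi b) ∧ᵉ (lo a′ ∧ᵉ hi b′))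
    where
    lo : ∀ {z x n} → z - ε < x → Eventually (λ t → z - ε < x + t * n)
    lo {z} {x} {n} l = mapᵉ (λ {t} _ 0< → 0<-⇒< (0<≈
      (solve 5 (λ x z e t n → (x :- (z :- e)) :+ t :* n := (x :+ t :* n) :- (z :- e)) refl x z ε t n) 0<))
      (affineᵉ (<⇒0<- l) n)
    hi : ∀ {z x n} → x < z + ε → Eventually (λ t → x + t * n < z + ε)
    hi {z} {x} {n} l = mapᵉ (λ {t} _ 0< → 0<-⇒< (0<≈
      (solve 5 (λ x z e t n → ((z :+ e) :- x) :+ t :* (:- n) := (z :+ e) :- (x :+ t :* n)) refl x z ε t n) 0<))
      (affineᵉ (<⇒0<- l) (- n))

  Within-centre : ∀ {ε z} → 0# < ε → Within ε z z
  Within-centre {ε} {z , z′} 0<ε = (lo z , hi z) , (lo z′ , hi z′)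
    where
    lo : ∀ z → z - ε < z
    lo z = 0<-⇒< (0<≈ (solve 2 (λ z e → e := z :- (z :- e)) refl z ε) 0<ε)
    hi : ∀ z → z < z + ε
    hi z = 0<-⇒< (0<≈ (solve 2 (λ z e → e := (z :+ e) :- z) refl z ε) 0<ε)

  Near-ray : ∀ {p z} {P : Point → Set p} → Near z P → ∀ n → Eventually (λ t → P (z +ₚ t *ₚ n))
  Near-ray (ε , 0<ε , P) n = mapᵉ (λ _ → P _) (Within-open (Within-centre 0<ε) n)

  -- Within distance `ε` in each coordinate the value drops by at most `ε * (a + b)`, where `a` and
  -- `b` are the absolute values of the coefficients, so `ε` is chosen with `f z + ε * - (a + b)`
  -- positive.
  affine-near : ∀ {f z} → Affine f → 0# < f z → Near z (λ x → 0# < f x)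
  affine-near {f} {z@(z₁ , z₂)} (α , β , κ , eq) 0<fz =
    let (a , 0≤a , boundα) = abs-bound α
        (b , 0≤b , boundβ) = abs-bound β
        (ε , 0<ε , 0<) = instance-of (affineᵉ 0<fz (- (a + b)))
    in ε , 0<ε , λ x@(x₁ , x₂) ((l , h) , (l′ , h′)) → 0<≈ (begin
        (f z + ε * - (a + b)) + ((ε * a + (x₁ - z₁) * α) + (ε * b + (x₂ - z₂) * β))
          ≈⟨ +-congʳ (+-congʳ (eq z)) ⟩
        ((α * z₁ + β * z₂ + κ) + ε * - (a + b)) + ((ε * a + (x₁ - z₁) * α) + (ε * b + (x₂ - z₂) * β))
          ≈⟨ solve 10 (λ α β κ z₁ z₂ x₁ x₂ ε a b →
               ((α :* z₁ :+ β :* z₂ :+ κ) :+ ε :* (:- (a :+ b))) :+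
               ((ε :* a :+ (x₁ :- z₁) :* α) :+ (ε :* b :+ (x₂ :- z₂) :* β)) :=
               α :* x₁ :+ β :* x₂ :+ κ) refl α β κ z₁ z₂ x₁ x₂ ε a b ⟩
        α * x₁ + β * x₂ + κ                     ≈⟨ eq x ⟨
        f x                                     ∎)
      (0<+0≤ 0< (0≤+ (boundα ε _ (lo l) (hi h)) (boundβ ε _ (lo l′) (hi h′))))
    where
    lo : ∀ {z x ε} → z - ε < x → - ε < x - z
    lo {z} {x} {ε} l = 0<-⇒< (0<≈ (solve 3 (λ z x e → x :- (z :- e) := (x :- z) :- (:- e)) refl z x ε) (<⇒0<- l))
    hi : ∀ {z x ε} → x < z + ε → x - z < ε
    hi {z} {x} {ε} l = 0<-⇒< (0<≈ (solve 3 (λ z x e → (z :+ e) :- x := e :- (x :- z)) refl z x ε) (<⇒0<- l))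

  -- The parameter is that of the orthogonal projection, `τ` over the squared length. In the frame
  -- of `b -ₚ a` and its rotation, `z -ₚ a` has no second component, since that component is the
  -- vanishing determinant.
  collinear-on-segment : ∀ {a b z} → 0# < dot (b -ₚ a) (b -ₚ a) → det (b -ₚ a) (z -ₚ a) ≈ 0# →
                         0# ≤ dot (b -ₚ a) (z -ₚ a) → dot (b -ₚ a) (z -ₚ b) ≤ 0# → OnSegment a b z
  collinear-on-segment {a₀} {b₀} {z₀} 0<dd δ≈0 0≤τ τ′≤0 =
    τ * i , 0≤* 0≤τ (inj₁ (0<⁻¹ 0<dd)) , τi≤1 , z≈₁ , z≈₂
    where
    τ = dot (b₀ -ₚ a₀) (z₀ -ₚ a₀)
    dd = dot (b₀ -ₚ a₀) (b₀ -ₚ a₀)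
    i = dd ⁻¹
    τi≤1 : τ * i ≤ 1#
    τi≤1 = 0≤-⇒≤ (0≤≈ (trans (trans (*-congʳ
        (solve 6 (λ a a′ b b′ z z′ → :- :dot ((b , b′) :-ₚ (a , a′)) ((z , z′) :-ₚ (b , b′)) :=
           :dot ((b , b′) :-ₚ (a , a′)) ((b , b′) :-ₚ (a , a′)) :- :dot ((b , b′) :-ₚ (a , a′)) ((z , z′) :-ₚ (a , a′)))
           refl (proj₁ a₀) (proj₂ a₀) (proj₁ b₀) (proj₂ b₀) (proj₁ z₀) (proj₂ z₀)))
        (solve 3 (λ d t i → (d :- t) :* i := d :* i :- t :* i) refl dd τ i))
        (+-congʳ (⁻¹-inverse 0<dd)))
      (0≤* (≤0⇒0≤- τ′≤0) (inj₁ (0<⁻¹ 0<dd))))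
    coordinate : ∀ {z a b y} → dd * (z - a) ≈ τ * (b - a) + det (b₀ -ₚ a₀) (z₀ -ₚ a₀) * y → z ≈ a + τ * i * (b - a)
    coordinate {z} {a} {b} {y} expansion = begin
      z                               ≈⟨ solve 2 (λ a z → z := a :+ con 1ℤ :* (z :- a)) refl a z ⟩
      a + 1# * (z - a)                ≈⟨ +-congˡ (*-congʳ (⁻¹-inverse 0<dd)) ⟨
      a + dd * i * (z - a)            ≈⟨ +-congˡ (solve 3 (λ d i y → d :* i :* y := i :* (d :* y)) refl dd i _) ⟩
      a + i * (dd * (z - a))          ≈⟨ +-congˡ (*-congˡ (trans expansion (+-congˡ (*-congʳ δ≈0)))) ⟩
      a + i * (τ * (b - a) + 0# * y)
        ≈⟨ solve 5 (λ a i τ e y → a :+ i :* (τ :* e :+ con 0ℤ :* y) := a :+ τ :* i :* e) refl a i τ _ y ⟩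
      a + τ * i * (b - a)             ∎
    z≈₁ : proj₁ z₀ ≈ proj₁ a₀ + τ * i * (proj₁ b₀ - proj₁ a₀)
    z≈₁ = coordinate (solve 6 (λ a a′ b b′ z z′ →
      let d = (b , b′) :-ₚ (a , a′); y = (z , z′) :-ₚ (a , a′) in
      :dot d d :* (z :- a) := :dot d y :* (b :- a) :+ :det d y :* (a′ :- b′))
      refl (proj₁ a₀) (proj₂ a₀) (proj₁ b₀) (proj₂ b₀) (proj₁ z₀) (proj₂ z₀))
    z≈₂ : proj₂ z₀ ≈ proj₂ a₀ + τ * i * (proj₂ b₀ - proj₂ a₀)
    z≈₂ = coordinate (solve 6 (λ a a′ b b′ z z′ →
      let d = (b , b′) :-ₚ (a , a′); y = (z , z′) :-ₚ (a , a′) in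
      :dot d d :* (z′ :- a′) := :dot d y :* (b′ :- a′) :+ :det d y :* (b :- a))
      refl (proj₁ a₀) (proj₂ a₀) (proj₁ b₀) (proj₂ b₀) (proj₁ z₀) (proj₂ z₀))

  -- A linear functional separates the point from the segment.
  off-segment-near : ∀ {a b z} → 0# < dot (b -ₚ a) (b -ₚ a) → ¬ OnSegment a b z →
                     Near z (λ x → ¬ OnSegment a b x)
  off-segment-near {a} {b} {z} 0<dd off with compare (det (b -ₚ a) (z -ₚ a)) 0#
  ... | tri> _ _ 0<δ = mapⁿ (λ x 0< on → functional-separates (detˡ-affine (b -ₚ a) a) 0< 0<
          (inj₂ (det-nullʳ (b -ₚ a) a)) (inj₂ (det-self _)) OnSegment-start on)
        (affine-near (detˡ-affine (b -ₚ a) a) 0<δ)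
  ... | tri< δ<0 _ _ = mapⁿ (λ x 0< on → functional-separates (detʳ-affine (b -ₚ a) a) 0< 0<
          (inj₂ (det-nullˡ (b -ₚ a) a)) (inj₂ (det-self _)) OnSegment-start on)
        (affine-near (detʳ-affine (b -ₚ a) a) (0<≈ (det-antisym (b -ₚ a) (z -ₚ a)) (<0⇒0<- δ<0)))
  -- The point is on the line of the segment, so a functional along the line has to separate it: the
  -- point lies before `a` or beyond `b`.
  ... | tri≈ _ δ≈0 _ with <-or-≥ (dot (b -ₚ a) (z -ₚ a)) 0#
  ...   | inj₁ τ<0 = mapⁿ (λ x 0< on → functional-separates af 0< 0<
            (inj₂ (neg-≈0 (dot-nullʳ (b -ₚ a) a))) (<⇒≤ (0<⇒-<0 0<dd)) OnSegment-start on)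
          (affine-near af (<0⇒0<- τ<0))
    where
    af = affine-neg (dot-affine (b -ₚ a) a)
  ...   | inj₂ 0≤τ with <-or-≥ 0# (dot (b -ₚ a) (z -ₚ b))
  ...     | inj₁ 0<τ′ = mapⁿ (λ x 0< on → functional-separates af 0< 0<
              (<⇒≤ fa) (inj₂ (dot-nullʳ (b -ₚ a) b)) OnSegment-start on)
            (affine-near af 0<τ′)
    where
    af = dot-affine (b -ₚ a) b
    fa : dot (b -ₚ a) (a -ₚ b) < 0#
    fa = 0<-⇒<0 (0<≈ (solve 4 (λ a a′ b b′ → :dot ((b , b′) :-ₚ (a , a′)) ((b , b′) :-ₚ (a , a′)) :=
           :- :dot ((b , b′) :-ₚ (a , a′)) ((a , a′) :-ₚ (b , b′)))
           refl (proj₁ a) (proj₂ a) (proj₁ b) (proj₂ b)) 0<dd)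
  ...     | inj₂ τ′≤0 = ⊥-elim (off (collinear-on-segment 0<dd δ≈0 0≤τ τ′≤0))

  -- Rays and sectors at a point.

  Ray : Point → Point → Point → Set _
  Ray z n x = ∃[ s ] 0# ≤ s × x ≈ₚ z +ₚ s *ₚ n

  det-rayˡ : ∀ v z n s → det v ((z +ₚ s *ₚ n) -ₚ z) ≈ s * det v n
  det-rayˡ (v , v′) (z , z′) (n , n′) s = solve 7 (λ v v′ z z′ n n′ s →
    :det (v , v′) (((z , z′) :+ₚ s :*ₚ (n , n′)) :-ₚ (z , z′)) := s :* :det (v , v′) (n , n′))
    refl v v′ z z′ n n′ s

  det-rayʳ : ∀ v z n s → det ((z +ₚ s *ₚ n) -ₚ z) v ≈ s * det n v
  det-rayʳ (v , v′) (z , z′) (n , n′) s = solve 7 (λ v v′ z z′ n n′ s →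
    :det (((z , z′) :+ₚ s :*ₚ (n , n′)) :-ₚ (z , z′)) (v , v′) := s :* :det (n , n′) (v , v′))
    refl v v′ z z′ n n′ s

  *-nonpos : ∀ {x y} → 0# ≤ x → y ≤ 0# → x * y ≤ 0#
  *-nonpos {x} {y} 0≤x y≤0 = 0≤-⇒≤0 (0≤≈ (solve 2 (λ x y → x :* (:- y) := :- (x :* y)) refl x y)
    (0≤* 0≤x (≤0⇒0≤- y≤0)))

  *-zeroʳ-≈ : ∀ x {y} → y ≈ 0# → x * y ≈ 0#
  *-zeroʳ-≈ x e = trans (*-congˡ e) (zeroʳ x)

  det-Rayˡ-≤0 : ∀ {v z n x} → det v n ≤ 0# → Ray z n x → det v (x -ₚ z) ≤ 0#
  det-Rayˡ-≤0 {v} {z} {n} ≤0 (s , 0≤s , e) = ≤-respˡ-≈ (sym (trans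
    (det-cong ≈ₚ-refl (-ₚ-cong e ≈ₚ-refl)) (det-rayˡ v z n s))) (*-nonpos 0≤s ≤0)

  det-Rayʳ-≤0 : ∀ {v z n x} → det n v ≤ 0# → Ray z n x → det (x -ₚ z) v ≤ 0#
  det-Rayʳ-≤0 {v} {z} {n} ≤0 (s , 0≤s , e) = ≤-respˡ-≈ (sym (trans
    (det-cong (-ₚ-cong e ≈ₚ-refl) ≈ₚ-refl) (det-rayʳ v z n s))) (*-nonpos 0≤s ≤0)

  -- w lies in the open sector swept by turning counterclockwise from v to u.
  Sector : Point → Point → Point → Set _
  Sector v u w = (0# < det v u × 0# < det v w × 0# < det w u)
               ⊎ (det v u ≤ 0# × (0# < det v w ⊎ 0# < det w u))

  -- A sector of at least half a turn is a union of two open half-planes, and a direction common to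
  -- both is required. For a larger angle this is the negative of the sum of the arms; for exactly
  -- half a turn the arms are opposite and the normal of one of them serves.
  reflex-witness : ∀ {v u} → 0# < dot v v → 0# < dot u u → Diverging v u → det v u ≤ 0# →
                   ∃[ w ] 0# < det v w × 0# < det w u
  reflex-witness {v@(a , b)} {u@(c , d)} 0<v 0<u div (inj₁ <0) = (- (a + c) , - (b + d))
    , 0<≈ (solve 4 (λ a b c d → :- :det (a , b) (c , d) := :det (a , b) (:- (a :+ c) , :- (b :+ d)))
            refl a b c d) (<0⇒0<- <0)
    , 0<≈ (solve 4 (λ a b c d → :- :det (a , b) (c , d) := :det (:- (a :+ c) , :- (b :+ d)) (c , d))
            refl a b c d) (<0⇒0<- <0)
  reflex-witness {v@(a , b)} {u@(c , d)} 0<v 0<u div (inj₂ ≈0) = rotate v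
    , 0<≈ (solve 2 (λ a b → :dot (a , b) (a , b) := :det (a , b) (:rotate (a , b))) refl a b) 0<v
    , 0<≈ (solve 4 (λ a b c d → :- :dot (a , b) (c , d) := :det (:rotate (a , b)) (c , d)) refl a b c d)
        (<0⇒0<- (diverging-opposite 0<v 0<u div ≈0))

  module _ {o : Level} {z v u : Point} (Off : Point → Set o)
           (near : Near z (λ x → ¬ Ray z u x → ¬ Ray z v x → Off x))
           (0<v : 0# < dot v v) (0<u : 0# < dot u u) (div : Diverging v u) where
    private
      Path : Point → Point → Set _
      Path = Star (λ p q → ∀ x → OnSegment p q x → Off x)

      δ = proj₁ near

      segment : ∀ {f g x y} → Affine f → Affine g → (∀ {t} → Ray z u t → f t ≤ 0#) →
                (∀ {t} → Ray z v t → g t ≤ 0#) → Within δ z x → Within δ z y →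
                0# < f x → 0# < f y → 0# < g x → 0# < g y → Path x y
      segment af ag f≤ g≤ wx wy fx fy gx gy = (λ t on →
        proj₂ (proj₂ near) t (Within-convex wx wy on)
          (λ ray → <-≤-absurd (affine-0< af on fx fy) (f≤ ray))
          (λ ray → <-≤-absurd (affine-0< ag on gx gy) (g≤ ray))) ◅ nil

      afᵛ = detˡ-affine v z
      afᵘ = detʳ-affine u z

      onᵛ : ∀ {x y} → det v u ≤ 0# → Within δ z x → Within δ z y →
            0# < det v (x -ₚ z) → 0# < det v (y -ₚ z) → Path x y
      onᵛ ≤0 wx wy px py = segment afᵛ afᵛ (det-Rayˡ-≤0 ≤0) (det-Rayˡ-≤0 (inj₂ (det-self v))) wx wy px py px py

      onᵘ : ∀ {x y} → det v u ≤ 0# → Within δ z x → Within δ z y →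
            0# < det (x -ₚ z) u → 0# < det (y -ₚ z) u → Path x y
      onᵘ ≤0 wx wy px py = segment afᵘ afᵘ (det-Rayʳ-≤0 (inj₂ (det-self u))) (det-Rayʳ-≤0 ≤0) wx wy px py px py

      witness : det v u ≤ 0# → ∃[ y ] Within δ z y × 0# < det v (y -ₚ z) × 0# < det (y -ₚ z) u
      witness ≤0 = let (w , 0<vw , 0<wu) = reflex-witness 0<v 0<u div ≤0
                       (t , 0<t , within) = instance-of (Within-open (Within-centre (proj₁ (proj₂ near))) w)
                   in _ , within , 0<≈ (sym (det-rayˡ v z w t)) (*-pos 0<t 0<vw)
                                 , 0<≈ (sym (det-rayʳ u z w t)) (*-pos 0<t 0<wu)

    -- A sector of less than half a turn is convex. Otherwise each of the two half-planes forming it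
    -- avoids both rays, and paths inside the half-planes suffice.
    sector-connected : ∃[ ε ] 0# < ε × (∀ x y → Within ε z x → Within ε z y →
                       Sector v u (x -ₚ z) → Sector v u (y -ₚ z) →
                       Star (λ p q → ∀ x → OnSegment p q x → Off x) x y)
    sector-connected = δ , proj₁ (proj₂ near) , λ x y wx wy sx sy → connect wx wy sx sy
      where
      connect : ∀ {x y} → Within δ z x → Within δ z y → Sector v u (x -ₚ z) → Sector v u (y -ₚ z) → Path x y
      connect wx wy (inj₁ (_ , vx , xu)) (inj₁ (_ , vy , yu)) =
        segment afᵘ afᵛ (det-Rayʳ-≤0 (inj₂ (det-self u))) (det-Rayˡ-≤0 (inj₂ (det-self v))) wx wy xu yu vx vy
      connect wx wy (inj₁ (0< , _)) (inj₂ (≤0 , _)) = ⊥-elim (<-≤-absurd 0< ≤0)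
      connect wx wy (inj₂ (≤0 , _)) (inj₁ (0< , _)) = ⊥-elim (<-≤-absurd 0< ≤0)
      connect wx wy (inj₂ (≤0 , inj₁ vx)) (inj₂ (_ , inj₁ vy)) = onᵛ ≤0 wx wy vx vy
      connect wx wy (inj₂ (≤0 , inj₂ xu)) (inj₂ (_ , inj₂ yu)) = onᵘ ≤0 wx wy xu yu
      -- The two points are known to lie in different half-planes; the path bends at a point of
      -- their intersection.
      connect wx wy (inj₂ (≤0 , inj₁ vx)) (inj₂ (_ , inj₂ yu)) =
        let (_ , wm , vm , mu) = witness ≤0 in onᵛ ≤0 wx wm vx vm ◅◅ onᵘ ≤0 wm wy mu yu
      connect wx wy (inj₂ (≤0 , inj₂ xu)) (inj₂ (_ , inj₁ vy)) =
        let (_ , wm , vm , mu) = witness ≤0 in onᵘ ≤0 wx wm xu mu ◅◅ onᵛ ≤0 wm wy vm vy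

  neg-det-≤ : ∀ {v u} → 0# ≤ det v u → det u v ≤ 0#
  neg-det-≤ {v} {u} 0≤ = 0≤-⇒≤0 (0≤≈ (sym (det-antisym u v)) 0≤)

  neg-det-< : ∀ {v u} → det v u < 0# → 0# < det u v
  neg-det-< {v} {u} <0 = 0<≈ (det-antisym v u) (<0⇒0<- <0)

  module _ {v u w : Point} (0<v : 0# < dot v v) (0<u : 0# < dot u u) (0<w : 0# < dot w w) where
    private
      -- `w` is a negative multiple of `v`, so `det u w` has the sign of `det v u`.
      opposite : Diverging v w → 0# < det v u → det v w ≈ 0# → 0# < det u w
      opposite vw 0<p q≈0 = 0<-cancelˡ 0<v (0<≈ (begin
          (- dot v w) * det v u
            ≈⟨ solve 3 (λ x y z → (:- x) :* y := x :* (:- y) :+ con 0ℤ :* z) refl _ _ _ ⟩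
          dot v w * - det v u + 0# * dot u v                 ≈⟨ +-cong (*-congˡ (det-antisym v u)) (*-congʳ (sym q≈0)) ⟩
          dot v w * det u v + det v w * dot u v              ≈⟨ det-expand v u w ⟨
          dot v v * det u w                                  ∎)
          (*-pos (<0⇒0<- (diverging-opposite 0<v 0<w vw q≈0)) 0<p))

      convex : Diverging v w → Diverging u w → 0# < det v u → Sector v u w ⊎ Sector u v w
      convex vw uw 0<p with compare (det v w) 0# | compare (det w u) 0#
      ... | tri< q<0 _ _ | _            = inj₂ (inj₂ (neg-det-≤ (inj₁ 0<p) , inj₂ (neg-det-< q<0)))
      ... | _            | tri< r<0 _ _ = inj₂ (inj₂ (neg-det-≤ (inj₁ 0<p) , inj₁ (neg-det-< r<0)))
      ... | tri> _ _ 0<q | tri> _ _ 0<r = inj₁ (inj₁ (0<p , 0<q , 0<r))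
      ... | tri≈ _ q≈0 _ | tri≈ _ _ _   = inj₂ (inj₂ (neg-det-≤ (inj₁ 0<p) , inj₁ (opposite vw 0<p q≈0)))
      ... | tri≈ _ q≈0 _ | tri> _ _ 0<r = inj₂ (inj₂ (neg-det-≤ (inj₁ 0<p) , inj₁ (opposite vw 0<p q≈0)))
      -- This case is impossible: `w` is opposite to `u`, which makes `det v w` negative.
      ... | tri> _ _ 0<q | tri≈ _ r≈0 _ = ⊥-elim (<-asym 0<q (0<-⇒<0 (0<-cancelˡ 0<u (0<≈ (begin
          (- dot u w) * det v u
            ≈⟨ solve 3 (λ x y z → (:- x) :* y := :- (x :* y :+ con 0ℤ :* z)) refl _ _ (dot v u) ⟩
          - (dot u w * det v u + 0# * dot v u)               ≈⟨ -‿cong (+-congˡ (*-congʳ (sym uw≈0))) ⟩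
          - (dot u w * det v u + det u w * dot v u)          ≈⟨ -‿cong (det-expand u v w) ⟨
          - (dot u u * det v w)
            ≈⟨ solve 2 (λ x y → :- (x :* y) := x :* (:- y)) refl _ _ ⟩
          dot u u * - det v w                                ∎)
          (*-pos (<0⇒0<- (diverging-opposite 0<u 0<w uw uw≈0)) 0<p)))))
        where
        uw≈0 : det u w ≈ 0#
        uw≈0 = det-zero-sym r≈0

    sector-or-opposite : Diverging v u → Diverging v w → Diverging u w → 0# < det v u ⊎ det v u ≈ 0# →
                         Sector v u w ⊎ Sector u v w
    sector-or-opposite vu vw uw (inj₁ 0<p) = convex vw uw 0<p
    sector-or-opposite vu vw uw (inj₂ p≈0) with compare (det v w) 0# | compare (det w u) 0#
    ... | tri> _ _ 0<q | _            = inj₁ (inj₂ (inj₂ p≈0 , inj₁ 0<q))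
    ... | _            | tri> _ _ 0<r = inj₁ (inj₂ (inj₂ p≈0 , inj₂ 0<r))
    ... | tri< q<0 _ _ | _            = inj₂ (inj₂ (neg-det-≤ (inj₂ (sym p≈0)) , inj₂ (neg-det-< q<0)))
    ... | _            | tri< r<0 _ _ = inj₂ (inj₂ (neg-det-≤ (inj₂ (sym p≈0)) , inj₁ (neg-det-< r<0)))
    -- All three vectors are on one line and each two of them would have to be opposite: `w` and
    -- `u`, both opposite to `v`, point the same way.
    ... | tri≈ _ q≈0 _ | tri≈ _ r≈0 _ = ⊥-elim (<-asym (0<-cancelˡ 0<v (0<≈ (begin
          dot v w * dot u v                          ≈⟨ solve 2 (λ x y → x := x :+ y :* con 0ℤ) refl _ (det v w) ⟩
          dot v w * dot u v + det v w * 0#           ≈⟨ +-congˡ (*-congˡ (sym p≈0)) ⟩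
          dot v w * dot u v + det v w * det v u      ≈⟨ dot-expand v u w ⟨
          dot v v * dot u w                          ∎)
          (*-neg-neg (diverging-opposite 0<v 0<w vw q≈0)
            (<-respˡ-≈ (dot-comm v u) (diverging-opposite 0<v 0<u vu p≈0)))))
          (diverging-opposite 0<u 0<w uw uw≈0))
      where
      uw≈0 : det u w ≈ 0#
      uw≈0 = det-zero-sym r≈0

  two-sectors : ∀ {v u w} → 0# < dot v v → 0# < dot u u → 0# < dot w w →
                Diverging v u → Diverging v w → Diverging u w → Sector v u w ⊎ Sector u v w
  two-sectors {v} {u} 0<v 0<u 0<w vu vw uw with compare (det v u) 0#
  ... | tri> _ _ 0<p = sector-or-opposite 0<v 0<u 0<w vu vw uw (inj₁ 0<p)
  ... | tri≈ _ p≈0 _ = sector-or-opposite 0<v 0<u 0<w vu vw uw (inj₂ p≈0)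
  -- A determinant that is negative from `v` to `u` is positive from `u` to `v`; exchanging the arms
  -- exchanges the two sectors.
  ... | tri< p<0 _ _ with sector-or-opposite 0<u 0<v 0<w (diverging-sym vu) uw vw (inj₁ (neg-det-< p<0))
  ...   | inj₁ s = inj₂ s
  ...   | inj₂ s = inj₁ s

-- Thin strips beside a segment, and the first hit of a segment.

module Hits {c ℓ₁ ℓ₂ : Level} (K : OrderedField c ℓ₁ ℓ₂) where
  open OrderedField K
  open OrderedFieldProperties K
  open Plane K hiding (s)
  open PlaneProperties K
  open IntegerSolver commutativeRing
  open SetoidReasoning setoid

  beside : Point → Point → Carrier → Carrier → Point
  beside p d x t = (p +ₚ x *ₚ d) +ₚ t *ₚ rotate d

  -- A functional separating [a , b] from a thin strip on the left of the open segment p, p + d.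
  StripSeparation : Point → Point → Point → Point → Set _
  StripSeparation p d a b = ∃[ f ] Affine f × f a ≤ 0# × f b ≤ 0# ×
    (∀ x → 0# < x → x < 1# → Eventually (λ t → 0# < f (beside p d x t)))

  -- The height over the line through `p` in direction `d` is itself the functional: it is positive
  -- everywhere strictly to the left.
  strip-above : ∀ {p d a b} → 0# < dot d d → det d (a -ₚ p) ≤ 0# → det d (b -ₚ p) ≤ 0# →
                StripSeparation p d a b
  strip-above {p@(p₁ , p₂)} {d@(d₁ , d₂)} 0<dd a≤ b≤ = _ , detˡ-affine d p , a≤ , b≤ , λ x _ _ →
    1# , 0<1 , λ t 0<t _ → 0<≈ (solve 6 (λ p₁ p₂ d₁ d₂ x t → let p = p₁ , p₂; d = d₁ , d₂ in
      t :* :dot d d := :det d ((p :+ₚ x :*ₚ d :+ₚ t :*ₚ :rotate d) :-ₚ p)) refl p₁ p₂ d₁ d₂ x t)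
      (*-pos 0<t 0<dd)

  -- With `m` the smaller height of `a` and `b`, the functional is `m` minus the height. It equals
  -- `m` on the line itself, hence stays positive for small displacements.
  strip-below : ∀ {p d a b} → 0# < det d (a -ₚ p) → 0# < det d (b -ₚ p) → StripSeparation p d a b
  strip-below {p@(p₁ , p₂)} {d@(d₁ , d₂)} 0<a 0<b = let (m , 0<m , m≤a , m≤b) = min 0<a 0<b
                                                        af = affine-const- m (detˡ-affine d p) in
    _ , af
    , 0≤-⇒≤0 (0≤≈ (solve 2 (λ m y → y :- m := :- (m :- y)) refl m _) (≤⇒0≤- m≤a))
    , 0≤-⇒≤0 (0≤≈ (solve 2 (λ m y → y :- m := :- (m :- y)) refl m _) (≤⇒0≤- m≤b))
    , λ x _ _ → Near-ray (affine-near af (0<≈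
        (solve 6 (λ p₁ p₂ d₁ d₂ x m → let p = p₁ , p₂; d = d₁ , d₂ in
          m := m :- :det d ((p :+ₚ x :*ₚ d) :-ₚ p)) refl p₁ p₂ d₁ d₂ x m) 0<m)) (rotate d)

  -- Cramer's rule: the lines meet at the parameter `g * i` along `d` and `(- fa) * i` along
  -- `[a , b]`, and the hypotheses place these two parameters in their ranges.
  crossing : ∀ {p d a b} → 0# < det d (b -ₚ a) → det d (a -ₚ p) ≤ 0# → 0# < det d (b -ₚ p) →
             0# < det (b -ₚ a) (p -ₚ a) → det (b -ₚ a) (p -ₚ a) < det d (b -ₚ a) →
             ∃[ s ] 0# < s × s < 1# × OnSegment a b (p +ₚ s *ₚ d)
  crossing {p@(p₁ , p₂)} {d@(d₁ , d₂)} {a@(a₁ , a₂)} {b@(b₁ , b₂)} 0<δ fa≤0 0<fb 0<g g<δ =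
    g * i , *-pos 0<g 0<i
    , 0<-⇒< (0<≈ (trans (solve 3 (λ d g i → (d :- g) :* i := d :* i :- g :* i) refl δ g i) (+-congʳ δi≈1))
        (*-pos (<⇒0<- g<δ) 0<i))
    , (- fa) * i , 0≤* (≤0⇒0≤- fa≤0) (inj₁ 0<i)
    , <⇒≤ (0<-⇒< (0<≈ (begin
        fb * i
          ≈⟨ solve 9 (λ p₁ p₂ d₁ d₂ a₁ a₂ b₁ b₂ i → let p = p₁ , p₂; d = d₁ , d₂; a = a₁ , a₂; b = b₁ , b₂ in
               :det d (b :-ₚ p) :* i := :det d (b :-ₚ a) :* i :- (:- :det d (a :-ₚ p)) :* i)
               refl p₁ p₂ d₁ d₂ a₁ a₂ b₁ b₂ i ⟩
        δ * i - (- fa) * i   ≈⟨ +-congʳ δi≈1 ⟩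
        1# - (- fa) * i      ∎) (*-pos 0<fb 0<i)))
    , e₁ , e₂
    where
    δ = det d (b -ₚ a)
    g = det (b -ₚ a) (p -ₚ a)
    fa = det d (a -ₚ p)
    fb = det d (b -ₚ p)
    i = δ ⁻¹
    0<i = 0<⁻¹ 0<δ
    δi≈1 = ⁻¹-inverse 0<δ
    coordinate : ∀ {p d a b} → δ * (p - a) + g * d ≈ (- fa) * (b - a) → p + g * i * d ≈ a + (- fa) * i * (b - a)
    coordinate {p} {d} {a} {b} relation = begin
      p + g * i * d                      ≈⟨ solve 3 (λ p a y → p :+ y := a :+ con 1ℤ :* (p :- a) :+ y) refl p a _ ⟩
      a + 1# * (p - a) + g * i * d       ≈⟨ +-congʳ (+-congˡ (*-congʳ δi≈1)) ⟨
      a + δ * i * (p - a) + g * i * d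
        ≈⟨ solve 6 (λ a δ i y g d → a :+ δ :* i :* y :+ g :* i :* d := a :+ (δ :* y :+ g :* d) :* i)
             refl a δ i _ g d ⟩
      a + (δ * (p - a) + g * d) * i      ≈⟨ +-congˡ (*-congʳ relation) ⟩
      a + (- fa) * (b - a) * i           ≈⟨ +-congˡ (solve 3 (λ x y i → x :* y :* i := x :* i :* y) refl _ _ i) ⟩
      a + (- fa) * i * (b - a)           ∎
    e₁ : p₁ + g * i * d₁ ≈ a₁ + (- fa) * i * (b₁ - a₁)
    e₁ = coordinate (solve 8 (λ p₁ p₂ d₁ d₂ a₁ a₂ b₁ b₂ → let p = p₁ , p₂; d = d₁ , d₂; a = a₁ , a₂; b = b₁ , b₂ in
      :det d (b :-ₚ a) :* (p₁ :- a₁) :+ :det (b :-ₚ a) (p :-ₚ a) :* d₁ := (:- :det d (a :-ₚ p)) :* (b₁ :- a₁))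
      refl p₁ p₂ d₁ d₂ a₁ a₂ b₁ b₂)
    e₂ : p₂ + g * i * d₂ ≈ a₂ + (- fa) * i * (b₂ - a₂)
    e₂ = coordinate (solve 8 (λ p₁ p₂ d₁ d₂ a₁ a₂ b₁ b₂ → let p = p₁ , p₂; d = d₁ , d₂; a = a₁ , a₂; b = b₁ , b₂ in
      :det d (b :-ₚ a) :* (p₂ :- a₂) :+ :det (b :-ₚ a) (p :-ₚ a) :* d₂ := (:- :det d (a :-ₚ p)) :* (b₂ :- a₂))
      refl p₁ p₂ d₁ d₂ a₁ a₂ b₁ b₂)

  -- The line of [a , b] crosses the line p + s d outside 0 < s < 1, so it separates.
  strip-across : ∀ {p d a b} → (∀ s → 0# < s → s < 1# → ¬ OnSegment a b (p +ₚ s *ₚ d)) →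
                 det d (a -ₚ p) ≤ 0# → 0# < det d (b -ₚ p) → StripSeparation p d a b
  strip-across {p@(p₁ , p₂)} {d@(d₁ , d₂)} {a@(a₁ , a₂)} {b@(b₁ , b₂)} off fa≤0 0<fb
    with <-or-≥ 0# (det (b -ₚ a) (p -ₚ a)) | <-or-≥ (det (b -ₚ a) (p -ₚ a)) (det d (b -ₚ a))
  ... | inj₁ 0<g | inj₁ g<δ = ⊥-elim (let (s , 0<s , s<1 , on) = crossing 0<δ fa≤0 0<fb 0<g g<δ in off s 0<s s<1 on)
    where
    0<δ : 0# < det d (b -ₚ a)
    0<δ = 0<≈ (solve 8 (λ p₁ p₂ d₁ d₂ a₁ a₂ b₁ b₂ → let p = p₁ , p₂; d = d₁ , d₂; a = a₁ , a₂; b = b₁ , b₂ in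
        (:- :det d (a :-ₚ p)) :+ :det d (b :-ₚ p) := :det d (b :-ₚ a)) refl p₁ p₂ d₁ d₂ a₁ a₂ b₁ b₂)
      (0≤+0< (≤0⇒0≤- fa≤0) 0<fb)
  ... | inj₂ g≤0 | _ = _ , af , inj₂ (det-nullˡ (b -ₚ a) a) , inj₂ (det-self (b -ₚ a))
    , λ x 0<x _ → Near-ray (affine-near af (0<≈
      (solve 9 (λ p₁ p₂ d₁ d₂ a₁ a₂ b₁ b₂ x → let p = p₁ , p₂; d = d₁ , d₂; a = a₁ , a₂; b = b₁ , b₂ in
        (:- :det (b :-ₚ a) (p :-ₚ a)) :+ x :* ((:- :det d (a :-ₚ p)) :+ :det d (b :-ₚ p)) :=
        :det ((p :+ₚ x :*ₚ d) :-ₚ a) (b :-ₚ a)) refl p₁ p₂ d₁ d₂ a₁ a₂ b₁ b₂ x)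
      (0≤+0< (≤0⇒0≤- g≤0) (*-pos 0<x (0≤+0< (≤0⇒0≤- fa≤0) 0<fb))))) (rotate d)
    where
    af = detʳ-affine (b -ₚ a) a
  ... | inj₁ _ | inj₂ δ≤g = _ , af , inj₂ (det-nullʳ (b -ₚ a) a) , inj₂ (det-self (b -ₚ a))
    , λ x _ x<1 → Near-ray (affine-near af (0<≈
      (solve 9 (λ p₁ p₂ d₁ d₂ a₁ a₂ b₁ b₂ x → let p = p₁ , p₂; d = d₁ , d₂; a = a₁ , a₂; b = b₁ , b₂ in
        (:det (b :-ₚ a) (p :-ₚ a) :- :det d (b :-ₚ a)) :+
        (con 1ℤ :- x) :* ((:- :det d (a :-ₚ p)) :+ :det d (b :-ₚ p)) :=
        :det (b :-ₚ a) ((p :+ₚ x :*ₚ d) :-ₚ a)) refl p₁ p₂ d₁ d₂ a₁ a₂ b₁ b₂ x)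
      (0≤+0< (≤⇒0≤- δ≤g) (*-pos (<⇒0<- x<1) (0≤+0< (≤0⇒0≤- fa≤0) 0<fb))))) (rotate d)
    where
    af = detˡ-affine (b -ₚ a) a

  swap-separation : ∀ {p d a b} → StripSeparation p d a b → StripSeparation p d b a
  swap-separation (f , af , a≤ , b≤ , ev) = f , af , b≤ , a≤ , ev

  strip-separation : ∀ {p d a b} → 0# < dot d d → (∀ s → 0# < s → s < 1# → ¬ OnSegment a b (p +ₚ s *ₚ d)) →
                     StripSeparation p d a b
  strip-separation {p} {d} {a} {b} 0<dd off
    with <-or-≥ 0# (det d (a -ₚ p)) | <-or-≥ 0# (det d (b -ₚ p))
  ... | inj₁ 0<a | inj₁ 0<b = strip-below 0<a 0<b
  ... | inj₂ a≤0 | inj₂ b≤0 = strip-above 0<dd a≤0 b≤0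
  ... | inj₂ a≤0 | inj₁ 0<b = strip-across off a≤0 0<b
  ... | inj₁ 0<a | inj₂ b≤0 = swap-separation
    (strip-across (λ s 0<s s<1 on → off s 0<s s<1 (OnSegment-swap on)) b≤0 0<a)

  strip-off : ∀ {p d a b} → StripSeparation p d a b → ∀ {x y} → 0# < x → x < 1# → 0# < y → y < 1# →
              ∃[ ε ] 0# < ε × (∀ s t → 0# < s → s < ε → 0# < t → t < ε →
                ∀ q → OnSegment (beside p d x s) (beside p d y t) q → ¬ OnSegment a b q)
  strip-off (f , af , a≤ , b≤ , ev) {x} {y} 0<x x<1 0<y y<1 =
    let (ε , 0<ε , P) = ev x 0<x x<1 ∧ᵉ ev y 0<y y<1 in
    ε , 0<ε , λ s t 0<s s<ε 0<t t<ε q →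
      functional-separates af (proj₁ (P s 0<s s<ε)) (proj₂ (P t 0<t t<ε)) a≤ b≤

  on-line : ∀ {a b x} → OnSegment a b x → det (x -ₚ a) (b -ₚ a) ≈ 0#
  on-line {a} {b} (u , _ , _ , e) = trans (det-cong (-ₚ-cong e ≈ₚ-refl) ≈ₚ-refl)
    (trans (det-rayʳ (b -ₚ a) a (b -ₚ a) u) (*-zeroʳ-≈ u (det-self (b -ₚ a))))

  det-advance : ∀ p w a e s → det ((p +ₚ s *ₚ w) -ₚ a) e ≈ det (p -ₚ a) e + s * det w e
  det-advance (p , p′) (w , w′) (a , a′) (e , e′) s = solve 9 (λ p p′ w w′ a a′ e e′ s →
    :det (((p , p′) :+ₚ s :*ₚ (w , w′)) :-ₚ (a , a′)) (e , e′) :=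
    :det ((p , p′) :-ₚ (a , a′)) (e , e′) :+ s :* :det (w , w′) (e , e′)) refl p p′ w w′ a a′ e e′ s

  dot-advance : ∀ p w a e s → dot e ((p +ₚ s *ₚ w) -ₚ a) ≈ dot e (p -ₚ a) + s * dot e w
  dot-advance (p , p′) (w , w′) (a , a′) (e , e′) s = solve 9 (λ p p′ w w′ a a′ e e′ s →
    :dot (e , e′) (((p , p′) :+ₚ s :*ₚ (w , w′)) :-ₚ (a , a′)) :=
    :dot (e , e′) ((p , p′) :-ₚ (a , a′)) :+ s :* :dot (e , e′) (w , w′)) refl p p′ w w′ a a′ e e′ s

  -- The parameter is cut off at 1, so that a miss also yields a value and the first hit of a union
  -- is a minimum. The alternative `s ≈ 1#` records that nothing need have been hit.
  FirstHit : ∀ {o} → (Point → Set o) → Point → Point → Set _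
  FirstHit On p w = ∃[ s ] 0# < s × s ≤ 1# × (∀ t → 0# ≤ t → t < s → ¬ On (p +ₚ t *ₚ w)) ×
                    (s ≈ 1# ⊎ On (p +ₚ s *ₚ w))

  no-hit : ∀ {o} {On : Point → Set o} {p w} → (∀ t → 0# ≤ t → ¬ On (p +ₚ t *ₚ w)) → FirstHit On p w
  no-hit off = 1# , 0<1 , ≤-refl , (λ t 0≤t _ → off t 0≤t) , inj₁ refl

  module _ {a b : Point} (0<dd : 0# < dot (b -ₚ a) (b -ₚ a)) where

    -- p lies on the line through a and b, before a.
    first-hit-before : ∀ {p w} → det w (b -ₚ a) ≈ 0# → det (p -ₚ a) (b -ₚ a) ≈ 0# →
                       dot (b -ₚ a) (p -ₚ a) < 0# → FirstHit (OnSegment a b) p w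
    first-hit-before {p} {w} δ≈0 κ≈0 τ<0 with <-or-≥ 0# (dot (b -ₚ a) w)
    ... | inj₂ m≤0 = no-hit {On = OnSegment a b} {p} {w} λ t 0≤t on → <-≤-absurd
          (0<-⇒<0 (0<≈ (trans (solve 3 (λ x t m → (:- x) :+ t :* (:- m) := :- (x :+ t :* m)) refl _ t _)
                              (-‿cong (sym (dot-advance p w a (b -ₚ a) t))))
            (0<+0≤ (<0⇒0<- τ<0) (0≤* 0≤t (≤0⇒0≤- m≤0)))))
          (on-positive on)
      where
      on-positive : ∀ {x} → OnSegment a b x → 0# ≤ dot (b -ₚ a) (x -ₚ a)
      on-positive on = affine-0≤ (dot-affine (b -ₚ a) a) on (inj₂ (sym (dot-nullʳ (b -ₚ a) a))) (inj₁ 0<dd)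
    ... | inj₁ 0<m = result
      where
      τ = dot (b -ₚ a) (p -ₚ a)
      m = dot (b -ₚ a) w
      -- At this parameter the coordinate along `b -ₚ a` has grown from `τ` to 0, that is, the point
      -- has reached `a`.
      s = (- τ) * m ⁻¹
      0<s : 0# < s
      0<s = *-pos (<0⇒0<- τ<0) (0<⁻¹ 0<m)
      sm≈-τ : s * m ≈ - τ
      sm≈-τ = trans (solve 3 (λ τ m i → τ :* i :* m := τ :* (m :* i)) refl (- τ) m (m ⁻¹))
        (trans (*-congˡ (⁻¹-inverse 0<m)) (*-identityʳ _))
      at-s : dot (b -ₚ a) ((p +ₚ s *ₚ w) -ₚ a) ≈ 0#
      at-s = trans (dot-advance p w a (b -ₚ a) s) (trans (+-congˡ sm≈-τ) (-‿inverseʳ τ))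
      before : ∀ t → t < s → ¬ OnSegment a b (p +ₚ t *ₚ w)
      before t t<s on = <-≤-absurd
        (0<-⇒<0 (0<≈ (begin
          (s - t) * m
            ≈⟨ solve 3 (λ s t m → (s :- t) :* m := s :* m :- t :* m) refl s t m ⟩
          s * m - t * m                              ≈⟨ +-congʳ sm≈-τ ⟩
          - τ - t * m                                ≈⟨ solve 2 (λ x y → :- x :- y := :- (x :+ y)) refl τ (t * m) ⟩
          - (τ + t * m)                              ≈⟨ -‿cong (dot-advance p w a (b -ₚ a) t) ⟨
          - dot (b -ₚ a) ((p +ₚ t *ₚ w) -ₚ a)        ∎) (*-pos (<⇒0<- t<s) 0<m)))
        (affine-0≤ (dot-affine (b -ₚ a) a) on (inj₂ (sym (dot-nullʳ (b -ₚ a) a))) (inj₁ 0<dd))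
      hit : OnSegment a b (p +ₚ s *ₚ w)
      hit = collinear-on-segment 0<dd
        (det-zero-sym (trans (det-advance p w a (b -ₚ a) s)
          (trans (+-cong κ≈0 (*-zeroʳ-≈ s δ≈0)) (+-identityˡ 0#))))
        (inj₂ (sym at-s))
        (0≤-⇒≤0 (inj₁ (0<≈ (begin
          dd                                         ≈⟨ solve 1 (λ x → x := x :- con 0ℤ) refl dd ⟩
          dd - 0#                                    ≈⟨ +-congˡ (-‿cong at-s) ⟨
          dd - dot (b -ₚ a) (x -ₚ a)
            ≈⟨ solve 6 (λ a a′ b b′ x x′ → let d = (b , b′) :-ₚ (a , a′) in
                 :dot d d :- :dot d ((x , x′) :-ₚ (a , a′)) := :- :dot d ((x , x′) :-ₚ (b , b′)))
                 refl (proj₁ a) (proj₂ a) (proj₁ b) (proj₂ b) (proj₁ x) (proj₂ x) ⟩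
          - dot (b -ₚ a) (x -ₚ b)                    ∎) 0<dd)))
        where
        dd = dot (b -ₚ a) (b -ₚ a)
        x = p +ₚ s *ₚ w
      result : FirstHit (OnSegment a b) p w
      result with <-or-≥ s 1#
      ... | inj₁ s<1 = s , 0<s , <⇒≤ s<1 , (λ t _ → before t) , inj₂ hit
      ... | inj₂ 1≤s = 1# , 0<1 , ≤-refl , (λ t _ t<1 → before t (<-≤-trans t<1 1≤s)) , inj₁ refl

  first-hit : ∀ {a b} → 0# < dot (b -ₚ a) (b -ₚ a) → ∀ p w → ¬ OnSegment a b p → FirstHit (OnSegment a b) p w
  first-hit {a} {b} 0<dd p w off with det w (b -ₚ a) ≟ 0#
  -- The line meets the segment at most once here, so deciding whether the ray meets it already
  -- finds the first hit.
  ... | no δ≉0 = transversal (rayMeets? p w a b δ≉0)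
    where
    unique : ∀ {s t} → OnSegment a b (p +ₚ s *ₚ w) → OnSegment a b (p +ₚ t *ₚ w) → s ≈ t
    unique {s} {t} on on′ = ≈0⇒≈ (*-cancelˡ-0 δ≉0 (begin
      det w e * (s - t)
        ≈⟨ solve 4 (λ k m s t → m :* (s :- t) := (k :+ s :* m) :- (k :+ t :* m)) refl (det (p -ₚ a) e) _ s t ⟩
      (det (p -ₚ a) e + s * det w e) - (det (p -ₚ a) e + t * det w e)
        ≈⟨ +-cong (trans (sym (det-advance p w a e s)) (on-line on))
                  (-‿cong (trans (sym (det-advance p w a e t)) (on-line on′))) ⟩
      0# - 0#                                   ≈⟨ -‿inverseʳ 0# ⟩
      0#                                        ∎))
      where e = b -ₚ a
    start-off : ∀ {s} → 0# ≤ s → OnSegment a b (p +ₚ s *ₚ w) → 0# < s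
    start-off (inj₁ 0<s) _ = 0<s
    start-off {s} (inj₂ 0≈s) on = ⊥-elim (off (OnSegment-resp ≈ₚ-refl ≈ₚ-refl
      (stay (proj₁ p) (proj₁ w) , stay (proj₂ p) (proj₂ w)) on))
      where
      stay : ∀ p w → p + s * w ≈ p
      stay p w = trans (+-congˡ (trans (*-congʳ (sym 0≈s)) (zeroˡ w))) (+-identityʳ p)
    transversal : Dec (RayMeets p w a b) → FirstHit (OnSegment a b) p w
    transversal (no miss) = no-hit {On = OnSegment a b} {p} {w} λ t 0≤t on → miss (t , start-off 0≤t on , on)
    transversal (yes (s , 0<s , on)) with <-or-≥ s 1#
    ... | inj₁ s<1 = s , 0<s , <⇒≤ s<1 , (λ t _ t<s on′ → <-irrefl (unique on′ on) t<s) , inj₂ on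
    ... | inj₂ 1≤s = 1# , 0<1 , ≤-refl , (λ t _ t<1 on′ → <-irrefl (unique on′ on) (<-≤-trans t<1 1≤s)) , inj₁ refl
  ... | yes δ≈0 with det (p -ₚ a) (b -ₚ a) ≟ 0#
  ...   | no κ≉0 = no-hit {On = OnSegment a b} {p} {w} λ t _ on → κ≉0 (begin
      det (p -ₚ a) (b -ₚ a)                       ≈⟨ +-identityʳ _ ⟨
      det (p -ₚ a) (b -ₚ a) + 0#                  ≈⟨ +-congˡ (*-zeroʳ-≈ t δ≈0) ⟨
      det (p -ₚ a) (b -ₚ a) + t * det w (b -ₚ a)  ≈⟨ det-advance p w a (b -ₚ a) t ⟨
      det ((p +ₚ t *ₚ w) -ₚ a) (b -ₚ a)           ≈⟨ on-line on ⟩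
      0#                                          ∎)
  ...   | yes κ≈0 with <-or-≥ (dot (b -ₚ a) (p -ₚ a)) 0# | <-or-≥ 0# (dot (b -ₚ a) (p -ₚ b))
  ...     | inj₁ τ<0 | _ = first-hit-before 0<dd δ≈0 κ≈0 τ<0
  ...     | inj₂ 0≤τ | inj₂ τ′≤0 = ⊥-elim (off (collinear-on-segment 0<dd
              (det-zero-sym κ≈0) 0≤τ τ′≤0))
  -- The point lies beyond `b`, which is the preceding case with the ends of the segment exchanged.
  ...     | inj₂ _ | inj₁ 0<τ′ =
    let (s , 0<s , s≤1 , miss , end) = first-hit-before
          (0<≈ (solve 4 (λ a a′ b b′ → let d = (b , b′) :-ₚ (a , a′); e = (a , a′) :-ₚ (b , b′) in :dot d d := :dot e e)
                  refl (proj₁ a) (proj₂ a) (proj₁ b) (proj₂ b)) 0<dd)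
          (trans (solve 6 (λ a a′ b b′ w w′ → let A = a , a′; B = b , b′; W = w , w′ in
                    :det W (A :-ₚ B) := :- :det W (B :-ₚ A))
                   refl (proj₁ a) (proj₂ a) (proj₁ b) (proj₂ b) (proj₁ w) (proj₂ w)) (neg-≈0 δ≈0))
          (trans (solve 6 (λ a a′ b b′ p p′ → let A = a , a′; B = b , b′; P = p , p′ in
                    :det (P :-ₚ B) (A :-ₚ B) := :- :det (P :-ₚ A) (B :-ₚ A))
                   refl (proj₁ a) (proj₂ a) (proj₁ b) (proj₂ b) (proj₁ p) (proj₂ p)) (neg-≈0 κ≈0))
          (0<-⇒<0 (0<≈ (solve 6 (λ a a′ b b′ p p′ → let A = a , a′; B = b , b′; P = p , p′ in
                    :dot (B :-ₚ A) (P :-ₚ B) := :- :dot (A :-ₚ B) (P :-ₚ B))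
                   refl (proj₁ a) (proj₂ a) (proj₁ b) (proj₂ b) (proj₁ p) (proj₂ p)) 0<τ′))
    in s , 0<s , s≤1 , (λ t 0≤t t<s on → miss t 0≤t t<s (OnSegment-swap on)) , swap-end end
    where
    swap-end : ∀ {s x} → s ≈ 1# ⊎ OnSegment b a x → s ≈ 1# ⊎ OnSegment a b x
    swap-end (inj₁ e) = inj₁ e
    swap-end (inj₂ on) = inj₂ (OnSegment-swap on)

-- Simple directed cycles in a graph.

unique-map-injective : ∀ {a b} {A : Set a} {B : Set b} (f : A → B) {xs x y} → Unique (map f xs) →
                       x ∈ xs → y ∈ xs → f x ≡ f y → x ≡ y
unique-map-injective f (_ ∷ _)  (here ≡.refl) (here ≡.refl) _ = ≡.refl
unique-map-injective f (x∉ ∷ _) (here ≡.refl) (there y∈) e = ⊥-elim (All.lookup x∉ (∈-map⁺ f y∈) e)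
unique-map-injective f (y∉ ∷ _) (there x∈) (here ≡.refl) e = ⊥-elim (All.lookup y∉ (∈-map⁺ f x∈) (≡.sym e))
unique-map-injective f (_ ∷ u)  (there x∈) (there y∈) e = unique-map-injective f u x∈ y∈ e

length-1-unique : ∀ {a} {A : Set a} {xs : List A} {x y} → length xs ≡ 1 → x ∈ xs → y ∈ xs → x ≡ y
length-1-unique {xs = _ ∷ []} _ (here ≡.refl) (here ≡.refl) = ≡.refl

module Cycle {n m r : ℕ} (end : Fin r → Bool → Fin n ⊎ Fin m) (o : Orientation r) (Q : List (Fin r))
             (cycle : Graph.Oriented.IsSimpleCycle end o Q) where
  open Graph end
  open Oriented o
  open IsSimpleCycle cycle

  private
    walk-ends : ∀ {u L v} → Walk u L v → map source L ++ v ∷ [] ≡ u ∷ map target L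
    walk-ends []      = ≡.refl
    walk-ends (e ∷ w) = ≡.cong (source e ∷_) (walk-ends w)

    targets↭sources : map target Q ↭ map source Q
    targets↭sources = let (v , w) = walk in
      drop-∷ (↭-trans (↭-reflexive (≡.sym (walk-ends w))) (++-comm (map source Q) (v ∷ [])))

  source-injective : ∀ {e f} → e ∈ Q → f ∈ Q → source e ≡ source f → e ≡ f
  source-injective = unique-map-injective source simple

  target-injective : ∀ {e f} → e ∈ Q → f ∈ Q → target e ≡ target f → e ≡ f
  target-injective = unique-map-injective target
    (PermutationSetoid.Unique-resp-↭ (≡.setoid Vertex) (↭⇒↭ₛ (↭-sym targets↭sources)) simple)

  next : ∀ {e} → e ∈ Q → ∃[ f ] f ∈ Q × source f ≡ target e
  next e∈ = let (f , f∈ , eq) = ∈-map⁻ source (∈-resp-↭ targets↭sources (∈-map⁺ target e∈)) in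
    f , f∈ , ≡.sym eq

  prev : ∀ {e} → e ∈ Q → ∃[ f ] f ∈ Q × target f ≡ source e
  prev e∈ = let (f , f∈ , eq) = ∈-map⁻ target (∈-resp-↭ (↭-sym targets↭sources) (∈-map⁺ source e∈)) in
    f , f∈ , ≡.sym eq

  private
    along : ∀ {p} {P : Edge → Set p} {e L u v} →
            (∀ {f g} → f ∈ e ∷ L → g ∈ e ∷ L → target f ≡ source g → P f → P g) →
            P e → target e ≡ u → Walk u L v → All P L
    along step Pe eq [] = []
    along step Pe eq (e ∷ w) = let Pf = step (here ≡.refl) (there (here ≡.refl)) eq Pe in
      Pf ∷ along (λ f∈ g∈ → step (there f∈) (there g∈)) Pf ≡.refl w

    unroll : ∀ {u v L} → Walk u L v → L ≢ [] → ∃[ e ] ∃[ L′ ] L ≡ e ∷ L′ × Walk (target e) L′ v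
    unroll [] ≢[]      = ⊥-elim (≢[] ≡.refl)
    unroll (e ∷ w) _ = e , _ , ≡.refl , w

    unrolled = unroll (proj₂ walk) nonempty

  root : Edge
  root = proj₁ unrolled

  root∈ : root ∈ Q
  root∈ = ≡.subst (root ∈_) (≡.sym (proj₁ (proj₂ (proj₂ unrolled)))) (here ≡.refl)

  from-root : ∀ {p} (P : Edge → Set p) →
              (∀ {f g} → f ∈ Q → g ∈ Q → target f ≡ source g → P f → P g) →
              P root → ∀ {f} → f ∈ Q → P f
  from-root P step Pe f∈ = let (_ , _ , eq , w) = unrolled in
    All.lookup (Pe ∷ along (λ f∈ g∈ → step (≡.subst (_ ∈_) (≡.sym eq) f∈) (≡.subst (_ ∈_) (≡.sym eq) g∈)) Pe ≡.refl w)
      (≡.subst (_ ∈_) eq f∈)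

  incident-source : ∀ e → Incident (source e) e
  incident-source e with o e
  ... | false = inj₁ ≡.refl
  ... | true  = inj₂ ≡.refl

  incident-target : ∀ e → Incident (target e) e
  incident-target e with o e
  ... | false = inj₂ ≡.refl
  ... | true  = inj₁ ≡.refl

  incident-cases : ∀ {v} e → Incident v e → source e ≡ v ⊎ target e ≡ v
  incident-cases e inc with o e | inc
  ... | false | inj₁ eq = inj₁ eq
  ... | false | inj₂ eq = inj₂ eq
  ... | true  | inj₁ eq = inj₂ eq
  ... | true  | inj₂ eq = inj₁ eq

  module _ (no-loop : ∀ e → end e false ≢ end e true)
           (degree-boundary : ∀ j → degree (inj₁ j) ≡ 1) where

    source≢target : ∀ e → source e ≢ target e
    source≢target e eq with o e
    ... | false = no-loop e eq
    ... | true  = no-loop e (≡.sym eq)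

    boundary-edge-unique : ∀ {j e f} → Incident (inj₁ j) e → Incident (inj₁ j) f → e ≡ f
    boundary-edge-unique {j} ie if = length-1-unique (degree-boundary j)
      (∈-filter⁺ _ (∈-allFin _) ie) (∈-filter⁺ _ (∈-allFin _) if)

    -- A boundary vertex has only one edge, so the cycle would leave it by the edge on which it
    -- arrives, and that edge would be a loop.
    cycle-avoids-boundary : ∀ {e j} → e ∈ Q → target e ≢ inj₁ j
    cycle-avoids-boundary {e} {j} e∈ eq = let (f , f∈ , eq′) = next e∈ in
      source≢target f (≡.trans eq′ (≡.cong target (boundary-edge-unique
        (≡.subst (λ v → Incident v e) eq (incident-target e))
        (≡.subst (λ v → Incident v f) (≡.trans eq′ eq) (incident-source f)))))

    cycle-target-internal : ∀ {e} → e ∈ Q → ∃[ v ] target e ≡ inj₂ v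
    cycle-target-internal {e} e∈ with target e in eq
    ... | inj₁ j = ⊥-elim (cycle-avoids-boundary e∈ eq)
    ... | inj₂ v = v , ≡.refl

    cycle-source-internal : ∀ {e} → e ∈ Q → ∃[ v ] source e ≡ inj₂ v
    cycle-source-internal e∈ = let (f , f∈ , eq) = prev e∈; (v , eq′) = cycle-target-internal f∈ in
      v , ≡.trans (≡.sym eq) eq′

-- Marks of points and of edges off the cycle.

module Topology {c ℓ₁ ℓ₂ d : Level} (K : OrderedField c ℓ₁ ℓ₂) (disk : Disk K d)
                {n m r : ℕ} (G : PlabicGraph disk n m r) (gauge : GaugeDirection G)
                (o : Orientation r) (Q : List (Fin r))
                (cycle : Graph.Oriented.IsSimpleCycle (PlabicGraph.end G) o Q)
                (regions : EdgeVectors.Regions G gauge Q) where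
  open OrderedField K
  open OrderedFieldProperties K
  open Plane K hiding (s)
  open PlaneProperties K
  open Hits K
  open IntegerSolver commutativeRing
  open Disk disk using (D; convex; Boundary; onBoundary)
  open PlabicGraph G
  open EdgeVectors G gauge
  open Oriented o
  open Cycle end o Q cycle
  open Regions regions

  D-pos : ∀ v → D (pos v)
  D-pos (inj₁ j) = proj₁ (onBoundary _ (τ j , proj₁ (τ-bounds j) , proj₂ (τ-bounds j) , pos-boundary j))
  D-pos (inj₂ v) = let (ε , 0<ε , within) = pos-internal v in within _ (Within-centre 0<ε)

  D-resp : ∀ {p q} → p ≈ₚ q → D p → D q
  D-resp p≈q Dp = convex Dp Dp (OnSegment-resp ≈ₚ-refl ≈ₚ-refl p≈q OnSegment-start)

  OnCycle-resp : ∀ {p q} → p ≈ₚ q → OnCycle Q p → OnCycle Q q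
  OnCycle-resp p≈q (e , e∈ , on) = e , e∈ , OnSegment-resp ≈ₚ-refl ≈ₚ-refl p≈q on

  OffCycle-resp : ∀ {p q} → p ≈ₚ q → OffCycle Q p → OffCycle Q q
  OffCycle-resp p≈q (Dp , off) = D-resp p≈q Dp , λ on → off (OnCycle-resp (≈ₚ-sym p≈q) on)

  Marked : Sign → Point → Set _
  Marked σ p = OffCycle Q p × mark p ≡ σ

  Marked-resp : ∀ {σ p q} → p ≈ₚ q → Marked σ p → Marked σ q
  Marked-resp p≈q (off , eq) = OffCycle-resp p≈q off , ≡.trans (≡.sym (separated
    ((λ x on → OffCycle-resp (OnSegment-≈ p≈q on) off) ◅ nil))) eq

  Marked-unique : ∀ {σ τ p} → Marked σ p → Marked τ p → σ ≡ τ
  Marked-unique (_ , eq) (_ , eq′) = ≡.trans (≡.sym eq) eq′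

  chord-positive : ∀ {u v} → u ≢ v → 0# < dot (pos v -ₚ pos u) (pos v -ₚ pos u)
  chord-positive u≢v = 0<dot (λ e → u≢v (pos-distinct e))

  Ends : Edge → Vertex → Vertex → Set
  Ends e u v = ∃[ x ] end e x ≡ u × end e (not x) ≡ v

  ends-swap : ∀ {e u v} → Ends e u v → Ends e v u
  ends-swap (false , eu , ev) = true , ev , eu
  ends-swap (true  , eu , ev) = false , ev , eu

  ends-oriented : ∀ e → Ends e (source e) (target e)
  ends-oriented e = o e , ≡.refl , ≡.refl

  ends-distinct : ∀ {e u v} → Ends e u v → u ≢ v
  ends-distinct {e} (false , ≡.refl , ≡.refl) eq = no-loop e eq
  ends-distinct {e} (true  , ≡.refl , ≡.refl) eq = no-loop e (≡.sym eq)

  ends-incidentˡ : ∀ {e u v} → Ends e u v → Incident u e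
  ends-incidentˡ (false , eu , _) = inj₁ eu
  ends-incidentˡ (true  , eu , _) = inj₂ eu

  ends-cases : ∀ {e u v t} → Ends e u v → Incident t e → t ≡ u ⊎ t ≡ v
  ends-cases (false , ≡.refl , ≡.refl) (inj₁ ≡.refl) = inj₁ ≡.refl
  ends-cases (false , ≡.refl , ≡.refl) (inj₂ ≡.refl) = inj₂ ≡.refl
  ends-cases (true  , ≡.refl , ≡.refl) (inj₁ ≡.refl) = inj₂ ≡.refl
  ends-cases (true  , ≡.refl , ≡.refl) (inj₂ ≡.refl) = inj₁ ≡.refl

  onEdge⇒ : ∀ {e u v x} → Ends e u v → OnEdge e x → OnSegment (pos u) (pos v) x
  onEdge⇒ (false , ≡.refl , ≡.refl) on = on
  onEdge⇒ (true  , ≡.refl , ≡.refl) on = OnSegment-swap on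

  onEdge⇐ : ∀ {e u v x} → Ends e u v → OnSegment (pos u) (pos v) x → OnEdge e x
  onEdge⇐ (false , ≡.refl , ≡.refl) on = on
  onEdge⇐ (true  , ≡.refl , ≡.refl) on = OnSegment-swap on

  along : Vertex → Vertex → Carrier → Point
  along u v t = pos u +ₚ t *ₚ (pos v -ₚ pos u)

  along-onEdge : ∀ {e u v t} → Ends e u v → 0# ≤ t → t ≤ 1# → OnEdge e (along u v t)
  along-onEdge ends 0≤t t≤1 = onEdge⇐ ends (_ , 0≤t , t≤1 , ≈ₚ-refl)

  along-0 : ∀ {u v} → along u v 0# ≈ₚ pos u
  along-0 {u} {v} = eq _ _ , eq _ _
    where
    eq : ∀ a b → a + 0# * (b - a) ≈ a
    eq = solve 2 (λ a b → a :+ con 0ℤ :* (b :- a) := a) refl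

  along-1 : ∀ {u v} → along u v 1# ≈ₚ pos v
  along-1 {u} {v} = eq _ _ , eq _ _
    where
    eq : ∀ a b → a + 1# * (b - a) ≈ b
    eq = solve 2 (λ a b → a :+ con 1ℤ :* (b :- a) := b) refl

  along-cong : ∀ {u v s t} → s ≈ t → along u v s ≈ₚ along u v t
  along-cong s≈t = +ₚ-cong ≈ₚ-refl (*ₚ-cong s≈t ≈ₚ-refl)

  along-flip : ∀ {u v t} → along v u (1# - t) ≈ₚ along u v t
  along-flip {u} {v} {t} = eq _ _ , eq _ _
    where
    eq : ∀ a b → b + (1# - t) * (a - b) ≈ a + t * (b - a)
    eq a b = solve 3 (λ a b t → b :+ (con 1ℤ :- t) :* (a :- b) := a :+ t :* (b :- a)) refl a b t

  0<1- : ∀ {t} → t < 1# → 0# < 1# - t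
  0<1- = <⇒0<-

  1-<1 : ∀ {t} → 0# < t → 1# - t < 1#
  1-<1 {t} 0<t = 0<-⇒< (0<≈ (solve 1 (λ t → t := con 1ℤ :- (con 1ℤ :- t)) refl t) 0<t)

  along-not-start : ∀ {u v t} → u ≢ v → 0# < t → ¬ (along u v t ≈ₚ pos u)
  along-not-start {u} {v} {t} u≢v 0<t eq = <-irrefl refl (0<≈ (begin
      t * dot w w                                  ≈⟨ advance (pos u) w t ⟨
      dot w (along u v t -ₚ pos u)                 ≈⟨ dot-cong ≈ₚ-refl (-ₚ-cong eq ≈ₚ-refl) ⟩
      dot w (pos u -ₚ pos u)                       ≈⟨ dot-nullʳ w (pos u) ⟩
      0#                                           ∎) (*-pos 0<t (chord-positive u≢v)))
    where
    open SetoidReasoning setoid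
    w = pos v -ₚ pos u
    advance : ∀ p w t → dot w ((p +ₚ t *ₚ w) -ₚ p) ≈ t * dot w w
    advance (p , p′) (w , w′) t = solve 5 (λ p p′ w w′ t →
      :dot (w , w′) (((p , p′) :+ₚ t :*ₚ (w , w′)) :-ₚ (p , p′)) := t :* :dot (w , w′) (w , w′)) refl p p′ w w′ t

  along-not-end : ∀ {u v t} → u ≢ v → t < 1# → ¬ (along u v t ≈ₚ pos v)
  along-not-end u≢v t<1 eq = along-not-start (λ e → u≢v (≡.sym e)) (0<1- t<1) (≈ₚ-trans along-flip eq)

  -- Distinct edges meet only in common vertices, and the only vertices on an edge that are incident
  -- to it are its ends.
  interior-off : ∀ {e f u v t} → Ends e u v → e ≢ f → 0# < t → t < 1# → ¬ OnEdge f (along u v t)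
  interior-off ends e≢f 0<t t<1 onf
    with edges-disjoint e≢f (along-onEdge ends (<⇒≤ 0<t) (<⇒≤ t<1)) onf
  ... | w , ie , _ , eq with ends-cases ends ie
  ...   | inj₁ ≡.refl = along-not-start (ends-distinct ends) 0<t eq
  ...   | inj₂ ≡.refl = along-not-end (ends-distinct ends) t<1 eq

  interior-OffCycle : ∀ {e u v t} → Ends e u v → e ∉ Q → 0# < t → t < 1# → OffCycle Q (along u v t)
  interior-OffCycle {u = u} {v} ends e∉ 0<t t<1 =
    convex (D-pos u) (D-pos v) (_ , <⇒≤ 0<t , <⇒≤ t<1 , ≈ₚ-refl) ,
    λ (f , f∈ , on) → interior-off ends (λ { ≡.refl → e∉ f∈ }) 0<t t<1 on

  vertex-OnCycle : ∀ {e v} → e ∈ Q → Incident v e → OnCycle Q (pos v)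
  vertex-OnCycle e∈ (inj₁ ≡.refl) = _ , e∈ , OnSegment-start
  vertex-OnCycle e∈ (inj₂ ≡.refl) = _ , e∈ , OnSegment-end

  OnCycle-vertex : ∀ {v} → OnCycle Q (pos v) → ∃[ e ] e ∈ Q × Incident v e
  OnCycle-vertex (e , e∈ , on) = e , e∈ , vertices-off-edges on

  -- Both ends are excluded, because they may lie on the cycle, where marks mean nothing.
  Germ : Sign → Point → Point → Set _
  Germ σ z w = ∀ t → 0# < t → t < 1# → Marked σ (z +ₚ t *ₚ w)

  segment-between : ∀ z w {s t x} → OnSegment (z +ₚ s *ₚ w) (z +ₚ t *ₚ w) x →
                    ∃[ u ] 0# ≤ u × u ≤ 1# × x ≈ₚ z +ₚ (s + u * (t - s)) *ₚ w
  segment-between (z , z′) (w , w′) {s} {t} (u , 0≤u , u≤1 , e , e′) =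
    u , 0≤u , u≤1 , trans e (eq z w) , trans e′ (eq z′ w′)
    where
    eq : ∀ z w → (z + s * w) + u * ((z + t * w) - (z + s * w)) ≈ z + (s + u * (t - s)) * w
    eq z w = solve 5 (λ z w s t u → (z :+ s :* w) :+ u :* ((z :+ t :* w) :- (z :+ s :* w)) :=
      z :+ (s :+ u :* (t :- s)) :* w) refl z w s t u

  convex-positive : ∀ {s t u} → 0# ≤ u → u ≤ 1# → 0# < s → 0# < t → 0# < s + u * (t - s)
  convex-positive {s} {t} {u} 0≤u u≤1 0<s 0<t = 0<≈
    (solve 3 (λ s t u → (con 1ℤ :- u) :* s :+ u :* t := s :+ u :* (t :- s)) refl s t u)
    (convex-0< 0≤u u≤1 0<s 0<t)

  convex-below : ∀ {s t u} b → 0# ≤ u → u ≤ 1# → s < b → t < b → s + u * (t - s) < b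
  convex-below {s} {t} {u} b 0≤u u≤1 s<b t<b = 0<-⇒< (0<≈
    (solve 4 (λ s t u b → (con 1ℤ :- u) :* (b :- s) :+ u :* (b :- t) := b :- (s :+ u :* (t :- s))) refl s t u b)
    (convex-0< 0≤u u≤1 (<⇒0<- s<b) (<⇒0<- t<b)))

  segment-constant : ∀ {z w s t} → (∀ u → 0# ≤ u → u ≤ 1# → OffCycle Q (z +ₚ (s + u * (t - s)) *ₚ w)) →
                     mark (z +ₚ s *ₚ w) ≡ mark (z +ₚ t *ₚ w)
  segment-constant {z} {w} off = separated ((λ x on →
    let (u , 0≤u , u≤1 , eq) = segment-between z w on in OffCycle-resp (≈ₚ-sym eq) (off u 0≤u u≤1)) ◅ nil)

  germ-constant : ∀ {z w} → (∀ t → 0# < t → t < 1# → OffCycle Q (z +ₚ t *ₚ w)) →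
                  ∀ {σ t} → 0# < t → t < 1# → mark (z +ₚ t *ₚ w) ≡ σ → Germ σ z w
  germ-constant off 0<t t<1 eq s 0<s s<1 = off s 0<s s<1 ,
    ≡.trans (segment-constant (λ u 0≤u u≤1 → off _ (convex-positive 0≤u u≤1 0<s 0<t) (convex-below 1# 0≤u u≤1 s<1 t<1))) eq

  germ-extend : ∀ {z w} → (∀ t → 0# < t → t ≤ 1# → OffCycle Q (z +ₚ t *ₚ w)) →
                ∀ {σ} → Germ σ z w → Marked σ (z +ₚ 1# *ₚ w)
  germ-extend off germ = let (h , 0<h , h<1) = half 0<1 in off 1# 0<1 ≤-refl ,
    ≡.trans (segment-constant (λ u 0≤u u≤1 → off _ (convex-positive 0≤u u≤1 0<1 0<h)
      (0≤-⇒≤ (0≤≈ (solve 2 (λ u h → u :* (con 1ℤ :- h) := con 1ℤ :- (con 1ℤ :+ u :* (h :- con 1ℤ))) refl u h)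
        (0≤* 0≤u (inj₁ (<⇒0<- h<1))))))) (proj₂ (germ h 0<h h<1))

  germ-reverse : ∀ {u v σ} → Germ σ (pos u) (pos v -ₚ pos u) → Germ σ (pos v) (pos u -ₚ pos v)
  germ-reverse {u} {v} germ t 0<t t<1 = Marked-resp flip (germ (1# - t) (0<1- t<1) (1-<1 0<t))
    where
    flip : along u v (1# - t) ≈ₚ along v u t
    flip = along-flip {v} {u} {t}

  germ-end : ∀ {e u v σ} → Ends e u v → e ∉ Q → ¬ OnCycle Q (pos v) → Germ σ (pos u) (pos v -ₚ pos u) →
             Marked σ (pos v)
  germ-end {u = u} {v} ends e∉ off germ = Marked-resp along-1 (germ-extend off′ germ)
    where
    off′ : ∀ t → 0# < t → t ≤ 1# → OffCycle Q (along u v t)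
    off′ t 0<t (inj₁ t<1) = interior-OffCycle ends e∉ 0<t t<1
    off′ t 0<t (inj₂ t≈1) = OffCycle-resp (≈ₚ-sym (≈ₚ-trans (along-cong t≈1) along-1)) (D-pos v , off)

  edge-germ : ∀ {e u v} → Ends e u v → e ∉ Q → ∃[ σ ] Germ σ (pos u) (pos v -ₚ pos u)
  edge-germ ends e∉ = let (h , 0<h , h<1) = half 0<1 in
    _ , germ-constant (λ t → interior-OffCycle ends e∉) 0<h h<1 ≡.refl

  -- The two sides of an edge of the cycle.

  common-bound : ∀ {p} (R : Carrier → Carrier → Edge → Set p) L →
    (∀ e → e ∈ L → ∃[ ε ] 0# < ε × (∀ s t → 0# < s → s < ε → 0# < t → t < ε → R s t e)) →
    ∃[ ε ] 0# < ε × (∀ s t → 0# < s → s < ε → 0# < t → t < ε → ∀ e → e ∈ L → R s t e)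
  common-bound R [] f = 1# , 0<1 , λ _ _ _ _ _ _ _ ()
  common-bound R (e ∷ L) f =
    let (ε , 0<ε , P) = f e (here ≡.refl)
        (δ , 0<δ , P′) = common-bound R L (λ e e∈ → f e (there e∈))
        (m , 0<m , m≤ε , m≤δ) = min 0<ε 0<δ
    in m , 0<m , λ s t 0<s s<m 0<t t<m → λ where
      _ (here ≡.refl) → P s t 0<s (<-≤-trans s<m m≤ε) 0<t (<-≤-trans t<m m≤ε)
      e (there e∈)    → P′ s t 0<s (<-≤-trans s<m m≤δ) 0<t (<-≤-trans t<m m≤δ) e e∈

  common-near : ∀ {p z} (P : Edge → Point → Set p) L → (∀ e → e ∈ L → Near z (P e)) →
                Near z (λ x → ∀ e → e ∈ L → P e x)
  common-near P [] f = 1# , 0<1 , λ _ _ _ ()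
  common-near P (e ∷ L) f = mapⁿ
    (λ { x (Pe , _) _ (here ≡.refl) → Pe ; x (_ , PL) e (there e∈) → PL e e∈ })
    (f e (here ≡.refl) ∧ⁿ common-near P L (λ e e∈ → f e (there e∈)))

  -- σ marks the points immediately to the left of the open segment from p to q.
  Side : Point → Point → Sign → Set _
  Side p q σ = ∀ x → 0# < x → x < 1# → Eventually (λ t → Marked σ (beside p (q -ₚ p) x t))

  -- The height is allowed to depend on `x` and `y`: another cycle edge may leave an end of the
  -- segment at a sharp angle, and then no uniform height works for the whole open segment.
  Strip : Point → Point → Set _
  Strip p q = ∀ {x y} → 0# < x → x < 1# → 0# < y → y < 1# →
    ∃[ ε ] 0# < ε × (∀ s t → 0# < s → s < ε → 0# < t → t < ε →
      ∀ z → OnSegment (beside p (q -ₚ p) x s) (beside p (q -ₚ p) y t) z → OffCycle Q z)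

  cycle-vertex-internal : ∀ {e u v} → e ∈ Q → Ends e u v → Near (pos u) D
  cycle-vertex-internal {e} {u} e∈ ends with incident-cases e (ends-incidentˡ ends)
  ... | inj₁ eq = let (v , eq′) = cycle-source-internal no-loop degree-boundary e∈ in
                  ≡.subst (λ u → Near (pos u) D) (≡.trans (≡.sym eq′) eq) (pos-internal v)
  ... | inj₂ eq = let (v , eq′) = cycle-target-internal no-loop degree-boundary e∈ in
                  ≡.subst (λ u → Near (pos u) D) (≡.trans (≡.sym eq′) eq) (pos-internal v)

  D-beside : ∀ {p q} → Near p D → Near q D → ∀ {x} → 0# < x → x < 1# →
             Eventually (λ t → D (beside p (q -ₚ p) x t))
  D-beside {p} {q} near-p near-q {x} 0<x x<1 = mapᵉ
    (λ {t} _ (Dp , Dq) → convex Dp Dq (x , <⇒≤ 0<x , <⇒≤ x<1 , eq _ _ _ , eq _ _ _))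
    (Near-ray near-p (rotate (q -ₚ p)) ∧ᵉ Near-ray near-q (rotate (q -ₚ p)))
    where
    eq : ∀ {t} p q n → (p + x * (q - p)) + t * n ≈ (p + t * n) + x * ((q + t * n) - (p + t * n))
    eq {t} p q n = solve 5 (λ p q n x t → (p :+ x :* (q :- p)) :+ t :* n :=
      (p :+ t :* n) :+ x :* ((q :+ t :* n) :- (p :+ t :* n))) refl p q n x t

  cycle-strip : ∀ {e u v} → e ∈ Q → Ends e u v → Strip (pos u) (pos v)
  cycle-strip {e} {u} {v} e∈ ends 0<x x<1 0<y y<1 =
    let near-u = cycle-vertex-internal e∈ ends
        near-v = cycle-vertex-internal e∈ (ends-swap {e} ends)
        (ε , 0<ε , inD) = D-beside near-u near-v 0<x x<1 ∧ᵉ D-beside near-u near-v 0<y y<1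
        (δ , 0<δ , off) = common-bound _ Q (λ f f∈ → strip-off (separation f) 0<x x<1 0<y y<1)
        (m , 0<m , m≤ε , m≤δ) = min 0<ε 0<δ
    in m , 0<m , λ s t 0<s s<m 0<t t<m z on →
      convex (proj₁ (inD s 0<s (<-≤-trans s<m m≤ε))) (proj₂ (inD t 0<t (<-≤-trans t<m m≤ε))) on ,
      λ (f , f∈ , onf) → off s t 0<s (<-≤-trans s<m m≤δ) 0<t (<-≤-trans t<m m≤δ) f f∈ z on onf
    where
    d′ = pos v -ₚ pos u
    0<dd = chord-positive (ends-distinct ends)
    -- The edge lies on the line bounding its own strip, where the height is 0, so it counts as
    -- lying below.
    own : Ends e u v → StripSeparation (pos u) d′ (pos (end e false)) (pos (end e true))
    own (false , ≡.refl , ≡.refl) = strip-above 0<dd (inj₂ (det-nullʳ d′ (pos u))) (inj₂ (det-self d′))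
    own (true  , ≡.refl , ≡.refl) = strip-above 0<dd (inj₂ (det-self d′)) (inj₂ (det-nullʳ d′ (pos u)))
    separation : ∀ f → StripSeparation (pos u) d′ (pos (end f false)) (pos (end f true))
    separation f with e Fin.≟ f
    ... | yes ≡.refl = own ends
    ... | no e≢f     = strip-separation 0<dd (λ s 0<s s<1 → interior-off ends e≢f 0<s s<1)

  -- One low point above `x` already carries the mark: a path inside the strip joins it to every low
  -- point above `y`.
  side-spread : ∀ {p q σ x} → Strip p q → 0# < x → x < 1# →
                Eventually (λ t → Marked σ (beside p (q -ₚ p) x t)) → Side p q σ
  side-spread strip 0<x x<1 ev y 0<y y<1 =
    let (ε , 0<ε , off) = strip 0<x x<1 0<y y<1
        (t₀ , 0<t₀ , (_ , eq) , t₀<ε) = instance-of (ev ∧ᵉ <ᵉ 0<ε)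
    in ε , 0<ε , λ t 0<t t<ε →
      off t₀ t 0<t₀ t₀<ε 0<t t<ε _ OnSegment-end ,
      ≡.trans (≡.sym (separated (off t₀ t 0<t₀ t₀<ε 0<t t<ε ◅ nil))) eq

  side-exists : ∀ {p q} → Strip p q → ∃[ σ ] Side p q σ
  side-exists strip =
    let (h , 0<h , h<1) = half 0<1
        (ε , 0<ε , off) = strip 0<h h<1 0<h h<1
        (t₀ , 0<t₀ , t₀<ε) = half 0<ε
    in _ , side-spread strip 0<h h<1 (ε , 0<ε , λ t 0<t t<ε →
      off t₀ t 0<t₀ t₀<ε 0<t t<ε _ OnSegment-end ,
      ≡.sym (separated (off t₀ t 0<t₀ t₀<ε 0<t t<ε ◅ nil)))

  -- Near z the cycle consists of two diverging arms, towards a and towards b.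
  record Corner (z a b : Point) : Set (c ⊔ ℓ₁ ⊔ ℓ₂ ⊔ d) where
    field
      0<u  : 0# < dot (a -ₚ z) (a -ₚ z)
      0<v  : 0# < dot (b -ₚ z) (b -ₚ z)
      div  : Diverging (b -ₚ z) (a -ₚ z)
      near : Near z (λ x → ¬ Ray z (a -ₚ z) x → ¬ Ray z (b -ₚ z) x → OffCycle Q x)

  corner-swap : ∀ {z a b} → Corner z a b → Corner z b a
  corner-swap corner = record
    { 0<u = 0<v ; 0<v = 0<u ; div = diverging-sym div ; near = mapⁿ (λ _ f x y → f y x) near }
    where open Corner corner

  Within-resp : ∀ {ε z x y} → x ≈ₚ y → Within ε z x → Within ε z y
  Within-resp (e , e′) ((a , b) , (a′ , b′)) =
    (<-respʳ-≈ e a , <-respˡ-≈ e b) , (<-respʳ-≈ e′ a′ , <-respˡ-≈ e′ b′)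

  module _ {z a b : Point} (corner : Corner z a b) where
    open Corner corner
    private
      u = a -ₚ z
      v = b -ₚ z

    -- Points are supplied at every scale because the radius within which the sector is connected is
    -- chosen only when two samples are compared.
    Sample : Sign → Set _
    Sample σ = ∀ ε → 0# < ε → ∃[ x ] Within ε z x × Sector v u (x -ₚ z) × mark x ≡ σ

    sample-unique : ∀ {σ τ} → Sample σ → Sample τ → σ ≡ τ
    sample-unique sσ sτ =
      let (ε , 0<ε , connect) = sector-connected (OffCycle Q) near 0<v 0<u div
          (x , wx , sx , eσ) = sσ ε 0<ε
          (y , wy , sy , eτ) = sτ ε 0<ε
      in ≡.trans (≡.sym eσ) (≡.trans (separated (connect x y wx wy sx sy)) eτ)

    private
      -- Membership in a sector of less than half a turn takes both inequalities, in a larger one a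
      -- single inequality is enough; hence the second is requested only when `det v u` is positive.
      sector-by-v : (x : Carrier → Point) → Eventually (λ t → 0# < det v (x t -ₚ z)) →
                    (0# < det v u → Eventually (λ t → 0# < det (x t -ₚ z) u)) →
                    Eventually (λ t → Sector v u (x t -ₚ z))
      sector-by-v x pv pu with <-or-≥ 0# (det v u)
      ... | inj₁ 0<p = mapᵉ (λ _ (q , r) → inj₁ (0<p , q , r)) (pv ∧ᵉ pu 0<p)
      ... | inj₂ p≤0 = mapᵉ (λ _ q → inj₂ (p≤0 , inj₁ q)) pv

      sector-by-u : (x : Carrier → Point) → Eventually (λ t → 0# < det (x t -ₚ z) u) →
                    (0# < det v u → Eventually (λ t → 0# < det v (x t -ₚ z))) →
                    Eventually (λ t → Sector v u (x t -ₚ z))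
      sector-by-u x pu pv with <-or-≥ 0# (det v u)
      ... | inj₁ 0<p = mapᵉ (λ _ (q , r) → inj₁ (0<p , q , r)) (pv 0<p ∧ᵉ pu)
      ... | inj₂ p≤0 = mapᵉ (λ _ r → inj₂ (p≤0 , inj₂ r)) pu

    sector-outgoing : ∀ {x} → 0# < x → Eventually (λ t → Sector v u (beside z v x t -ₚ z))
    sector-outgoing {x} 0<x = sector-by-v (beside z v x)
      (1# , 0<1 , λ t 0<t _ → 0<≈ (eq₁ z v t) (*-pos 0<t 0<v))
      (λ 0<p → mapᵉ (λ {t} _ → 0<≈ (eq₂ z v u t)) (affineᵉ (*-pos 0<x 0<p) (det (rotate v) u)))
      where
      eq₁ : ∀ z v t → t * dot v v ≈ det v (beside z v x t -ₚ z)
      eq₁ (z , z′) (v , v′) t = solve 6 (λ z z′ v v′ x t → let Z = z , z′; V = v , v′ in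
        t :* :dot V V := :det V ((Z :+ₚ x :*ₚ V :+ₚ t :*ₚ :rotate V) :-ₚ Z)) refl z z′ v v′ x t
      eq₂ : ∀ z v u t → x * det v u + t * det (rotate v) u ≈ det (beside z v x t -ₚ z) u
      eq₂ (z , z′) (v , v′) (u , u′) t = solve 8 (λ z z′ v v′ u u′ x t → let Z = z , z′; V = v , v′; U = u , u′ in
        x :* :det V U :+ t :* :det (:rotate V) U := :det ((Z :+ₚ x :*ₚ V :+ₚ t :*ₚ :rotate V) :-ₚ Z) U)
        refl z z′ v v′ u u′ x t

    sector-incoming : ∀ {x} → 0# < x → Eventually (λ t → Sector v u (beside a (z -ₚ a) (1# - x) t -ₚ z))
    sector-incoming {x} 0<x = sector-by-u (beside a (z -ₚ a) (1# - x))
      (1# , 0<1 , λ t 0<t _ → 0<≈ (eq₁ z a t) (*-pos 0<t 0<u))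
      (λ 0<p → mapᵉ (λ {t} _ → 0<≈ (eq₂ z a v t)) (affineᵉ (*-pos 0<x 0<p) (det v (rotate (z -ₚ a)))))
      where
      eq₁ : ∀ z a t → t * dot (a -ₚ z) (a -ₚ z) ≈ det (beside a (z -ₚ a) (1# - x) t -ₚ z) (a -ₚ z)
      eq₁ (z , z′) (a , a′) t = solve 6 (λ z z′ a a′ x t → let Z = z , z′; A = a , a′ in
        t :* :dot (A :-ₚ Z) (A :-ₚ Z) :=
        :det ((A :+ₚ (con 1ℤ :- x) :*ₚ (Z :-ₚ A) :+ₚ t :*ₚ :rotate (Z :-ₚ A)) :-ₚ Z) (A :-ₚ Z)) refl z z′ a a′ x t
      eq₂ : ∀ z a v t → x * det v (a -ₚ z) + t * det v (rotate (z -ₚ a)) ≈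
                        det v (beside a (z -ₚ a) (1# - x) t -ₚ z)
      eq₂ (z , z′) (a , a′) (v , v′) t = solve 8 (λ z z′ a a′ v v′ x t → let Z = z , z′; A = a , a′; V = v , v′ in
        x :* :det V (A :-ₚ Z) :+ t :* :det V (:rotate (Z :-ₚ A)) :=
        :det V ((A :+ₚ (con 1ℤ :- x) :*ₚ (Z :-ₚ A) :+ₚ t :*ₚ :rotate (Z :-ₚ A)) :-ₚ Z)) refl z z′ a a′ v v′ x t

    sample-outgoing : ∀ {σ} → Side z b σ → Sample σ
    sample-outgoing side ε 0<ε =
      let (x , 0<x , within , x<1) = instance-of (Within-open (Within-centre 0<ε) v ∧ᵉ <ᵉ 0<1)
          (t , _ , within′ , sector , (_ , eq)) =
            instance-of (Within-open within (rotate v) ∧ᵉ sector-outgoing 0<x ∧ᵉ side x 0<x x<1)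
      in beside z v x t , within′ , sector , eq

    sample-incoming : ∀ {σ} → Side a z σ → Sample σ
    sample-incoming side ε 0<ε =
      let (x , 0<x , within , x<1) = instance-of (Within-open (Within-centre 0<ε) u ∧ᵉ <ᵉ 0<1)
          (t , _ , within′ , sector , (_ , eq)) =
            instance-of (Within-open (Within-resp (flip (proj₁ z) (proj₁ a) x , flip (proj₂ z) (proj₂ a) x) within)
                                     (rotate (z -ₚ a))
                         ∧ᵉ sector-incoming 0<x ∧ᵉ side (1# - x) (0<1- x<1) (1-<1 0<x))
      in beside a (z -ₚ a) (1# - x) t , within′ , sector , eq
      where
      flip : ∀ z a x → z + x * (a - z) ≈ a + (1# - x) * (z - a)
      flip = solve 3 (λ z a x → z :+ x :* (a :- z) := a :+ (con 1ℤ :- x) :* (z :- a)) refl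

    sample-germ : ∀ {σ w} → Germ σ z w → Sector v u w → Sample σ
    sample-germ {w = w} germ sector ε 0<ε =
      let (t , 0<t , within , t<1) = instance-of (Within-open (Within-centre 0<ε) w ∧ᵉ <ᵉ 0<1)
      in z +ₚ t *ₚ w , within , scale 0<t sector , proj₂ (germ t 0<t t<1)
      where
      scale : ∀ {t} → 0# < t → Sector v u w → Sector v u ((z +ₚ t *ₚ w) -ₚ z)
      scale {t} 0<t = λ where
          (inj₁ (0<p , 0<q , 0<r))  → inj₁ (0<p , scaleˡ 0<q , scaleʳ 0<r)
          (inj₂ (p≤0 , inj₁ 0<q))   → inj₂ (p≤0 , inj₁ (scaleˡ 0<q))
          (inj₂ (p≤0 , inj₂ 0<r))   → inj₂ (p≤0 , inj₂ (scaleʳ 0<r))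
        where
        scaleˡ : 0# < det v w → 0# < det v ((z +ₚ t *ₚ w) -ₚ z)
        scaleˡ 0<q = 0<≈ (sym (det-rayˡ v z w t)) (*-pos 0<t 0<q)
        scaleʳ : 0# < det w u → 0# < det ((z +ₚ t *ₚ w) -ₚ z) u
        scaleʳ 0<r = 0<≈ (sym (det-rayʳ u z w t)) (*-pos 0<t 0<r)

    -- Just before `z` and just after it, the left side of the path from `a` over `z` to `b` lies in
    -- the sector turning from the outgoing arm to the reversed incoming one. This sector is
    -- connected near `z`, so the mark survives the corner.
    turn : ∀ {σ} → Strip z b → Side a z σ → Side z b σ
    turn strip side = let (τ , side′) = side-exists strip in
      ≡.subst (Side z b) (sample-unique (sample-outgoing side′) (sample-incoming side)) side′

    turn-back : ∀ {σ} → Strip a z → Side z b σ → Side a z σ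
    turn-back strip side = let (τ , side′) = side-exists strip in
      ≡.subst (Side a z) (sample-unique (sample-incoming side′) (sample-outgoing side)) side′

    germ-in-sector : ∀ {σ τ w} → Side z b σ → Germ τ z w → Sector v u w → τ ≡ σ
    germ-in-sector side germ sector = sample-unique (sample-germ germ sector) (sample-outgoing side)

  make-corner : ∀ {z a b} → 0# < dot (a -ₚ z) (a -ₚ z) → 0# < dot (b -ₚ z) (b -ₚ z) →
                Diverging (b -ₚ z) (a -ₚ z) → Near z D →
                (∀ e → e ∈ Q → ¬ OnEdge e z ⊎ (∀ x → OnEdge e x → Ray z (a -ₚ z) x ⊎ Ray z (b -ₚ z) x)) →
                Corner z a b
  make-corner {z} {a} {b} 0<u 0<v div inside arms = record
    { 0<u = 0<u ; 0<v = 0<v ; div = div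
    ; near = mapⁿ (λ x (Dx , off) ¬u ¬v → Dx , λ (e , e∈ , on) → off e e∈ ¬u ¬v on)
               (inside ∧ⁿ common-near _ Q (λ e e∈ → clear e (arms e e∈))) }
    where
    clear : ∀ e → ¬ OnEdge e z ⊎ (∀ x → OnEdge e x → Ray z (a -ₚ z) x ⊎ Ray z (b -ₚ z) x) →
            Near z (λ x → ¬ Ray z (a -ₚ z) x → ¬ Ray z (b -ₚ z) x → ¬ OnEdge e x)
    clear e (inj₁ off) = mapⁿ (λ _ off _ _ → off) (off-segment-near (chord-positive (no-loop e)) off)
    clear e (inj₂ rays) = 1# , 0<1 , λ x _ ¬u ¬v on → Sum.[ ¬u , ¬v ] (rays x on)

  -- If `w` had the direction of `a -ₚ z`, a short piece in direction `w` would lie on the segment.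
  diverging-off : ∀ {z a w} → 0# < dot (a -ₚ z) (a -ₚ z) →
                  (∀ t → 0# < t → t < 1# → ¬ OnSegment z a (z +ₚ t *ₚ w)) → Diverging (a -ₚ z) w
  diverging-off {z} {a} {w} 0<u off (e , 0<d) =
    let (t , 0<t , t<1 , small) = instance-of (<ᵉ 0<1 ∧ᵉ affineᵉ 0<u (- dot (a -ₚ z) w)) in
    off t 0<t t<1 (collinear-on-segment 0<u
      (trans (det-rayˡ (a -ₚ z) z w t) (*-zeroʳ-≈ t e))
      (0≤≈ (dot-ray (a -ₚ z) z w t) (<⇒≤ (*-pos 0<t 0<d)))
      (0≤-⇒≤0 (0≤≈ (overshoot z a w t) (<⇒≤ small))))
    where
    dot-ray : ∀ u z w t → t * dot u w ≈ dot u ((z +ₚ t *ₚ w) -ₚ z)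
    dot-ray (u , u′) (z , z′) (w , w′) t = solve 7 (λ u u′ z z′ w w′ t →
      t :* :dot (u , u′) (w , w′) := :dot (u , u′) (((z , z′) :+ₚ t :*ₚ (w , w′)) :-ₚ (z , z′)))
      refl u u′ z z′ w w′ t
    overshoot : ∀ z a w t → dot (a -ₚ z) (a -ₚ z) + t * - dot (a -ₚ z) w ≈ - dot (a -ₚ z) ((z +ₚ t *ₚ w) -ₚ a)
    overshoot (z , z′) (a , a′) (w , w′) t = solve 7 (λ z z′ a a′ w w′ t →
      let Z = z , z′; A = a , a′; W = w , w′; U = A :-ₚ Z in
      :dot U U :+ t :* (:- :dot U W) := :- :dot U ((Z :+ₚ t :*ₚ W) :-ₚ A)) refl z z′ a a′ w w′ t

  source-≢-target : ∀ e → source e ≢ target e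
  source-≢-target = source≢target no-loop degree-boundary

  vertex-corner : ∀ {e f} → e ∈ Q → f ∈ Q → target e ≡ source f →
                  Corner (pos (source f)) (pos (source e)) (pos (target f))
  vertex-corner {e} {f} e∈ f∈ eq = make-corner
    (chord-positive (ends-distinct {e} (ends-swap {e} ends-e)))
    (chord-positive (source-≢-target f))
    (diverging-off (chord-positive (source-≢-target f)) λ t 0<t t<1 on →
      interior-off (ends-swap {e} ends-e) e≢f 0<t t<1 (onEdge⇐ (ends-oriented f) on))
    (cycle-vertex-internal f∈ (ends-oriented f))
    arms
    where
    ends-e : Ends e (source e) (source f)
    ends-e = o e , ≡.refl , eq
    e≢f : e ≢ f
    e≢f ≡.refl = source-≢-target e (≡.sym eq)
    V = source f
    arms : ∀ g → g ∈ Q → ¬ OnEdge g (pos V) ⊎ (∀ x → OnEdge g x →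
             Ray (pos V) (pos (source e) -ₚ pos V) x ⊎ Ray (pos V) (pos (target f) -ₚ pos V) x)
    arms g g∈ with g Fin.≟ e | g Fin.≟ f
    ... | yes ≡.refl | _ = inj₂ λ x on → let (t , 0≤t , _ , e) = onEdge⇒ (ends-swap {g} ends-e) on in inj₁ (t , 0≤t , e)
    ... | no _ | yes ≡.refl = inj₂ λ x on → let (t , 0≤t , _ , e) = onEdge⇒ (ends-oriented g) on in inj₂ (t , 0≤t , e)
    -- A third cycle edge at `V` would start or end there, against injectivity of sources or of
    -- targets.
    ... | no g≢e | no g≢f = inj₁ λ on → absurd (incident-cases g (vertices-off-edges on))
      where
      absurd : source g ≡ V ⊎ target g ≡ V → ⊥
      absurd (inj₁ eq′) = g≢f (source-injective g∈ f∈ eq′)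
      absurd (inj₂ eq′) = g≢e (target-injective g∈ e∈ (≡.trans eq′ (≡.sym eq)))

  -- A point `x` near the combination `z` is the same combination of the translates of `p` and `q`
  -- by `x -ₚ z`.
  Interior-convex : ∀ {p q t} → Near p D → Near q D → 0# ≤ t → t ≤ 1# → Near (p +ₚ t *ₚ (q -ₚ p)) D
  Interior-convex {p} {q} {t} near-p near-q 0≤t t≤1 =
    let (ε , 0<ε , Dp) = near-p; (δ , 0<δ , Dq) = near-q; (m , 0<m , m≤ε , m≤δ) = min 0<ε 0<δ in
    m , 0<m , λ x within →
      convex (Dp (p +ₚ (x -ₚ z)) (shift p (Within-mono m≤ε within)))
             (Dq (q +ₚ (x -ₚ z)) (shift q (Within-mono m≤δ within)))
             (t , 0≤t , t≤1 , eq _ _ _ , eq _ _ _)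
    where
    z = p +ₚ t *ₚ (q -ₚ p)
    eq : ∀ p q x → x ≈ (p + (x - (p + t * (q - p)))) +
                       t * ((q + (x - (p + t * (q - p)))) - (p + (x - (p + t * (q - p)))))
    eq p q x = solve 4 (λ p q x t → x := (p :+ (x :- (p :+ t :* (q :- p)))) :+
                 t :* ((q :+ (x :- (p :+ t :* (q :- p)))) :- (p :+ (x :- (p :+ t :* (q :- p)))))) refl p q x t
    shift : ∀ {ε x} p → Within ε z x → Within ε p (p +ₚ (x -ₚ z))
    shift {ε} (p , p′) ((a , b) , (a′ , b′)) = (lo p a , hi p b) , (lo p′ a′ , hi p′ b′)
      where
      lo : ∀ {z x} p → z - ε < x → p - ε < p + (x - z)
      lo {z} {x} p l = 0<-⇒< (0<≈ (solve 4 (λ z x p e → x :- (z :- e) := (p :+ (x :- z)) :- (p :- e)) refl z x p ε) (<⇒0<- l))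
      hi : ∀ {z x} p → x < z + ε → p + (x - z) < p + ε
      hi {z} {x} p l = 0<-⇒< (0<≈ (solve 4 (λ z x p e → (z :+ e) :- x := (p :+ e) :- (p :+ (x :- z))) refl z x p ε) (<⇒0<- l))

  -- An interior point of a cycle edge is treated as a corner with straight angle, so that one
  -- argument covers hits at vertices and inside edges.
  interior-corner : ∀ {e u v t} → e ∈ Q → Ends e u v → 0# < t → t < 1# →
                    Corner (along u v t) (pos u) (pos v)
  interior-corner {e} {u} {v} {t} e∈ ends 0<t t<1 = make-corner
    (0<≈ (back (pos u) (pos v)) (*-pos (*-pos 0<t 0<t) 0<dd))
    (0<≈ (forth (pos u) (pos v)) (*-pos (*-pos (0<1- t<1) (0<1- t<1)) 0<dd))
    (λ (_ , 0<dot) → <-asym 0<dot (0<-⇒<0 (0<≈ (opposite (pos u) (pos v)) (*-pos (*-pos 0<t (0<1- t<1)) 0<dd))))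
    (Interior-convex (cycle-vertex-internal e∈ ends) (cycle-vertex-internal e∈ (ends-swap {e} ends)) (<⇒≤ 0<t) (<⇒≤ t<1))
    arms
    where
    0<dd = chord-positive (ends-distinct ends)
    z = along u v t
    back : ∀ p q → t * t * dot (q -ₚ p) (q -ₚ p) ≈ dot (p -ₚ (p +ₚ t *ₚ (q -ₚ p))) (p -ₚ (p +ₚ t *ₚ (q -ₚ p)))
    back (p , p′) (q , q′) = solve 5 (λ p p′ q q′ t → let P = p , p′; D = (q , q′) :-ₚ P; Y = P :-ₚ (P :+ₚ t :*ₚ D) in
      t :* t :* :dot D D := :dot Y Y) refl p p′ q q′ t
    forth : ∀ p q → (1# - t) * (1# - t) * dot (q -ₚ p) (q -ₚ p) ≈ dot (q -ₚ (p +ₚ t *ₚ (q -ₚ p))) (q -ₚ (p +ₚ t *ₚ (q -ₚ p)))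
    forth (p , p′) (q , q′) = solve 5 (λ p p′ q q′ t → let P = p , p′; D = (q , q′) :-ₚ P; Y = (q , q′) :-ₚ (P :+ₚ t :*ₚ D) in
      (con 1ℤ :- t) :* (con 1ℤ :- t) :* :dot D D := :dot Y Y) refl p p′ q q′ t
    opposite : ∀ p q → t * (1# - t) * dot (q -ₚ p) (q -ₚ p) ≈ - dot (q -ₚ (p +ₚ t *ₚ (q -ₚ p))) (p -ₚ (p +ₚ t *ₚ (q -ₚ p)))
    opposite (p , p′) (q , q′) = solve 5 (λ p p′ q q′ t → let P = p , p′; D = (q , q′) :-ₚ P; Z = P :+ₚ t :*ₚ D in
      t :* (con 1ℤ :- t) :* :dot D D := :- :dot ((q , q′) :-ₚ Z) (P :-ₚ Z)) refl p p′ q q′ t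
    arms : ∀ g → g ∈ Q → ¬ OnEdge g z ⊎ (∀ x → OnEdge g x → Ray z (pos u -ₚ z) x ⊎ Ray z (pos v -ₚ z) x)
    arms g g∈ with e Fin.≟ g
    ... | no e≢g = inj₁ (interior-off ends e≢g 0<t t<1)
    ... | yes ≡.refl = inj₂ λ x on → side (onEdge⇒ ends on)
      where
      side : ∀ {x} → OnSegment (pos u) (pos v) x → Ray z (pos u -ₚ z) x ⊎ Ray z (pos v -ₚ z) x
      side {x} (s , 0≤s , s≤1 , e , e′) with <-or-≥ s t
      ... | inj₁ s<t = inj₁ ((t - s) * i , <⇒≤ (*-pos (<⇒0<- s<t) (0<⁻¹ 0<t)) , trans e (eq _ _) , trans e′ (eq _ _))
        where
        i = t ⁻¹
        eq : ∀ p q → p + s * (q - p) ≈ (p + t * (q - p)) + (t - s) * i * (p - (p + t * (q - p)))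
        eq p q = sym (trans (solve 5 (λ p q s t i →
            (p :+ t :* (q :- p)) :+ (t :- s) :* i :* (p :- (p :+ t :* (q :- p))) :=
            (p :+ t :* (q :- p)) :- (t :* i) :* ((t :- s) :* (q :- p))) refl p q s t i)
          (trans (+-congˡ (-‿cong (*-congʳ (⁻¹-inverse 0<t))))
            (solve 4 (λ p q s t → (p :+ t :* (q :- p)) :- con 1ℤ :* ((t :- s) :* (q :- p)) := p :+ s :* (q :- p)) refl p q s t)))
      ... | inj₂ t≤s = inj₂ ((s - t) * i , 0≤* (≤⇒0≤- t≤s) (inj₁ (0<⁻¹ (0<1- t<1))) , trans e (eq _ _) , trans e′ (eq _ _))
        where
        i = (1# - t) ⁻¹
        eq : ∀ p q → p + s * (q - p) ≈ (p + t * (q - p)) + (s - t) * i * (q - (p + t * (q - p)))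
        eq p q = sym (trans (solve 5 (λ p q s t i →
            (p :+ t :* (q :- p)) :+ (s :- t) :* i :* (q :- (p :+ t :* (q :- p))) :=
            (p :+ t :* (q :- p)) :+ ((con 1ℤ :- t) :* i) :* ((s :- t) :* (q :- p))) refl p q s t i)
          (trans (+-congˡ (*-congʳ (⁻¹-inverse (0<1- t<1))))
            (solve 4 (λ p q s t → (p :+ t :* (q :- p)) :+ con 1ℤ :* ((s :- t) :* (q :- p)) := p :+ s :* (q :- p)) refl p q s t)))

  -- The rotated difference shrinks with the segment by the factor `1# - t`, so the displacement `s`
  -- of the shorter segment is `s * (1# - t)` for the longer one.
  side-rest : ∀ {p q σ t} → 0# ≤ t → t < 1# → Side p q σ → Side (p +ₚ t *ₚ (q -ₚ p)) q σ
  side-rest {p} {q} {σ} {t} 0≤t t<1 side x 0<x x<1 =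
    let (ε , 0<ε , M) = side (t + x * (1# - t)) (0≤+0< 0≤t (*-pos 0<x (0<1- t<1)))
          (0<-⇒< (0<≈ (solve 2 (λ x t → (con 1ℤ :- x) :* (con 1ℤ :- t) := con 1ℤ :- (t :+ x :* (con 1ℤ :- t))) refl x t)
            (*-pos (0<1- x<1) (0<1- t<1))))
    in ε , 0<ε , λ s 0<s s<ε → Marked-resp
         (eq _ _ (- (proj₂ q - proj₂ p)) _ (rot₁ _ _) , eq _ _ (proj₁ q - proj₁ p) _ (rot₂ _ _))
         (M (s * (1# - t)) (*-pos 0<s (0<1- t<1))
           (≤-<-trans (0≤-⇒≤ (0≤≈ (solve 2 (λ s t → s :* t := s :- s :* (con 1ℤ :- t)) refl s t) (0≤* (<⇒≤ 0<s) 0≤t))) s<ε))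
    where
    rot₁ : ∀ p q → (1# - t) * - (q - p) ≈ - (q - (p + t * (q - p)))
    rot₁ p q = solve 3 (λ p q t → (con 1ℤ :- t) :* (:- (q :- p)) := :- (q :- (p :+ t :* (q :- p)))) refl p q t
    rot₂ : ∀ p q → (1# - t) * (q - p) ≈ q - (p + t * (q - p))
    rot₂ p q = solve 3 (λ p q t → (con 1ℤ :- t) :* (q :- p) := q :- (p :+ t :* (q :- p))) refl p q t
    eq : ∀ p q n n′ → (1# - t) * n ≈ n′ → ∀ {s} → (p + (t + x * (1# - t)) * (q - p)) + s * (1# - t) * n ≈
         ((p + t * (q - p)) + x * (q - (p + t * (q - p)))) + s * n′
    eq p q n n′ e {s} = trans (solve 6 (λ p q n s t x →
        (p :+ (t :+ x :* (con 1ℤ :- t)) :* (q :- p)) :+ s :* (con 1ℤ :- t) :* n :=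
        ((p :+ t :* (q :- p)) :+ x :* (q :- (p :+ t :* (q :- p)))) :+ s :* ((con 1ℤ :- t) :* n)) refl p q n s t x)
      (+-congˡ (*-congˡ e))

  side-resp : ∀ {p p′ q σ} → p ≈ₚ p′ → Side p q σ → Side p′ q σ
  side-resp {q = q} e side x 0<x x<1 = mapᵉ (λ _ → Marked-resp
    (+ₚ-cong (+ₚ-cong e (*ₚ-cong refl (-ₚ-cong ≈ₚ-refl e)))
      (*ₚ-cong refl (-‿cong (+-congˡ (-‿cong (proj₂ e))) , +-congˡ (-‿cong (proj₁ e))))))
    (side x 0<x x<1)

  germ-resp : ∀ {σ z z′ w w′} → z ≈ₚ z′ → w ≈ₚ w′ → Germ σ z w → Germ σ z′ w′
  germ-resp ez ew germ t 0<t t<1 = Marked-resp (+ₚ-cong ez (*ₚ-cong refl ew)) (germ t 0<t t<1)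

  -- The germ avoids the cycle, so its direction is none of the two arms and lies in one of the two
  -- sectors. Each sector is connected near `z` and contains the points beside an arm on that side.
  germ-side : ∀ {z a b w λσ ρσ τ} → Corner z a b →
              (∀ {x} → OnSegment z a x → OnCycle Q x) → (∀ {x} → OnSegment z b x → OnCycle Q x) →
              Side z b λσ → Side z a ρσ → Germ τ z w → 0# < dot w w →
              Diverging (b -ₚ z) w × Diverging (a -ₚ z) w ×
              (Sector (b -ₚ z) (a -ₚ z) w × τ ≡ λσ ⊎ Sector (a -ₚ z) (b -ₚ z) w × τ ≡ ρσ)
  germ-side {z} {a} {b} {w} {λσ} {ρσ} {τ} corner on-a on-b left right germ 0<w = vw , uw , classify
      (two-sectors 0<v 0<u 0<w div vw uw)
    where
    open Corner corner
    vw : Diverging (b -ₚ z) w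
    vw = diverging-off 0<v λ t 0<t t<1 on → proj₂ (proj₁ (germ t 0<t t<1)) (on-b on)
    uw : Diverging (a -ₚ z) w
    uw = diverging-off 0<u λ t 0<t t<1 on → proj₂ (proj₁ (germ t 0<t t<1)) (on-a on)
    classify : Sector (b -ₚ z) (a -ₚ z) w ⊎ Sector (a -ₚ z) (b -ₚ z) w →
               Sector (b -ₚ z) (a -ₚ z) w × τ ≡ λσ ⊎ Sector (a -ₚ z) (b -ₚ z) w × τ ≡ ρσ
    classify (inj₁ s) = inj₁ (s , germ-in-sector corner left germ s)
    classify (inj₂ s) = inj₂ (s , germ-in-sector (corner-swap corner) right germ s)

  abstract
    left-exists : ∃[ σ ] Side (pos (source root)) (pos (target root)) σ
    left-exists = side-exists (cycle-strip root∈ (ends-oriented root))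

    right-exists : ∃[ σ ] Side (pos (target root)) (pos (source root)) σ
    right-exists = side-exists (cycle-strip root∈ (ends-swap {root} (ends-oriented root)))

  leftMark rightMark : Sign
  leftMark  = proj₁ left-exists
  rightMark = proj₁ right-exists

  left-side : ∀ {e} → e ∈ Q → Side (pos (source e)) (pos (target e)) leftMark
  left-side = from-root (λ e → Side (pos (source e)) (pos (target e)) leftMark)
    (λ {e} {f} e∈ f∈ eq side → turn (vertex-corner e∈ f∈ eq) (cycle-strip f∈ (ends-oriented f))
      (≡.subst (λ v → Side (pos (source e)) (pos v) leftMark) eq side))
    (proj₂ left-exists)

  -- The right side is the left side of the reversed edge. Since the reversed path meets `f` before
  -- `e`, the step from `e` to `f` passes the corner backwards.
  right-side : ∀ {e} → e ∈ Q → Side (pos (target e)) (pos (source e)) rightMark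
  right-side = from-root (λ e → Side (pos (target e)) (pos (source e)) rightMark)
    (λ {e} {f} e∈ f∈ eq side → turn-back (corner-swap (vertex-corner e∈ f∈ eq))
      (cycle-strip f∈ (ends-swap {f} (ends-oriented f)))
      (≡.subst (λ v → Side (pos v) (pos (source e)) rightMark) eq side))
    (proj₂ right-exists)

  vertex-germ : ∀ {e f τ w} → e ∈ Q → f ∈ Q → target e ≡ source f →
    let v = pos (target f) -ₚ pos (source f); u = pos (source e) -ₚ pos (source f) in
    Germ τ (pos (source f)) w → 0# < dot w w →
    Diverging v w × Diverging u w × (Sector v u w × τ ≡ leftMark ⊎ Sector u v w × τ ≡ rightMark)
  vertex-germ {e} {f} e∈ f∈ eq = germ-side (vertex-corner e∈ f∈ eq)
    (λ on → e , e∈ , onEdge⇐ (ends-swap {e} (o e , ≡.refl , eq)) on)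
    (λ on → f , f∈ , onEdge⇐ (ends-oriented f) on)
    (left-side f∈)
    (≡.subst (λ v → Side (pos v) (pos (source e)) rightMark) eq (right-side e∈))

  -- Each point off the cycle carries the mark of one of the two sides.

  merge-hits : ∀ {a b} (A : Point → Set a) (B : Point → Set b) p w → FirstHit A p w → FirstHit B p w →
               FirstHit (λ x → A x ⊎ B x) p w
  merge-hits A B p w (s , 0<s , s≤1 , missA , endA) (t , 0<t , t≤1 , missB , endB) with <-or-≥ s t
  ... | inj₁ s<t = s , 0<s , s≤1 ,
    (λ { x 0≤x x<s (inj₁ on) → missA x 0≤x x<s on ; x 0≤x x<s (inj₂ on) → missB x 0≤x (<-trans x<s s<t) on }) ,
    Sum.map₂ inj₁ endA
  ... | inj₂ t≤s = t , 0<t , t≤1 ,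
    (λ { x 0≤x x<t (inj₁ on) → missA x 0≤x (<-≤-trans x<t t≤s) on ; x 0≤x x<t (inj₂ on) → missB x 0≤x x<t on }) ,
    Sum.map₂ inj₂ endB

  first-hit-of : ∀ L p w → (∀ e → e ∈ L → ¬ OnEdge e p) → FirstHit (λ x → ∃[ e ] e ∈ L × OnEdge e x) p w
  first-hit-of [] p w off = 1# , 0<1 , ≤-refl , (λ { _ _ _ (_ , () , _) }) , inj₁ refl
  first-hit-of (e ∷ L) p w off =
    let (s , 0<s , s≤1 , miss , end) = merge-hits (OnEdge e) (λ x → ∃[ f ] f ∈ L × OnEdge f x) p w
                                    (first-hit (chord-positive (no-loop e)) p w (off e (here ≡.refl)))
                                    (first-hit-of L p w (λ f f∈ → off f (there f∈)))
    in s , 0<s , s≤1 ,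
       (λ { t 0≤t t<s (_ , here ≡.refl , on) → miss t 0≤t t<s (inj₁ on)
          ; t 0≤t t<s (f , there f∈ , on) → miss t 0≤t t<s (inj₂ (f , f∈ , on)) }) ,
       Sum.map₂ Sum.[ (λ on → e , here ≡.refl , on) , (λ (f , f∈ , on) → f , there f∈ , on) ] end

  module _ {p : Point} (off : OffCycle Q p) where
    private
      hit : ∃[ z ] OnCycle Q z × Germ (mark p) z (p -ₚ z)
      hit = z , on-z , germ
        where
        q = pos (source root)
        w = q -ₚ p
        first = first-hit-of Q p w (λ e e∈ on → proj₂ off (e , e∈ , on))
        s = proj₁ first
        0<s = proj₁ (proj₂ first)
        s≤1 = proj₁ (proj₂ (proj₂ first))
        miss = proj₁ (proj₂ (proj₂ (proj₂ first)))
        z = p +ₚ s *ₚ w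
        reach : s ≈ 1# ⊎ OnCycle Q z → OnCycle Q z
        -- The segment aims at a vertex of the cycle; if no edge stops it earlier, its end point is
        -- the hit.
        reach (inj₂ on) = on
        reach (inj₁ s≈1) = OnCycle-resp (arrive _ _ , arrive _ _) (root , root∈ , onEdge⇐ (ends-oriented root) OnSegment-start)
          where
          arrive : ∀ p q → q ≈ p + s * (q - p)
          arrive p q = trans (solve 2 (λ p q → q := p :+ con 1ℤ :* (q :- p)) refl p q) (+-congˡ (*-congʳ (sym s≈1)))
        on-z = reach (proj₂ (proj₂ (proj₂ (proj₂ first))))
        clear : ∀ x → 0# ≤ x → x < s → OffCycle Q (p +ₚ x *ₚ w)
        clear x 0≤x x<s = convex (proj₁ off) (D-pos (source root)) (x , 0≤x , <⇒≤ (<-≤-trans x<s s≤1) , ≈ₚ-refl) ,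
          λ on → miss x 0≤x x<s on
        germ : Germ (mark p) z (p -ₚ z)
        germ t 0<t t<1 = Marked-resp (back _ _ , back _ _)
          (clear x (<⇒≤ 0<x) x<s , ≡.trans (≡.sym (segment-constant λ u 0≤u u≤1 → clear _ (0≤≈ (drop u) (0≤* 0≤u (<⇒≤ 0<x)))
              (convex-below s 0≤u u≤1 0<s x<s))) start)
          where
          x = s * (1# - t)
          0<x = *-pos 0<s (0<1- t<1)
          x<s : x < s
          x<s = 0<-⇒< (0<≈ (solve 2 (λ s t → s :* t := s :- s :* (con 1ℤ :- t)) refl s t) (*-pos 0<s 0<t))
          drop : ∀ u → u * x ≈ 0# + u * (x - 0#)
          drop u = solve 2 (λ u x → u :* x := con 0ℤ :+ u :* (x :- con 0ℤ)) refl u x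
          back : ∀ p w → p + x * w ≈ (p + s * w) + t * (p - (p + s * w))
          back p w = solve 4 (λ p w s t → p :+ s :* (con 1ℤ :- t) :* w := (p :+ s :* w) :+ t :* (p :- (p :+ s :* w))) refl p w s t
          start : mark (p +ₚ 0# *ₚ w) ≡ mark p
          start = proj₂ (Marked-resp (zero-step _ _ , zero-step _ _) (off , ≡.refl))
            where
            zero-step : ∀ p w → p ≈ p + 0# * w
            zero-step = solve 2 (λ p w → p := p :+ con 0ℤ :* w) refl

      either : ∀ {a b s t} {A : Set a} {B : Set b} {S : Set s} {T : Set t} →
               A × B × (S × mark p ≡ leftMark ⊎ T × mark p ≡ rightMark) →
               mark p ≡ leftMark ⊎ mark p ≡ rightMark
      either (_ , _ , inj₁ (_ , eq)) = inj₁ eq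
      either (_ , _ , inj₂ (_ , eq)) = inj₂ eq

      away : ∀ {z} → OnCycle Q z → 0# < dot (p -ₚ z) (p -ₚ z)
      away on = 0<dot (λ z≈p → proj₂ off (OnCycle-resp z≈p on))
      approach : ∀ {z z′} → z ≈ₚ z′ → Germ (mark p) z (p -ₚ z) → Germ (mark p) z′ (p -ₚ z′)
      approach {z} {z′} z≈ = germ-resp {z = z} {z′} {p -ₚ z} {p -ₚ z′} z≈ (-ₚ-cong ≈ₚ-refl z≈)
      at-vertex : ∀ {z} e → e ∈ Q → z ≈ₚ pos (source e) → Germ (mark p) z (p -ₚ z) → mark p ≡ leftMark ⊎ mark p ≡ rightMark
      at-vertex {z} e e∈ z≈ germ = let (f , f∈ , eq) = prev e∈ in
        either (vertex-germ {w = p -ₚ pos (source e)} f∈ e∈ eq (approach z≈ germ)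
          (away {pos (source e)} (vertex-OnCycle e∈ (ends-incidentˡ (ends-oriented e)))))
      at-interior : ∀ {z t} e → e ∈ Q → 0# < t → t < 1# → z ≈ₚ along (source e) (target e) t →
                    Germ (mark p) z (p -ₚ z) → mark p ≡ leftMark ⊎ mark p ≡ rightMark
      at-interior {z} {t} e e∈ 0<t t<1 z≈ germ = either (germ-side {z′} {pos u} {pos v} {p -ₚ z′}
            (interior-corner e∈ ends 0<t t<1)
            (λ on′ → e , e∈ , onEdge⇐ ends (sub-left on′)) (λ on′ → e , e∈ , onEdge⇐ ends (sub-right on′))
            (side-rest {pos u} {pos v} (<⇒≤ 0<t) t<1 (left-side e∈))
            (side-resp {along v u (1# - t)} {z′} {pos u} (along-flip {u} {v} {t})
              (side-rest {pos v} {pos u} (<⇒≤ (0<1- t<1)) (1-<1 0<t) (right-side e∈)))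
            (approach z≈ germ)
            (away {z′} (e , e∈ , onEdge⇐ ends (t , <⇒≤ 0<t , <⇒≤ t<1 , ≈ₚ-refl))))
        where
        ends = ends-oriented e
        u = source e
        v = target e
        z′ = along u v t
        sub : ∀ {a b s x} → 0# ≤ s → s ≤ 1# → OnSegment (a +ₚ s *ₚ (b -ₚ a)) b x → OnSegment a b x
        sub {a} {b} {s} {x} 0≤s s≤1 (y , 0≤y , y≤1 , e , e′) =
          s + y * (1# - s) , 0≤+ 0≤s (0≤* 0≤y (≤⇒0≤- s≤1)) ,
          0≤-⇒≤ (0≤≈ (solve 2 (λ s y → (con 1ℤ :- y) :* (con 1ℤ :- s) := con 1ℤ :- (s :+ y :* (con 1ℤ :- s))) refl s y)
            (0≤* (≤⇒0≤- y≤1) (≤⇒0≤- s≤1))) ,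
          trans e (eq _ _) , trans e′ (eq _ _)
          where
          eq : ∀ a b → (a + s * (b - a)) + y * (b - (a + s * (b - a))) ≈ a + (s + y * (1# - s)) * (b - a)
          eq a b = solve 4 (λ a b s y → (a :+ s :* (b :- a)) :+ y :* (b :- (a :+ s :* (b :- a))) :=
            a :+ (s :+ y :* (con 1ℤ :- s)) :* (b :- a)) refl a b s y
        sub-right : ∀ {x} → OnSegment (along u v t) (pos v) x → OnSegment (pos u) (pos v) x
        sub-right = sub (<⇒≤ 0<t) (<⇒≤ t<1)
        sub-left : ∀ {x} → OnSegment (along u v t) (pos u) x → OnSegment (pos u) (pos v) x
        sub-left on′ = OnSegment-swap (sub (<⇒≤ (0<1- t<1)) (<⇒≤ (1-<1 0<t))
          (OnSegment-resp {along u v t} {pos u} {_} {along v u (1# - t)} {pos u} (≈ₚ-sym (along-flip {u} {v} {t})) ≈ₚ-refl ≈ₚ-refl on′))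
      at-point : ∀ {z} e → e ∈ Q → OnSegment (pos (source e)) (pos (target e)) z →
                 Germ (mark p) z (p -ₚ z) → mark p ≡ leftMark ⊎ mark p ≡ rightMark
      at-point e e∈ (t , inj₂ 0≈t , t≤1 , z≈) = at-vertex e e∈
        (≈ₚ-trans z≈ (≈ₚ-trans (along-cong {source e} {target e} (sym 0≈t)) (along-0 {source e} {target e})))
      -- A hit at the end of an edge is a hit at the start of the next one.
      at-point {z} e e∈ (t , inj₁ 0<t , inj₂ t≈1 , z≈) = let (f , f∈ , eq) = next e∈ in
        at-vertex f f∈ (≡.subst (λ v → z ≈ₚ pos v) (≡.sym eq)
          (≈ₚ-trans z≈ (≈ₚ-trans (along-cong {source e} {target e} t≈1) (along-1 {source e} {target e}))))
      at-point e e∈ (t , inj₁ 0<t , inj₁ t<1 , z≈) = at-interior e e∈ 0<t t<1 z≈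

    marked-left-or-right : mark p ≡ leftMark ⊎ mark p ≡ rightMark
    marked-left-or-right = let (z , (e , e∈ , on) , germ) = hit in
      at-point {z} e e∈ (onEdge⇒ (ends-oriented e) on) germ

  boundary-OffCycle : ∀ j → ¬ OnCycle Q (pos (inj₁ j))
  boundary-OffCycle j on with OnCycle-vertex on
  ... | e , e∈ , inc with incident-cases e inc
  ...   | inj₁ eq with cycle-source-internal no-loop degree-boundary e∈
  ...     | v , eq′ with () ← ≡.trans (≡.sym eq) eq′
  boundary-OffCycle j on | e , e∈ , inc | inj₂ eq = cycle-avoids-boundary no-loop degree-boundary e∈ eq

  boundary-Marked : ∀ j → Marked Sign.+ (pos (inj₁ j))
  boundary-Marked j = (D-pos (inj₁ j) , boundary-OffCycle j) ,
    external _ (onBoundary _ (τ j , proj₁ (τ-bounds j) , proj₂ (τ-bounds j) , pos-boundary j))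

  leftMark≢rightMark : leftMark ≢ rightMark
  -- This supplies a boundary vertex, at which the external mark certainly occurs.
  leftMark≢rightMark l≡r = let (j , _) = no-isolated (source root)
                               (p , off , eq) = internal in
    differ (≡.trans (≡.sym (proj₂ (boundary-Marked j)))
      (≡.trans (only (proj₁ (boundary-Marked j))) (≡.trans (≡.sym (only off)) eq)))
    where
    only : ∀ {p} → OffCycle Q p → mark p ≡ leftMark
    only off = Sum.[ (λ eq → eq) , (λ eq → ≡.trans eq (≡.sym l≡r)) ] (marked-left-or-right off)
    differ : Sign.+ ≢ Sign.-
    differ ()

  -- The point at distance `t` before the end is the one at parameter `1# - t` from the start, so
  -- both descriptions of the left side can be evaluated at a common point.
  markedAtLeft : ∀ {e σ} → e ∈ Q → MarkedAtLeft Q o regions e σ → σ ≡ leftMark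
  markedAtLeft {e} {σ} e∈ (ε , 0<ε , at) = conclude (instance-of (<ᵉ 0<ε ∧ᵉ <ᵉ 0<1))
    where
    P = pos (source e)
    R = pos (target e)
    back : ∀ p q n t s → (p + (1# - t) * (q - p)) + s * n ≈ (q - t * (q - p)) + s * n
    back p q n t s = solve 5 (λ p q n s t → (p :+ (con 1ℤ :- t) :* (q :- p)) :+ s :* n :=
      (q :- t :* (q :- p)) :+ s :* n) refl p q n s t
    conclude : ∃[ t ] 0# < t × t < ε × t < 1# → σ ≡ leftMark
    conclude (t , 0<t , t<ε , t<1) = agree (instance-of (_∧ᵉ_ {P = λ s → mark (far s) ≡ σ} {Q = λ s → Marked leftMark (near s)}
        (at t 0<t t<ε) (left-side e∈ (1# - t) (0<1- t<1) (1-<1 0<t))))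
      where
      far near : Carrier → Point
      far s = pos (target e) -ₚ t *ₚ dir o e +ₚ s *ₚ rotate (dir o e)
      near = beside P (R -ₚ P) (1# - t)
      agree : ∃[ s ] 0# < s × mark (far s) ≡ σ × Marked leftMark (near s) → σ ≡ leftMark
      agree (s , _ , eq , marked) = ≡.trans (≡.sym eq) (proj₂ (Marked-resp {p = near s} {q = far s}
        (back (proj₁ P) (proj₁ R) (- (proj₂ R - proj₂ P)) t s ,
         back (proj₂ P) (proj₂ R) (proj₁ R - proj₁ P) t s) marked))

-- Parities of windings as finite functions of signs.

infixr 5 _xor-cong_
_xor-cong_ : ∀ {x x′ y y′} → x ≡ x′ → y ≡ y′ → (x xor y) ≡ (x′ xor y′)
_xor-cong_ = ≡.cong₂ _xor_

odd : ℕ → Bool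
odd zero    = false
odd (suc n) = not (odd n)

data Sgn : Set where
  minus zer plus : Sgn

toℤ : Sgn → ℤ
toℤ minus = -1ℤ
toℤ zer = 0ℤ
toℤ plus = 1ℤ

opp : Sgn → Sgn
opp minus = plus
opp zer = zer
opp plus = minus

infixl 7 _·_
_·_ : Sgn → Sgn → Sgn
minus · τ = opp τ
zer · τ = zer
plus · τ = τ

isPos isNeg : Sgn → Bool
isPos plus = true
isPos _   = false
isNeg minus = true
isNeg _   = false

-- wind′ as a function of s x y, s x l and s l y.
windℤ : ℤ → ℤ → ℤ → ℤ
windℤ i j k with i ℤ.≟ j | i ℤ.≟ k
... | yes _ | yes _ = i
... | _     | _     = 0ℤ

-- `Sector v u w` in terms of the signs `p`, `q`, `r` of `det v u`, `det v w`, `det w u`.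
sectorᵇ : Sgn → Sgn → Sgn → Bool
sectorᵇ p q r = if isPos p then isPos q ∧ isPos r else isPos q ∨ isPos r

-- Three numbers with sum zero can have these signs.
balanced : Sgn → Sgn → Sgn → Bool
balanced x y z = not ((isPos x ∨ isPos y ∨ isPos z) xor (isNeg x ∨ isNeg y ∨ isNeg z))

nonzero : Sgn → Bool
nonzero σ = isPos σ ∨ isNeg σ

-- Constraint for a degenerate determinant: when `σ` is zero the two directions are parallel with
-- known sense, which fixes how their signs `τ` and `ρ` against the gauge direction compare.
agree : Sgn → Sgn → Sgn → Bool
agree σ τ ρ = nonzero σ ∨ isPos (τ · ρ)

infixr 4 _⇒ᵇ_
_⇒ᵇ_ : Bool → Bool → Bool
x ⇒ᵇ y = not x ∨ y

iffᵇ : Bool → Bool → Bool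
iffᵇ x y = not (x xor y)

⇒ᵇ-elim : ∀ {x y} → (x ⇒ᵇ y) ≡ true → x ≡ true → y ≡ true
⇒ᵇ-elim e ≡.refl = e

iffᵇ-elim : ∀ {x y} → iffᵇ x y ≡ true → x ≡ y
iffᵇ-elim {false} {false} _ = ≡.refl
iffᵇ-elim {true}  {true}  _ = ≡.refl
iffᵇ-elim {false} {true}  ()
iffᵇ-elim {true}  {false} ()

∧-split : ∀ {x y} → (x ∧ y) ≡ true → x ≡ true × y ≡ true
∧-split {true} e = ≡.refl , e

forAll : (Sgn → Bool) → Bool
forAll f = f minus ∧ f zer ∧ f plus

forAll-sound : ∀ f → forAll f ≡ true → ∀ σ → f σ ≡ true
forAll-sound f e minus = proj₁ (∧-split e)
forAll-sound f e zer = proj₁ (∧-split (proj₂ (∧-split {f minus} e)))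
forAll-sound f e plus = proj₂ (∧-split {f zer} (proj₂ (∧-split {f minus} e)))

abstract
  windᵇ : Sgn → Sgn → Sgn → Bool
  windᵇ σ τ ρ = odd ∣ windℤ (toℤ σ) (toℤ τ) (toℤ ρ) ∣

  γ₂ᵇ : Sgn → Bool
  γ₂ᵇ σ = odd ∣ (1ℤ -ℤ toℤ σ) /ℕ 2 ∣

  windᵇ-def : ∀ σ τ ρ → windᵇ σ τ ρ ≡ odd ∣ windℤ (toℤ σ) (toℤ τ) (toℤ ρ) ∣
  windᵇ-def _ _ _ = ≡.refl

  γ₂ᵇ-def : ∀ σ → γ₂ᵇ σ ≡ odd ∣ (1ℤ -ℤ toℤ σ) /ℕ 2 ∣
  γ₂ᵇ-def _ = ≡.refl

  -- For the directions `d` and `v` of consecutive cycle edges: `p` is the sign of `det d v`, and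
  -- `a`, `b` are the signs of `det d l`, `det v l`. Reversing both edges and their order negates
  -- `p` and turns the pair of `a` and `opp b` into that of `opp b` and `a`.
  straight-check : Sgn → Sgn → Sgn → Bool
  straight-check p a b = nonzero a ⇒ᵇ nonzero b ⇒ᵇ agree p a b ⇒ᵇ
    iffᵇ (windᵇ p a (opp b) xor windᵇ (opp p) (opp b) a xor γ₂ᵇ a xor γ₂ᵇ b) false

  -- A third direction `w` leaves the vertex: `q`, `r`, `c` are the signs of `det v w`, `det d w`,
  -- `det w l`. The three conclusions concern a third edge directed outwards, one directed inwards,
  -- and the complementarity of the two sectors.
  branch-check : Sgn → Sgn → Sgn → Sgn → Sgn → Sgn → Bool
  branch-check p q r a b c =
    nonzero a ⇒ᵇ nonzero b ⇒ᵇ nonzero c ⇒ᵇ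
    agree p a b ⇒ᵇ agree q b (opp c) ⇒ᵇ agree r a c ⇒ᵇ
    balanced (p · c) (q · a) (opp (r · b)) ⇒ᵇ
    iffᵇ (windᵇ (opp p) (opp b) a xor windᵇ r a (opp c) xor windᵇ (opp q) (opp b) (opp c) xor γ₂ᵇ a)
         (sectorᵇ p q r) ∧
    iffᵇ (windᵇ q (opp c) (opp b) xor windᵇ (opp r) (opp c) a xor windᵇ p a (opp b) xor γ₂ᵇ a)
         (not (sectorᵇ p q r)) ∧
    iffᵇ (sectorᵇ (opp p) (opp r) (opp q)) (not (sectorᵇ p q r))

  straight : ∀ p a b → straight-check p a b ≡ true
  straight p a b =
    forAll-sound (λ b → straight-check p a b)
      (forAll-sound (λ a → forAll λ b → straight-check p a b)
        (forAll-sound (λ p → forAll λ a → forAll λ b → straight-check p a b) ≡.refl p) a) b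

  branch : ∀ p q r a b c → branch-check p q r a b c ≡ true
  branch p q r a b c =
    forAll-sound (λ c → branch-check p q r a b c)
    (forAll-sound (λ b → forAll λ c → branch-check p q r a b c)
    (forAll-sound (λ a → forAll λ b → forAll λ c → branch-check p q r a b c)
    (forAll-sound (λ r → forAll λ a → forAll λ b → forAll λ c → branch-check p q r a b c)
    (forAll-sound (λ q → forAll λ r → forAll λ a → forAll λ b → forAll λ c → branch-check p q r a b c)
    (forAll-sound (λ p → forAll λ q → forAll λ r → forAll λ a → forAll λ b → forAll λ c →
      branch-check p q r a b c) ≡.refl p) q) r) a) b) c

  straight-parity : ∀ p a b → nonzero a ≡ true → nonzero b ≡ true → agree p a b ≡ true →
    windᵇ p a (opp b) xor windᵇ (opp p) (opp b) a xor γ₂ᵇ a xor γ₂ᵇ b ≡ false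
  straight-parity p a b na nb ag =
    iffᵇ-elim (⇒ᵇ-elim (⇒ᵇ-elim (⇒ᵇ-elim (straight p a b) na) nb) ag)

  branch-parity : ∀ p q r a b c → nonzero a ≡ true → nonzero b ≡ true → nonzero c ≡ true →
    agree p a b ≡ true → agree q b (opp c) ≡ true → agree r a c ≡ true →
    balanced (p · c) (q · a) (opp (r · b)) ≡ true →
    (windᵇ (opp p) (opp b) a xor windᵇ r a (opp c) xor windᵇ (opp q) (opp b) (opp c) xor γ₂ᵇ a ≡ sectorᵇ p q r) ×
    (windᵇ q (opp c) (opp b) xor windᵇ (opp r) (opp c) a xor windᵇ p a (opp b) xor γ₂ᵇ a ≡ not (sectorᵇ p q r)) ×
    (sectorᵇ (opp p) (opp r) (opp q) ≡ not (sectorᵇ p q r))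
  branch-parity p q r a b c na nb nc ap aq ar bal =
    let (x , y) = ∧-split (⇒ᵇ-elim (⇒ᵇ-elim (⇒ᵇ-elim (⇒ᵇ-elim (⇒ᵇ-elim (⇒ᵇ-elim (⇒ᵇ-elim
                    (branch p q r a b c) na) nb) nc) ap) aq) ar) bal)
        (y , z) = ∧-split y
    in iffᵇ-elim x , iffᵇ-elim y , iffᵇ-elim z

-- Windings at a vertex of the cycle.

module Turns {c ℓ₁ ℓ₂ : Level} (K : OrderedField c ℓ₁ ℓ₂) where
  open OrderedField K
  open OrderedFieldProperties K
  open Plane K
  open PlaneProperties K
  open IntegerSolver commutativeRing

  -- The trivial components bring all cases to one universe level.
  SgnOf : Carrier → Sgn → Set _
  SgnOf x minus = x < 0# × 0# ≤ 0#
  SgnOf x zer = 0# ≤ x × x ≤ 0#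
  SgnOf x plus = 0# < x × 0# ≤ 0#

  sgn-view : ∀ x → ∃[ σ ] SgnOf x σ
  sgn-view x with compare x 0#
  ... | tri< x<0 _ _ = minus , x<0 , ≤-refl
  ... | tri≈ _ x≈0 _ = zer , inj₂ (sym x≈0) , inj₂ x≈0
  ... | tri> _ _ 0<x = plus , 0<x , ≤-refl

  SgnOf-sgn : ∀ {x} σ → SgnOf x σ → sgn x ≡ toℤ σ
  SgnOf-sgn {x} σ s with compare x 0#
  SgnOf-sgn minus s         | tri< _ _ _   = ≡.refl
  SgnOf-sgn zer (0≤ , _)  | tri< x<0 _ _ = ⊥-elim (<-≤-absurd x<0 0≤)
  SgnOf-sgn plus (0< , _)  | tri< x<0 _ _ = ⊥-elim (<-asym 0< x<0)
  SgnOf-sgn minus (<0 , _)  | tri≈ _ x≈0 _ = ⊥-elim (<-irrefl x≈0 <0)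
  SgnOf-sgn zer s         | tri≈ _ _ _   = ≡.refl
  SgnOf-sgn plus (0< , _)  | tri≈ _ x≈0 _ = ⊥-elim (<-irrefl (sym x≈0) 0<)
  SgnOf-sgn minus (<0 , _)  | tri> _ _ 0<x = ⊥-elim (<-asym <0 0<x)
  SgnOf-sgn zer (_ , ≤0)  | tri> _ _ 0<x = ⊥-elim (<-≤-absurd 0<x ≤0)
  SgnOf-sgn plus s         | tri> _ _ _   = ≡.refl

  SgnOf-resp : ∀ {x y} σ → x ≈ y → SgnOf x σ → SgnOf y σ
  SgnOf-resp minus e (s , t) = <-respˡ-≈ e s , t
  SgnOf-resp zer e (s , t) = 0≤≈ e s , ≤-respˡ-≈ e t
  SgnOf-resp plus e (s , t) = 0<≈ e s , t

  SgnOf-opp : ∀ {x y} σ → - x ≈ y → SgnOf x σ → SgnOf y (opp σ)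
  SgnOf-opp minus e (s , t) = 0<≈ e (<0⇒0<- s) , t
  SgnOf-opp zer e (s , t) = 0≤≈ e (≤0⇒0≤- t) , ≤-respˡ-≈ e (0≤-⇒≤0 (0≤≈ (solve 1 (λ x → x := :- (:- x)) refl _) s))
  SgnOf-opp plus e (s , t) = <-respˡ-≈ e (0<⇒-<0 s) , t

  SgnOf-zero : ∀ {x} → SgnOf x zer → x ≈ 0#
  SgnOf-zero (inj₁ 0<x , x≤0) = ⊥-elim (<-≤-absurd 0<x x≤0)
  SgnOf-zero (inj₂ 0≈x , _) = sym 0≈x

  ≈0⇒SgnOf : ∀ {x} → x ≈ 0# → SgnOf x zer
  ≈0⇒SgnOf e = inj₂ (sym e) , inj₂ e

  SgnOf-* : ∀ {x y} σ τ → SgnOf x σ → SgnOf y τ → SgnOf (x * y) (σ · τ)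
  SgnOf-* zer τ s t = ≈0⇒SgnOf (trans (*-congʳ (SgnOf-zero s)) (zeroˡ _))
  SgnOf-* minus zer s t = ≈0⇒SgnOf (trans (*-congˡ (SgnOf-zero t)) (zeroʳ _))
  SgnOf-* plus zer s t = ≈0⇒SgnOf (trans (*-congˡ (SgnOf-zero t)) (zeroʳ _))
  SgnOf-* minus minus (s , z) (t , _) = *-neg-neg s t , z
  SgnOf-* minus plus (s , z) (t , _) =
    0<-⇒<0 (0<≈ (solve 2 (λ x y → (:- x) :* y := :- (x :* y)) refl _ _) (*-pos (<0⇒0<- s) t)) , z
  SgnOf-* plus minus (s , z) (t , _) =
    0<-⇒<0 (0<≈ (solve 2 (λ x y → x :* (:- y) := :- (x :* y)) refl _ _) (*-pos s (<0⇒0<- t))) , z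
  SgnOf-* plus plus (s , z) (t , _) = *-pos s t , z

  SgnOf-isPos : ∀ {x} σ → SgnOf x σ → 0# < x → isPos σ ≡ true
  SgnOf-isPos minus (s , _) 0<x = ⊥-elim (<-asym s 0<x)
  SgnOf-isPos zer (_ , s) 0<x = ⊥-elim (<-≤-absurd 0<x s)
  SgnOf-isPos plus _ _ = ≡.refl

  SgnOf-notPos : ∀ {x} σ → SgnOf x σ → x ≤ 0# → isPos σ ≡ false
  SgnOf-notPos minus _ _ = ≡.refl
  SgnOf-notPos zer _ _ = ≡.refl
  SgnOf-notPos plus (s , _) x≤0 = ⊥-elim (<-≤-absurd s x≤0)

  SgnOf-nonzero : ∀ {x} σ → SgnOf x σ → ¬ (x ≈ 0#) → nonzero σ ≡ true
  SgnOf-nonzero minus _ _ = ≡.refl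
  SgnOf-nonzero zer s x≉0 = ⊥-elim (x≉0 (SgnOf-zero s))
  SgnOf-nonzero plus _ _ = ≡.refl

  SgnOf-0≤ : ∀ {x} σ → SgnOf x σ → isNeg σ ≡ false → 0# ≤ x
  SgnOf-0≤ zer (0≤x , _) _ = 0≤x
  SgnOf-0≤ plus (0<x , _) _ = inj₁ 0<x

  SgnOf-0< : ∀ {x} σ → SgnOf x σ → isPos σ ≡ true → 0# < x
  SgnOf-0< plus (0<x , _) _ = 0<x

  isNeg-opp : ∀ σ → isNeg (opp σ) ≡ isPos σ
  isNeg-opp minus = ≡.refl
  isNeg-opp zer   = ≡.refl
  isNeg-opp plus  = ≡.refl

  isPos-opp : ∀ σ → isPos (opp σ) ≡ isNeg σ
  isPos-opp minus = ≡.refl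
  isPos-opp zer   = ≡.refl
  isPos-opp plus  = ≡.refl

  not-all-nonnegative : ∀ {x y z} σ τ ρ → SgnOf x σ → SgnOf y τ → SgnOf z ρ → x + y + z ≈ 0# →
    (isPos σ ∨ isPos τ ∨ isPos ρ) ≡ true → ¬ ((isNeg σ ∨ isNeg τ ∨ isNeg ρ) ≡ false)
  not-all-nonnegative {x} {y} {z} σ τ ρ sx sy sz e some none with isNeg σ in nσ | isNeg τ in nτ | isNeg ρ in nρ
  ... | false | false | false = positive (isPos σ) (isPos τ) ≡.refl ≡.refl some
    where
    0≤x = SgnOf-0≤ σ sx nσ
    0≤y = SgnOf-0≤ τ sy nτ
    0≤z = SgnOf-0≤ ρ sz nρ
    positive : ∀ p q → isPos σ ≡ p → isPos τ ≡ q → (p ∨ q ∨ isPos ρ) ≡ true → ⊥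
    positive true  _     pσ _  _  = 0<⇒≉0 (0<+0≤ (0<+0≤ (SgnOf-0< σ sx pσ) 0≤y) 0≤z) e
    positive false true  _  pτ _  = 0<⇒≉0 (0<+0≤ (0≤+0< 0≤x (SgnOf-0< τ sy pτ)) 0≤z) e
    positive false false _  _  pρ = 0<⇒≉0 (0≤+0< (0≤+ 0≤x 0≤y) (SgnOf-0< ρ sz pρ)) e

  SgnOf-balanced : ∀ {x y z} σ τ ρ → SgnOf x σ → SgnOf y τ → SgnOf z ρ → x + y + z ≈ 0# →
                   balanced σ τ ρ ≡ true
  SgnOf-balanced {x} {y} {z} σ τ ρ sx sy sz e
    with isPos σ ∨ isPos τ ∨ isPos ρ in P | isNeg σ ∨ isNeg τ ∨ isNeg ρ in N
  ... | true  | true  = ≡.refl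
  ... | false | false = ≡.refl
  ... | true  | false = ⊥-elim (not-all-nonnegative σ τ ρ sx sy sz e P N)
  -- Negating all three numbers exchanges positive and negative and reduces to the preceding case.
  ... | false | true  = ⊥-elim (not-all-nonnegative (opp σ) (opp τ) (opp ρ)
    (SgnOf-opp σ refl sx) (SgnOf-opp τ refl sy) (SgnOf-opp ρ refl sz)
    (trans (solve 3 (λ x y z → (:- x) :+ (:- y) :+ (:- z) := :- (x :+ y :+ z)) refl x y z) (neg-≈0 e))
    (≡.trans (≡.cong₂ _∨_ (isPos-opp σ) (≡.cong₂ _∨_ (isPos-opp τ) (isPos-opp ρ))) N)
    (≡.trans (≡.cong₂ _∨_ (isNeg-opp σ) (≡.cong₂ _∨_ (isNeg-opp τ) (isNeg-opp ρ))) P))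

  det-flipˡ : ∀ x y q → - det (x -ₚ y) q ≈ det (y -ₚ x) q
  det-flipˡ (x , x′) (y , y′) (q , q′) = solve 6 (λ x x′ y y′ q q′ →
    :- :det ((x , x′) :-ₚ (y , y′)) (q , q′) := :det ((y , y′) :-ₚ (x , x′)) (q , q′)) refl x x′ y y′ q q′

  det-flip-swap : ∀ x y q → det (x -ₚ y) q ≈ det q (y -ₚ x)
  det-flip-swap (x , x′) (y , y′) (q , q′) = solve 6 (λ x x′ y y′ q q′ →
    :det ((x , x′) :-ₚ (y , y′)) (q , q′) := :det (q , q′) ((y , y′) :-ₚ (x , x′))) refl x x′ y y′ q q′

  module _ (l : Point) where

    windP : Point → Point → Bool
    windP x y = odd ∣ windℤ (s x y) (s x l) (s l y) ∣

    γ₂P : Point → Bool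
    γ₂P x = odd ∣ (1ℤ -ℤ s x l) /ℕ 2 ∣

    windP-sgn : ∀ {x y} σ τ ρ → SgnOf (det x y) σ → SgnOf (det x l) τ → SgnOf (det l y) ρ →
                windP x y ≡ windᵇ σ τ ρ
    windP-sgn σ τ ρ a b c = ≡.trans (cong₃ (λ i j k → odd ∣ windℤ i j k ∣)
      (SgnOf-sgn σ a) (SgnOf-sgn τ b) (SgnOf-sgn ρ c)) (≡.sym (windᵇ-def σ τ ρ))
      where
      cong₃ : ∀ {i i′ j j′ k k′ : ℤ} (f : ℤ → ℤ → ℤ → Bool) → i ≡ i′ → j ≡ j′ → k ≡ k′ → f i j k ≡ f i′ j′ k′
      cong₃ f ≡.refl ≡.refl ≡.refl = ≡.refl

    γ₂P-sgn : ∀ {x} σ → SgnOf (det x l) σ → γ₂P x ≡ γ₂ᵇ σ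
    γ₂P-sgn σ a = ≡.trans (≡.cong (λ i → odd ∣ (1ℤ -ℤ i) /ℕ 2 ∣) (SgnOf-sgn σ a)) (≡.sym (γ₂ᵇ-def σ))

    -- `A`, `V`, `B` are consecutive vertices of the cycle; `d₁` and `v` are the directions of the
    -- two edges, `u` and `v′` those after reversal.
    module Turn (A V B : Point) (Al : ¬ (det (V -ₚ A) l ≈ 0#)) (Bl : ¬ (det (B -ₚ V) l ≈ 0#))
             (0<u : 0# < dot (A -ₚ V) (A -ₚ V)) (0<v : 0# < dot (B -ₚ V) (B -ₚ V))
             (vu : Diverging (B -ₚ V) (A -ₚ V)) where
      private
        d₁ = V -ₚ A
        u  = A -ₚ V
        v  = B -ₚ V
        v′ = V -ₚ B
        P = sgn-view (det d₁ v)
        SA = sgn-view (det d₁ l)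
        SB = sgn-view (det v l)
        p = proj₁ P
        a = proj₁ SA
        b = proj₁ SB

        -- The vectors are antiparallel, so expanding `det l y` along `x` leaves only a negative
        -- multiple of `det l x`.
        opposite-signs : ∀ {x y} → 0# < dot x x → 0# < dot y y → Diverging x y → det x y ≈ 0# →
                         ¬ (det x l ≈ 0#) → 0# < - det x l * det y l
        opposite-signs {x} {y} 0<x 0<y xy e x≉ = 0<-cancelˡ 0<x (0<≈ (begin
            (- dot x y) * (X * X)
              ≈⟨ solve 3 (λ d X Z → (:- d) :* (X :* X) := X :* (d :* (:- X) :+ con 0ℤ :* Z)) refl _ X (dot l x) ⟩
            X * (dot x y * - X + 0# * dot l x)
              ≈⟨ *-congˡ (+-cong (*-congˡ (det-antisym x l)) (*-congʳ (sym e))) ⟩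
            X * (dot x y * det l x + det x y * dot l x)   ≈⟨ *-congˡ (det-expand x l y) ⟨
            X * (dot x x * det l y)                       ≈⟨ *-congˡ (*-congˡ (det-antisym y l)) ⟨
            X * (dot x x * - det y l)
              ≈⟨ solve 3 (λ X d Y → X :* (d :* (:- Y)) := d :* ((:- X) :* Y)) refl X _ _ ⟩
            dot x x * (- X * det y l)                     ∎)
          (*-pos (<0⇒0<- (diverging-opposite 0<x 0<y xy e)) (0<sq x≉)))
          where
          open SetoidReasoning setoid
          X = det x l

        agrees : ∀ {X} σ τ ρ → SgnOf X σ → (X ≈ 0# → isPos (τ · ρ) ≡ true) → agree σ τ ρ ≡ true
        agrees minus τ ρ s _ = ≡.refl
        agrees zer τ ρ s f = f (SgnOf-zero s)
        agrees plus τ ρ s _ = ≡.refl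

        du≈ : det v u ≈ det d₁ v
        du≈ = sym (det-flip-swap V A v)

        -- Diverging arms with zero determinant are opposite, so `d₁`, the negative of `u`, points
        -- the same way as `v`.
        agree-p : agree p a b ≡ true
        agree-p = agrees p a b (proj₂ P) λ e → SgnOf-isPos (a · b) (SgnOf-* a b (proj₂ SA) (proj₂ SB))
          (0<≈ (trans (solve 2 (λ X Y → (:- Y) :* X := (:- X) :* Y) refl _ _) (*-congʳ (det-flipˡ A V l)))
            (opposite-signs 0<v 0<u vu (trans du≈ e) Bl))

        nonzero-a = SgnOf-nonzero a (proj₂ SA) Al
        nonzero-b = SgnOf-nonzero b (proj₂ SB) Bl

        wind-d₁v : windP d₁ v ≡ windᵇ p a (opp b)
        wind-d₁v = windP-sgn p a (opp b) (proj₂ P) (proj₂ SA) (SgnOf-opp b (det-antisym v l) (proj₂ SB))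

        wind-v′u : windP v′ u ≡ windᵇ (opp p) (opp b) a
        wind-v′u = windP-sgn (opp p) (opp b) a
          (SgnOf-opp p (trans (-‿cong (sym du≈)) (det-flipˡ B V u)) (proj₂ P))
          (SgnOf-opp b (det-flipˡ B V l) (proj₂ SB))
          (SgnOf-resp a (det-flip-swap V A l) (proj₂ SA))

      wind-straight : windP d₁ v xor windP v′ u xor γ₂P d₁ xor γ₂P v ≡ false
      wind-straight = ≡.trans
        (wind-d₁v xor-cong wind-v′u xor-cong γ₂P-sgn a (proj₂ SA) xor-cong γ₂P-sgn b (proj₂ SB))
        (straight-parity p a b nonzero-a nonzero-b agree-p)

      module Branch (U : Point) (Wl : ¬ (det (U -ₚ V) l ≈ 0#)) (0<w : 0# < dot (U -ₚ V) (U -ₚ V))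
               (vw : Diverging (B -ₚ V) (U -ₚ V)) (uw : Diverging (A -ₚ V) (U -ₚ V)) where
        private
          w  = U -ₚ V
          w′ = V -ₚ U
          Q = sgn-view (det v w)
          R = sgn-view (det d₁ w)
          SC = sgn-view (det w l)
          q = proj₁ Q
          r = proj₁ R
          c′ = proj₁ SC

          agree-q : agree q b (opp c′) ≡ true
          agree-q = agrees q b (opp c′) (proj₂ Q) λ e → SgnOf-isPos (b · opp c′)
            (SgnOf-* b (opp c′) (proj₂ SB) (SgnOf-opp c′ refl (proj₂ SC)))
            (0<≈ (solve 2 (λ X Y → (:- X) :* Y := X :* (:- Y)) refl _ _) (opposite-signs 0<v 0<w vw e Bl))

          agree-r : agree r a c′ ≡ true
          agree-r = agrees r a c′ (proj₂ R) λ e → SgnOf-isPos (a · c′)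
            (SgnOf-* a c′ (proj₂ SA) (proj₂ SC))
            (0<≈ (*-congʳ (det-flipˡ A V l)) (opposite-signs 0<u 0<w uw
              (trans (sym (det-flipˡ V A w)) (neg-≈0 e))
              (λ e′ → Al (trans (sym (det-flipˡ A V l)) (neg-≈0 e′)))))

          -- The relation for the four vectors `d`, `v`, `w`, `l`; it rules out those sign patterns
          -- that cannot occur in the plane.
          plücker : ∀ d v w → det d v * det w l + det v w * det d l + - (det d w * det v l) ≈ 0#
          plücker (d , d′) (v , v′) (w , w′) = solve 8 (λ d d′ v v′ w w′ m m′ →
            let x = d , d′; y = v , v′; z = w , w′; l = m , m′ in
            :det x y :* :det z l :+ :det y z :* :det x l :+ (:- (:det x z :* :det y l)) := con 0ℤ)
            refl d d′ v v′ w w′ (proj₁ l) (proj₂ l)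

          checked = branch-parity p q r a b c′ nonzero-a nonzero-b
            (SgnOf-nonzero c′ (proj₂ SC) Wl) agree-p agree-q agree-r
            (SgnOf-balanced (p · c′) (q · a) (opp (r · b))
              (SgnOf-* p c′ (proj₂ P) (proj₂ SC)) (SgnOf-* q a (proj₂ Q) (proj₂ SA))
              (SgnOf-opp (r · b) refl (SgnOf-* r b (proj₂ R) (proj₂ SB)))
              (plücker d₁ v w))

          sectorᵇ-complete : ∀ {x y z} p q r → SgnOf (det x y) p → SgnOf (det x z) q → SgnOf (det z y) r →
                             Sector x y z → sectorᵇ p q r ≡ true
          sectorᵇ-complete p q r sp sq sr (inj₁ (0<p , 0<q , 0<r))
            rewrite SgnOf-isPos p sp 0<p | SgnOf-isPos q sq 0<q | SgnOf-isPos r sr 0<r = ≡.refl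
          sectorᵇ-complete p q r sp sq sr (inj₂ (p≤0 , inj₁ 0<q))
            rewrite SgnOf-notPos p sp p≤0 | SgnOf-isPos q sq 0<q = ≡.refl
          sectorᵇ-complete p q r sp sq sr (inj₂ (p≤0 , inj₂ 0<r))
            rewrite SgnOf-notPos p sp p≤0 | SgnOf-isPos r sr 0<r with isPos q
          ... | true  = ≡.refl
          ... | false = ≡.refl

        in-left : Sector v u w → sectorᵇ p q r ≡ true
        in-left = sectorᵇ-complete p q r (SgnOf-resp p (sym du≈) (proj₂ P)) (proj₂ Q)
          (SgnOf-resp r (det-flip-swap V A w) (proj₂ R))

        in-right : Sector u v w → sectorᵇ p q r ≡ false
        -- The sector from `u` to `v` has the signs `opp p`, `opp r`, `opp q`; the enumeration shows
        -- it to be the complement.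
        in-right s = not-true (≡.trans (≡.sym (proj₂ (proj₂ checked)))
          (sectorᵇ-complete (opp p) (opp r) (opp q)
            (SgnOf-opp p (det-flipˡ V A v) (proj₂ P)) (SgnOf-opp r (det-flipˡ V A w) (proj₂ R))
            (SgnOf-opp q (det-antisym v w) (proj₂ Q)) s))
          where
          not-true : ∀ {x} → not x ≡ true → x ≡ false
          not-true {false} _ = ≡.refl

        private
          SC′ : SgnOf (det l w) (opp c′)
          SC′ = SgnOf-opp c′ (det-antisym w l) (proj₂ SC)

          SW : SgnOf (det w′ l) (opp c′)
          SW = SgnOf-opp c′ (det-flipˡ U V l) (proj₂ SC)

        wind-out : windP v′ u xor windP d₁ w xor windP v′ w xor γ₂P d₁ ≡ sectorᵇ p q r
        wind-out = ≡.trans (wind-v′u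
          xor-cong windP-sgn r a (opp c′) (proj₂ R) (proj₂ SA) SC′
          xor-cong windP-sgn (opp q) (opp b) (opp c′) (SgnOf-opp q (det-flipˡ B V w) (proj₂ Q))
                     (SgnOf-opp b (det-flipˡ B V l) (proj₂ SB)) SC′
          xor-cong γ₂P-sgn a (proj₂ SA)) (proj₁ checked)

        wind-in : windP w′ v xor windP w′ u xor windP d₁ v xor γ₂P d₁ ≡ not (sectorᵇ p q r)
        wind-in = ≡.trans (windP-sgn q (opp c′) (opp b) (SgnOf-resp q (sym (det-flip-swap V U v)) (proj₂ Q)) SW
                     (SgnOf-opp b (det-antisym v l) (proj₂ SB))
          xor-cong windP-sgn (opp r) (opp c′) a
                     (SgnOf-opp r (trans (-‿cong (det-flip-swap V A w)) (det-flipˡ U V u)) (proj₂ R)) SW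
                     (SgnOf-resp a (det-flip-swap V A l) (proj₂ SA))
          xor-cong wind-d₁v
          xor-cong γ₂P-sgn a (proj₂ SA)) (proj₁ (proj₂ checked))

-- The algebra of a vertex relation.

module Signs {c ℓ₁ ℓ₂ : Level} (K : OrderedField c ℓ₁ ℓ₂) where
  open OrderedField K
  open IntegerSolver commutativeRing
  open SetoidReasoning setoid

  -- Abstract, so that b can be inferred from ± b.
  abstract
    ± : Bool → Carrier
    ± true  = - 1#
    ± false = 1#

    parity-± : ∀ k → parity k ≈ ± (odd k)
    parity-± zero    = refl
    parity-± (suc k) = trans (*-congˡ (parity-± k)) (flip (odd k))
      where
      flip : ∀ b → - 1# * ± b ≈ ± (not b)
      flip true  = solve 0 ((:- con 1ℤ) :* (:- con 1ℤ) := con 1ℤ) refl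
      flip false = *-identityʳ _

    ±-xor : ∀ x y → ± (x xor y) ≈ ± x * ± y
    ±-xor true true   = solve 0 (con 1ℤ := (:- con 1ℤ) :* (:- con 1ℤ)) refl
    ±-xor true false  = sym (*-identityʳ _)
    ±-xor false y     = sym (*-identityˡ _)

    ±-not : ∀ x → ± (not x) ≈ - ± x
    ±-not true  = solve 0 (con 1ℤ := :- (:- con 1ℤ)) refl
    ±-not false = refl

    ±-square : ∀ x → ± x * ± x ≈ 1#
    ±-square true  = solve 0 ((:- con 1ℤ) :* (:- con 1ℤ) := con 1ℤ) refl
    ±-square false = *-identityʳ _

    ±-false : ± false ≈ 1#
    ±-false = refl

  ±-xor₄ : ∀ x y z t → ± (x xor y xor z xor t) ≈ ± x * (± y * (± z * ± t))
  ±-xor₄ x y z t = trans (±-xor x _) (*-congˡ (trans (±-xor y _) (*-congˡ (±-xor z t))))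

  unit-* : ∀ {x y} → x ≈ 1# → y ≈ 1# → x * y ≈ 1#
  unit-* x≈1 y≈1 = trans (*-cong x≈1 y≈1) (*-identityʳ 1#)

  unit-drop : ∀ {x y} → x ≈ 1# → x * y ≈ y
  unit-drop {y = y} x≈1 = trans (*-congʳ x≈1) (*-identityˡ y)

  unit-cancel : ∀ {u v x y} → u * v ≈ 1# → u * x ≈ u * y → x ≈ y
  unit-cancel {u} {v} {x} {y} uv≈1 e = begin
    x             ≈⟨ unit-drop uv≈1 ⟨
    u * v * x     ≈⟨ solve 3 (λ u v x → u :* v :* x := v :* (u :* x)) refl u v x ⟩
    v * (u * x)   ≈⟨ *-congˡ e ⟩
    v * (u * y)   ≈⟨ solve 3 (λ u v x → u :* v :* x := v :* (u :* x)) refl u v y ⟨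
    u * v * y     ≈⟨ unit-drop uv≈1 ⟩
    y             ∎

  -- The relation at a vertex of the cycle in the form T = i₁ w₁⁻¹ X₁ , with T = ε₁₂ X₂ + S.
  module _ {i₁ w₁ v₁ X₁ T : Carrier} (i²≈1 : i₁ * i₁ ≈ 1#) (wv≈1 : w₁ * v₁ ≈ 1#) where

    isolate : X₁ ≈ i₁ * w₁ * T → T ≈ i₁ * v₁ * X₁
    isolate e = begin
      T                            ≈⟨ unit-drop (unit-* i²≈1 wv≈1) ⟨
      (i₁ * i₁) * (w₁ * v₁) * T
        ≈⟨ solve 4 (λ i w v T → (i :* i) :* (w :* v) :* T := i :* v :* (i :* w :* T)) refl i₁ w₁ v₁ T ⟩
      i₁ * v₁ * (i₁ * w₁ * T)      ≈⟨ *-congˡ e ⟨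
      i₁ * v₁ * X₁                 ∎

    restore : T ≈ i₁ * v₁ * X₁ → X₁ ≈ i₁ * w₁ * T
    restore e = sym (begin
      i₁ * w₁ * T                  ≈⟨ *-congˡ e ⟩
      i₁ * w₁ * (i₁ * v₁ * X₁)
        ≈⟨ solve 4 (λ i w v X → i :* w :* (i :* v :* X) := (i :* i) :* (w :* v) :* X) refl i₁ w₁ v₁ X₁ ⟩
      (i₁ * i₁) * (w₁ * v₁) * X₁   ≈⟨ unit-drop (unit-* i²≈1 wv≈1) ⟩
      X₁                           ∎)

  module _ {i₁ i₂ a b g₁ g₂ L γ₁ γ₂ w₂ v₁ v₂ X₁ X₂ S X̂₁ X̂₂ Ŝ : Carrier}
           (i₂² : i₂ * i₂ ≈ 1#) (a² : a * a ≈ 1#) (b² : b * b ≈ 1#) (g² : g₁ * g₁ ≈ 1#) (L² : L * L ≈ 1#)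
           (turning : a * (b * (g₁ * g₂)) ≈ 1#) (γ₁≈ : γ₁ ≈ L * g₁ * i₁) (γ₂≈ : γ₂ ≈ L * g₂ * i₂)
           (w₂v₂ : w₂ * v₂ ≈ 1#) (X̂₁≈ : X̂₁ ≈ γ₁ * v₁ * X₁) (X̂₂≈ : X̂₂ ≈ γ₂ * v₂ * X₂)
           (Ŝ≈ : Ŝ ≈ - (b * L * g₁) * S) where
    private
      m = b * L * g₁
      k = i₂ * v₂ * m
      k⁻¹ = i₂ * w₂ * m

      unit : k * k⁻¹ ≈ 1#
      unit = trans (solve 6 (λ i w v b L g → i :* v :* (b :* L :* g) :* (i :* w :* (b :* L :* g)) :=
               (i :* i) :* ((w :* v) :* ((b :* b) :* ((L :* L) :* (g :* g))))) refl i₂ w₂ v₂ b L g₁)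
             (unit-* i₂² (unit-* w₂v₂ (unit-* b² (unit-* L² g²))))

      -- The parity of the turn, solved for the γ₂ sign of the second edge.
      g₂≈ : g₂ ≈ a * b * g₁
      g₂≈ = begin
        g₂                                                ≈⟨ unit-drop (unit-* a² (unit-* b² g²)) ⟨
        (a * a) * ((b * b) * (g₁ * g₁)) * g₂
          ≈⟨ solve 4 (λ a b g h → (a :* a) :* ((b :* b) :* (g :* g)) :* h := a :* b :* g :* (a :* (b :* (g :* h))))
               refl a b g₁ g₂ ⟩
        a * b * g₁ * (a * (b * (g₁ * g₂)))                ≈⟨ *-congˡ turning ⟩
        a * b * g₁ * 1#                                   ≈⟨ *-identityʳ _ ⟩
        a * b * g₁                                        ∎

      left : X̂₂ ≈ k * (a * X₂)
      left = begin
        X̂₂                                   ≈⟨ X̂₂≈ ⟩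
        γ₂ * v₂ * X₂                         ≈⟨ *-congʳ (*-congʳ (trans γ₂≈ (*-congʳ (*-congˡ g₂≈)))) ⟩
        L * (a * b * g₁) * i₂ * v₂ * X₂
          ≈⟨ solve 7 (λ L a b g i v X → L :* (a :* b :* g) :* i :* v :* X := i :* v :* (b :* L :* g) :* (a :* X))
               refl L a b g₁ i₂ v₂ X₂ ⟩
        k * (a * X₂)                         ∎

      right : i₂ * v₂ * (b * X̂₁ + Ŝ) ≈ k * (i₁ * v₁ * X₁ - S)
      right = begin
        i₂ * v₂ * (b * X̂₁ + Ŝ)
          ≈⟨ *-congˡ (+-cong (*-congˡ (trans X̂₁≈ (*-congʳ (*-congʳ γ₁≈)))) Ŝ≈) ⟩
        i₂ * v₂ * (b * (L * g₁ * i₁ * v₁ * X₁) + - m * S)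
          ≈⟨ solve 9 (λ i₂ v₂ b L g i₁ v₁ X S → i₂ :* v₂ :* (b :* (L :* g :* i₁ :* v₁ :* X) :+ (:- (b :* L :* g)) :* S) :=
               i₂ :* v₂ :* (b :* L :* g) :* (i₁ :* v₁ :* X :- S)) refl i₂ v₂ b L g₁ i₁ v₁ X₁ S ⟩
        k * (i₁ * v₁ * X₁ - S)               ∎

    -- `X̂₂` is `k * (a * X₂)` and the new right side is `k * (i₁ * v₁ * X₁ - S)`. The factor `k` is
    -- invertible, so the two relations are the same equation solved for different terms.
    reversed : a * X₂ + S ≈ i₁ * v₁ * X₁ → X̂₂ ≈ i₂ * v₂ * (b * X̂₁ + Ŝ)
    reversed e = trans left (trans (*-congˡ (trans
      (solve 2 (λ x s → x := (x :+ s) :- s) refl (a * X₂) S) (+-congʳ e))) (sym right))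

    unreversed : X̂₂ ≈ i₂ * v₂ * (b * X̂₁ + Ŝ) → a * X₂ + S ≈ i₁ * v₁ * X₁
    unreversed e = trans (+-congʳ (unit-cancel unit (trans (sym left) (trans e right))))
      (solve 2 (λ x s → (x :- s) :+ s := x) refl _ S)

  module _ {i w a p q g₁ L i₁ γ γ₁ v₁ X X₁ X₂ X̂ X̂₁ : Carrier}
           (a² : a * a ≈ 1#) (p² : p * p ≈ 1#) (q² : q * q ≈ 1#) (g² : g₁ * g₁ ≈ 1#) (L² : L * L ≈ 1#)
           (branching : p * (q * (a * g₁)) ≈ L * γ) (γ₁≈ : γ₁ ≈ L * g₁ * i₁)
           (X̂₁≈ : X̂₁ ≈ γ₁ * v₁ * X₁) (X̂≈ : X̂ ≈ γ * X) (main : a * X₂ ≈ i₁ * v₁ * X₁) where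
    private
      k = q * L * g₁ * a * p

      unit : k * k ≈ 1#
      unit = trans (solve 5 (λ a p q g L → let k = q :* L :* g :* a :* p in
                 k :* k := (a :* a) :* ((p :* p) :* ((q :* q) :* ((g :* g) :* (L :* L))))) refl a p q g₁ L)
             (unit-* a² (unit-* p² (unit-* q² (unit-* g² L²))))

      left : X̂ ≈ k * X
      left = begin
        X̂                                    ≈⟨ X̂≈ ⟩
        γ * X                                ≈⟨ unit-drop L² ⟨
        L * L * (γ * X)
          ≈⟨ solve 3 (λ L γ X → L :* L :* (γ :* X) := L :* (L :* γ) :* X) refl L γ X ⟩
        L * (L * γ) * X                      ≈⟨ *-congʳ (*-congˡ branching) ⟨
        L * (p * (q * (a * g₁))) * X
          ≈⟨ solve 6 (λ L p q a g X → L :* (p :* (q :* (a :* g))) :* X := q :* L :* g :* a :* p :* X)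
               refl L p q a g₁ X ⟩
        k * X                                ∎

      right : i * w * (q * X̂₁) ≈ k * (i * w * (p * X₂))
      right = begin
        i * w * (q * X̂₁)                         ≈⟨ *-congˡ (*-congˡ (trans X̂₁≈ (*-congʳ (*-congʳ γ₁≈)))) ⟩
        i * w * (q * (L * g₁ * i₁ * v₁ * X₁))
          ≈⟨ solve 8 (λ i w q L g i₁ v X → i :* w :* (q :* (L :* g :* i₁ :* v :* X)) := i :* w :* (q :* L :* g :* (i₁ :* v :* X)))
               refl i w q L g₁ i₁ v₁ X₁ ⟩
        i * w * (q * L * g₁ * (i₁ * v₁ * X₁))    ≈⟨ *-congˡ (*-congˡ main) ⟨
        i * w * (q * L * g₁ * (a * X₂))          ≈⟨ unit-drop p² ⟨
        p * p * (i * w * (q * L * g₁ * (a * X₂)))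
          ≈⟨ solve 8 (λ p i w q L g a X → p :* p :* (i :* w :* (q :* L :* g :* (a :* X))) :=
               q :* L :* g :* a :* p :* (i :* w :* (p :* X))) refl p i w q L g₁ a X₂ ⟩
        k * (i * w * (p * X₂))                   ∎

    -- A third edge entering the vertex sees only `X₂` before the reversal and only `X̂₁` after it.
    -- The relation `main` of the cycle edge converts one into the other, leaving a sign `k`.
    side-reversed : X ≈ i * w * (p * X₂) → X̂ ≈ i * w * (q * X̂₁)
    side-reversed e = trans left (trans (*-congˡ e) (sym right))

    side-unreversed : X̂ ≈ i * w * (q * X̂₁) → X ≈ i * w * (p * X₂)
    side-unreversed e = unit-cancel unit (trans (sym left) (trans e right))

-- Sums over filtered lists of edges.

module Sums {c ℓ₁ ℓ₂ : Level} (K : OrderedField c ℓ₁ ℓ₂) {r : ℕ} where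
  open OrderedField K
  open IntegerSolver commutativeRing

  -- ∑ of EdgeVectors, which does not depend on the network.
  sum : List (Fin r) → (Fin r → Carrier) → Carrier
  sum es f = foldr _+_ 0# (map f es)

  sum-cong : ∀ {f g} es → (∀ {e} → e ∈ es → f e ≈ g e) → sum es f ≈ sum es g
  sum-cong []       h = refl
  sum-cong (e ∷ es) h = +-cong (h (here ≡.refl)) (sum-cong es (λ e∈ → h (there e∈)))

  sum-scale : ∀ k {f} es → sum es (λ e → k * f e) ≈ k * sum es f
  sum-scale k []       = sym (zeroʳ k)
  sum-scale k (e ∷ es) = trans (+-congˡ (sum-scale k es)) (sym (distribˡ k _ _))

  sum-empty : ∀ {f} es → (∀ {e} → ¬ (e ∈ es)) → sum es f ≈ 0#
  sum-empty []       _  = refl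
  sum-empty (e ∷ es) ∉ = ⊥-elim (∉ (here ≡.refl))

  module _ {a b : Level} {A : Pred (Fin r) a} {B : Pred (Fin r) b} (A? : Decidable A) (B? : Decidable B) where

    sum-filter-≐ : ∀ f {es} → (∀ {e} → e ∈ es → (A e → B e) × (B e → A e)) → sum (filter A? es) f ≈ sum (filter B? es) f
    sum-filter-≐ f {[]} h = refl
    sum-filter-≐ f {e ∷ es} h with A? e | B? e
    ... | yes _ | yes _ = +-congˡ (sum-filter-≐ f (λ e∈ → h (there e∈)))
    ... | no _  | no _  = sum-filter-≐ f (λ e∈ → h (there e∈))
    ... | yes p | no ¬q = ⊥-elim (¬q (proj₁ (h (here ≡.refl)) p))
    ... | no ¬p | yes q = ⊥-elim (¬p (proj₂ (h (here ≡.refl)) q))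

    -- As `es` has no repetitions, `c` is met once and the filters agree on all the rest.
    sum-extract : ∀ f {es c} → Unique es → c ∈ es → A c → ¬ B c → (∀ {e} → e ≢ c → (A e → B e) × (B e → A e)) →
                  sum (filter A? es) f ≈ f c + sum (filter B? es) f
    sum-extract f {e ∷ es} (e∉ ∷ _) (here ≡.refl) Ac ¬Bc h with A? e | B? e
    ... | yes _ | no _  = +-congˡ (sum-filter-≐ f (λ d∈ → h (λ { ≡.refl → All.lookup e∉ d∈ ≡.refl })))
    ... | no ¬A | _     = ⊥-elim (¬A Ac)
    ... | yes _ | yes B = ⊥-elim (¬Bc B)
    sum-extract f {e ∷ es} {c} (e∉ ∷ uniq) (there c∈) Ac ¬Bc h with A? e | B? e
    ... | yes _ | yes _ = trans (+-congˡ (sum-extract f uniq c∈ Ac ¬Bc h))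
            (solve 3 (λ x y z → x :+ (y :+ z) := y :+ (x :+ z)) refl _ _ _)
    ... | no _  | no _  = sum-extract f uniq c∈ Ac ¬Bc h
    ... | yes p | no ¬q = ⊥-elim (¬q (proj₁ (h e≢c) p))
      where
      e≢c : e ≢ c
      e≢c ≡.refl = All.lookup e∉ c∈ ≡.refl
    ... | no ¬p | yes q = ⊥-elim (¬p (proj₂ (h e≢c) q))
      where
      e≢c : e ≢ c
      e≢c ≡.refl = All.lookup e∉ c∈ ≡.refl

-- Effect of the reversal on intersections, indices and windings.

module Reversal {c ℓ₁ ℓ₂ d : Level} (K : OrderedField c ℓ₁ ℓ₂) (disk : Disk K d)
                {n m r : ℕ} (G : PlabicGraph disk n m r) (gauge : GaugeDirection G)
                (o : Orientation r) (Q : List (Fin r))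
                (cycle : Graph.Oriented.IsSimpleCycle (PlabicGraph.end G) o Q)
                (regions : EdgeVectors.Regions G gauge Q)
                (γ : Fin r → ℕ) (index : ∀ e → EdgeVectors.IsIndex G gauge Q o regions e (γ e))
                (perfect : Graph.Oriented.IsPerfect (PlabicGraph.end G) o (PlabicGraph.colour G))
                (w : Fin r → OrderedField.Carrier K)
                (w-positive : ∀ e → OrderedField._<_ K (OrderedField.0# K) (w e)) where
  open OrderedField K
  open OrderedFieldProperties K
  open Plane K
  open PlaneProperties K
  open IntegerSolver commutativeRing
  open PlabicGraph G
  open EdgeVectors G gauge
  open Oriented o
  open Cycle end o Q cycle
  open Topology K disk G gauge o Q cycle regions
  open GaugeDirection gauge using (l; nonparallel)
  open Turns K

  o′ : Orientation r
  o′ = reverse Q o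

  reverse-∈ : ∀ {e} → e ∈ Q → o′ e ≡ not (o e)
  reverse-∈ {e} e∈ with e ∈ₑ? Q
  ... | yes _ = ≡.refl
  ... | no e∉ = ⊥-elim (e∉ e∈)

  reverse-∉ : ∀ {e} → e ∉ Q → o′ e ≡ o e
  reverse-∉ {e} e∉ with e ∈ₑ? Q
  ... | yes e∈ = ⊥-elim (e∉ e∈)
  ... | no _   = ≡.refl

  module O′ = Oriented o′

  source-∈ : ∀ {e} → e ∈ Q → O′.source e ≡ target e
  source-∈ {e} e∈ = ≡.cong (end e) (reverse-∈ e∈)

  target-∈ : ∀ {e} → e ∈ Q → O′.target e ≡ source e
  target-∈ {e} e∈ = ≡.cong (end e) (≡.trans (≡.cong not (reverse-∈ e∈)) (not-involutive (o e)))

  source-∉ : ∀ {e} → e ∉ Q → O′.source e ≡ source e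
  source-∉ {e} e∉ = ≡.cong (end e) (reverse-∉ e∉)

  target-∉ : ∀ {e} → e ∉ Q → O′.target e ≡ target e
  target-∉ {e} e∉ = ≡.cong (end e) (≡.cong not (reverse-∉ e∉))

  source-boundary : ∀ {e j} → source e ≡ inj₁ j → e ∉ Q
  source-boundary eq e∈ with cycle-source-internal no-loop degree-boundary e∈
  ... | _ , eq′ with () ← ≡.trans (≡.sym eq) eq′

  -- The cycle does not touch the boundary, so the sources and hence the gauge rays are unchanged.
  pivots-reverse : O′.pivots ≡ pivots
  pivots-reverse = filter-≐ O′.isPivot? isPivot? (forth , back) (allFin n)
    where
    forth : ∀ {j} → O′.IsPivot j → IsPivot j
    forth {j} (e , eq) with e ∈ₑ? Q
    ... | no _   = e , eq
    ... | yes e∈ = ⊥-elim (cycle-avoids-boundary no-loop degree-boundary e∈ eq)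
    back : ∀ {j} → IsPivot j → O′.IsPivot j
    back (e , eq) = e , ≡.trans (source-∉ (source-boundary eq)) eq

  int-reverse : ∀ e → int o′ e ≡ int o e
  int-reverse e = ≡.cong (λ is → length (filter
    (λ i → rayMeets? (pos (inj₁ i)) l (pos (end e false)) (pos (end e true)) (nonparallel e)) is)) pivots-reverse

  wind-windP : ∀ x y → odd ∣ wind′ x y ∣ ≡ windP l x y
  wind-windP x y with s x y ℤ.≟ s x l | s x y ℤ.≟ s l y
  ... | yes _ | yes _ = ≡.refl
  ... | yes _ | no _  = ≡.refl
  ... | no _  | _     = ≡.refl

  odd-+ : ∀ a b → odd (a +ℕ b) ≡ odd a xor odd b
  odd-+ ℕ.zero b    = ≡.refl
  odd-+ (ℕ.suc a) b = ≡.trans (≡.cong not (odd-+ a b)) (not-xor (odd a) (odd b))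
    where
    not-xor : ∀ x y → not (x xor y) ≡ not x xor y
    not-xor true  y = not-involutive y
    not-xor false y = ≡.refl

  oddˢ : Sign → Bool
  oddˢ σ = odd (bit Q σ)

  oddˢ-differ : ∀ {σ τ} → σ ≢ τ → oddˢ σ ≡ not (oddˢ τ)
  oddˢ-differ {Sign.+} {Sign.+} ne = ⊥-elim (ne ≡.refl)
  oddˢ-differ {Sign.+} {Sign.-} _  = ≡.refl
  oddˢ-differ {Sign.-} {Sign.+} _  = ≡.refl
  oddˢ-differ {Sign.-} {Sign.-} ne = ⊥-elim (ne ≡.refl)

  direction-≉ : ∀ {e u v} → Ends e u v → ¬ (det (pos v -ₚ pos u) l ≈ 0#)
  direction-≉ {e} (false , ≡.refl , ≡.refl) e≈0 = nonparallel e
    (det-zero-sym e≈0)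
  direction-≉ {e} (true , ≡.refl , ≡.refl) e≈0 = nonparallel e
    (trans (sym (det-flip-swap (pos (end e false)) (pos (end e true)) l)) e≈0)

  -- The mark is constant along the open edge. If the start is off the cycle this mark extends to
  -- it, and if not the shifted start lies on the edge, so both clauses read off the same mark.
  off-index : ∀ {e} → e ∉ Q → ∃[ σ ] γ e ≡ bit Q σ × Germ σ (pos (source e)) (dir o e)
  off-index {e} e∉ = from (index e) (edge-germ (ends-oriented e) e∉)
    where
    from : ∀ {k} → IsIndex Q o regions e k → ∃[ σ ] Germ σ (pos (source e)) (dir o e) →
           ∃[ σ ] k ≡ bit Q σ × Germ σ (pos (source e)) (dir o e)
    from (on-cycle e∈ _) _ = ⊥-elim (e∉ e∈)
    from (start-off _ off) (τ , germ) = τ , ≡.cong (bit Q) (proj₂ marked) , germ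
      where
      marked : Marked τ (pos (source e))
      marked = germ-end (ends-swap {e} (ends-oriented e)) e∉ off (germ-reverse {source e} {target e} germ)
    from (start-on {σ} _ _ (ε , 0<ε , at)) (τ , germ) = τ , ≡.cong (bit Q) σ≡τ , germ
      where
      σ≡τ : σ ≡ τ
      σ≡τ = let (t , 0<t , t<ε , t<1) = instance-of (<ᵉ 0<ε ∧ᵉ <ᵉ 0<1) in
        ≡.trans (≡.sym (at t 0<t t<ε)) (proj₂ (germ t 0<t t<1))

  on-index : ∀ {e} → e ∈ Q → odd (γ e) ≡ (oddˢ leftMark xor γ₂P l (dir o e)) xor odd (int o e)
  on-index {e} e∈ = from (index e)
    where
    from : ∀ {k} → IsIndex Q o regions e k → odd k ≡ (oddˢ leftMark xor γ₂P l (dir o e)) xor odd (int o e)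
    from (start-off e∉ _)  = ⊥-elim (e∉ e∈)
    from (start-on e∉ _ _) = ⊥-elim (e∉ e∈)
    from (on-cycle {σ} _ at) = ≡.trans (odd-+ (bit Q σ +ℕ γ₂ Q o regions e) (int o e)) (≡.cong (_xor odd (int o e))
      (≡.trans (odd-+ (bit Q σ) (γ₂ Q o regions e))
               (≡.cong (λ σ → oddˢ σ xor γ₂P l (dir o e)) (markedAtLeft e∈ at))))

  -- The edge stays in the region of its sink, which is external. This is why the boundary
  -- conditions keep their signs.
  sink-index : ∀ {e j} → target e ≡ inj₁ j → odd (γ e) ≡ false
  sink-index {e} {j} eq = let (σ , γ≡ , germ) = off-index e∉ in
    ≡.trans (≡.cong odd γ≡) (≡.cong oddˢ (Marked-unique (germ-end ends e∉ (boundary-OffCycle j) (to germ)) (boundary-Marked j)))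
    where
    e∉ : e ∉ Q
    e∉ e∈ = cycle-avoids-boundary no-loop degree-boundary e∈ eq
    ends : Ends e (source e) (inj₁ j)
    ends = o e , ≡.refl , eq
    to : ∀ {σ} → Germ σ (pos (source e)) (dir o e) → Germ σ (pos (source e)) (pos (inj₁ j) -ₚ pos (source e))
    to {σ} = ≡.subst (λ v → Germ σ (pos (source e)) (pos v -ₚ pos (source e))) eq

  off-vertex-index : ∀ {e f} → target e ≡ source f → ¬ OnCycle Q (pos (source f)) → odd (γ e) ≡ odd (γ f)
  off-vertex-index {e} {f} eq off =
    let (σ , γe , germ-e) = off-index e∉; (τ , γf , germ-f) = off-index f∉ in
    ≡.trans (≡.cong odd γe) (≡.trans (≡.cong oddˢ (Marked-unique (end-e germ-e) (end-f germ-f))) (≡.sym (≡.cong odd γf)))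
    where
    V = source f
    ends : Ends e (source e) V
    ends = o e , ≡.refl , eq
    e∉ : e ∉ Q
    e∉ e∈ = off (vertex-OnCycle e∈ (ends-incidentˡ (ends-swap {e} ends)))
    f∉ : f ∉ Q
    f∉ f∈ = off (vertex-OnCycle f∈ (ends-incidentˡ (ends-oriented f)))
    end-e : ∀ {σ} → Germ σ (pos (source e)) (dir o e) → Marked σ (pos V)
    end-e {σ} germ = germ-end ends e∉ off (≡.subst (λ v → Germ σ (pos (source e)) (pos v -ₚ pos (source e))) eq germ)
    end-f : ∀ {σ} → Germ σ (pos V) (dir o f) → Marked σ (pos V)
    end-f germ = germ-end (ends-swap {f} (ends-oriented f)) f∉ off (germ-reverse {V} {target f} germ)

  dir-∈ : ∀ {e} → e ∈ Q → dir o′ e ≡ pos (source e) -ₚ pos (target e)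
  dir-∈ e∈ = ≡.cong₂ (λ u v → pos u -ₚ pos v) (target-∈ e∈) (source-∈ e∈)

  dir-∉ : ∀ {e} → e ∉ Q → dir o′ e ≡ dir o e
  dir-∉ e∉ = ≡.cong₂ (λ u v → pos u -ₚ pos v) (target-∉ e∉) (source-∉ e∉)

  windows : ∀ {x y x′ y′} → x ≡ x′ → y ≡ y′ → odd ∣ wind′ x y ∣ ≡ windP l x′ y′
  windows {x} {y} ≡.refl ≡.refl = wind-windP x y

  module _ {e f : Edge} (e∈ : e ∈ Q) (f∈ : f ∈ Q) (eq : target e ≡ source f) where
    private
      V = source f
      A = pos (source e)
      B = pos (target f)
      ends-e : Ends e (source e) V
      ends-e = o e , ≡.refl , eq
      open Corner (vertex-corner e∈ f∈ eq)
      open Turn l A (pos V) B (direction-≉ ends-e) (direction-≉ (ends-oriented f)) 0<u 0<v div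

      dir-e : dir o e ≡ pos V -ₚ A
      dir-e = ≡.cong (λ v → pos v -ₚ A) eq
      dir-e′ : dir o′ e ≡ A -ₚ pos V
      dir-e′ = ≡.trans (dir-∈ e∈) (≡.cong (λ v → A -ₚ pos v) eq)
      dir-f′ : dir o′ f ≡ pos V -ₚ B
      dir-f′ = dir-∈ f∈
      γ₂-e : γ₂P l (dir o e) ≡ γ₂P l (pos V -ₚ A)
      γ₂-e = ≡.cong (γ₂P l) dir-e

    cycle-parity : odd ∣ wind o e f ∣ xor odd ∣ wind o′ f e ∣ xor γ₂P l (dir o e) xor γ₂P l (dir o f) ≡ false
    cycle-parity = ≡.trans (windows dir-e ≡.refl xor-cong windows dir-f′ dir-e′ xor-cong γ₂-e xor-cong ≡.refl)
      wind-straight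

    private
      module _ {g : Edge} {U : Vertex} {σ : Sign} (ends : Ends g V U) (germ : Germ σ (pos V) (pos U -ₚ pos V)) where
        0<w = chord-positive (ends-distinct ends)
        classified = vertex-germ {w = pos U -ₚ pos V} e∈ f∈ eq germ 0<w
        open Branch (pos U) (direction-≉ ends) 0<w (proj₁ classified) (proj₁ (proj₂ classified))

        out-parity : windP l (pos V -ₚ B) (A -ₚ pos V) xor windP l (pos V -ₚ A) (pos U -ₚ pos V)
                     xor windP l (pos V -ₚ B) (pos U -ₚ pos V) xor γ₂P l (pos V -ₚ A)
                     ≡ not (oddˢ leftMark xor oddˢ σ)
        out-parity = ≡.trans wind-out (side (proj₂ (proj₂ classified)))
          where
          self : ∀ x → not (x xor x) ≡ true
          self true  = ≡.refl
          self false = ≡.refl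
          other : ∀ x → not (not x xor x) ≡ false
          other true  = ≡.refl
          other false = ≡.refl
          side : _ → _
          side (inj₁ (sector , ≡.refl)) = ≡.trans (in-left sector) (≡.sym (self (oddˢ leftMark)))
          side (inj₂ (sector , ≡.refl)) = ≡.trans (in-right sector) (≡.sym (≡.trans
            (≡.cong (λ b → not (b xor oddˢ rightMark)) (oddˢ-differ leftMark≢rightMark)) (other (oddˢ rightMark))))

        in-parity : windP l (pos V -ₚ pos U) (B -ₚ pos V) xor windP l (pos V -ₚ pos U) (A -ₚ pos V)
                    xor windP l (pos V -ₚ A) (B -ₚ pos V) xor γ₂P l (pos V -ₚ A)
                    ≡ oddˢ leftMark xor oddˢ σ
        -- Both parities are governed by the same sector test, whose value in terms of marks is
        -- already known from the outgoing case.
        in-parity = ≡.trans wind-in (≡.trans (≡.cong not (≡.trans (≡.sym wind-out) out-parity)) (not-involutive _))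

    -- The right side is `true` exactly when the index of `g` has the parity of the left mark, that
    -- is, when `g` leaves on the left.
    outgoing-parity : ∀ {g} → g ∉ Q → source g ≡ V →
      odd ∣ wind o′ f e ∣ xor odd ∣ wind o e g ∣ xor odd ∣ wind o′ f g ∣ xor γ₂P l (dir o e)
      ≡ not (oddˢ leftMark xor odd (γ g))
    outgoing-parity {g} g∉ eqg = let (σ , γg , germ) = off-index g∉ in
      ≡.trans (windows dir-f′ dir-e′ xor-cong windows dir-e dir-g xor-cong windows dir-f′ (≡.trans (dir-∉ g∉) dir-g) xor-cong γ₂-e)
      (≡.trans (out-parity {g} {target g} {σ} (o g , eqg , ≡.refl)
                 (≡.subst (λ v → Germ σ (pos v) (pos (target g) -ₚ pos v)) eqg germ))
               (≡.cong (λ b → not (oddˢ leftMark xor b)) (≡.sym (≡.cong odd γg))))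
      where
      dir-g : dir o g ≡ pos (target g) -ₚ pos V
      dir-g = ≡.cong (λ v → pos (target g) -ₚ pos v) eqg

    incoming-parity : ∀ {g} → g ∉ Q → target g ≡ V →
      odd ∣ wind o g f ∣ xor odd ∣ wind o′ g e ∣ xor odd ∣ wind o e f ∣ xor γ₂P l (dir o e)
      ≡ oddˢ leftMark xor odd (γ g)
    incoming-parity {g} g∉ eqg = let (σ , γg , germ) = off-index g∉ in
      ≡.trans (windows dir-g ≡.refl xor-cong windows (≡.trans (dir-∉ g∉) dir-g) dir-e′ xor-cong windows dir-e ≡.refl xor-cong γ₂-e)
      (≡.trans (in-parity {g} {source g} {σ} (ends-swap {g} (o g , ≡.refl , eqg))
                 (germ-reverse {source g} {V} (≡.subst (λ v → Germ σ (pos (source g)) (pos v -ₚ pos (source g))) eqg germ)))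
               (≡.cong (oddˢ leftMark xor_) (≡.sym (≡.cong odd γg))))
      where
      dir-g : dir o g ≡ pos V -ₚ pos (source g)
      dir-g = ≡.cong (λ v → pos v -ₚ pos (source g)) eqg

  -- Vertex relations in both orientations.

  open Signs K
  open Sums K {r}
  open IsPerfect perfect
  open SetoidReasoning setoid

  ŵ : Weight
  ŵ = reweight Q w

  ŵ-∈ : ∀ {e} → e ∈ Q → ŵ e ≡ w e ⁻¹
  ŵ-∈ {e} e∈ with e ∈ₑ? Q
  ... | yes _ = ≡.refl
  ... | no e∉ = ⊥-elim (e∉ e∈)

  ŵ-∉ : ∀ {e} → e ∉ Q → ŵ e ≡ w e
  ŵ-∉ {e} e∉ with e ∈ₑ? Q
  ... | yes e∈ = ⊥-elim (e∉ e∈)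
  ... | no _   = ≡.refl

  w-inverse : ∀ e → w e * w e ⁻¹ ≈ 1#
  w-inverse e = ⁻¹-inverse (w-positive e)

  Rest : Vertex → Edge → Set
  Rest V f = source f ≡ V × f ∉ Q

  rest? : ∀ V → Decidable (Rest V)
  rest? V f = (source f ≟ᵛ V) ×-dec ¬? (f ∈ₑ? Q)

  rest : Vertex → List Edge
  rest V = filter (rest? V) (allFin r)

  rest-elim : ∀ {V g} → g ∈ rest V → Rest V g
  rest-elim {V} g∈ = proj₂ (∈-filter⁻ (rest? V) {xs = allFin r} g∈)

  out-split : ∀ F {f} → f ∈ Q → ∑ (outEdges (source f)) F ≈ F f + sum (rest (source f)) F
  out-split F {f} f∈ = sum-extract _ (rest? (source f)) F (allFin⁺ r) (∈-allFin f) ≡.refl (λ (_ , f∉) → f∉ f∈)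
    λ {g} g≢f → (λ eq → eq , λ g∈ → g≢f (source-injective g∈ f∈ eq)) , proj₁

  -- After the reversal `e` is the cycle edge leaving `V`, while the edges off the cycle that leave
  -- `V` are the same as before.
  out-split-reverse : ∀ F {e V} → e ∈ Q → target e ≡ V → ∑ (O′.outEdges V) F ≈ F e + sum (rest V) F
  out-split-reverse F {e} {V} e∈ eq = sum-extract _ (rest? V) F (allFin⁺ r) (∈-allFin e)
    (≡.trans (source-∈ e∈) eq) (λ (_ , e∉) → e∉ e∈) split
    where
    split : ∀ {g} → g ≢ e → (O′.source g ≡ V → Rest V g) × (Rest V g → O′.source g ≡ V)
    split {g} g≢e = forth , λ (eq′ , g∉) → ≡.trans (source-∉ g∉) eq′
      where
      forth : O′.source g ≡ V → Rest V g
      forth eq′ with g ∈ₑ? Q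
      ... | yes g∈ = ⊥-elim (g≢e (target-injective g∈ e∈ (≡.trans eq′ (≡.sym eq))))
      ... | no g∉  = eq′ , g∉

  -- A relation in place of the map, so that the same lemmas serve for a given old system and for a
  -- given new one.
  record Related (X X̂ : EdgeSystem) : Set ℓ₁ where
    field
      on  : ∀ {e} → e ∈ Q → ∀ k → X̂ e k ≈ ± (odd (γ e)) * w e ⁻¹ * X e k
      off : ∀ {e} → e ∉ Q → ∀ k → X̂ e k ≈ ± (odd (γ e)) * X e k

  ι : Edge → Carrier
  ι e = ± (odd (int o e))

  ι-reverse : ∀ e → parity (int o′ e) ≈ ι e
  ι-reverse e = trans (parity-± (int o′ e)) (reflexive (≡.cong (λ k → ± (odd k)) (int-reverse e)))

  ω ω̂ : Edge → Edge → Carrier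
  ω e f = ± (odd ∣ wind o e f ∣)
  ω̂ e f = ± (odd ∣ wind o′ e f ∣)

  g₂ : Edge → Carrier
  g₂ e = ± (γ₂P l (dir o e))

  λ± : Carrier
  λ± = ± (oddˢ leftMark)

  index-on : ∀ {e} → e ∈ Q → ± (odd (γ e)) ≈ λ± * g₂ e * ι e
  index-on e∈ = trans (reflexive (≡.cong ± (on-index e∈))) (trans (±-xor _ _) (*-congʳ (±-xor _ _)))

  -- The vertex is an argument of its own, since the same vertex appears as the end of one edge and
  -- as the start of another.
  OldAt NewAt : EdgeSystem → Fin n → Edge → Vertex → Set ℓ₁
  OldAt X k e V = X e k ≈ parity (int o e) * w e * ∑ (outEdges V) (λ f → parity ∣ wind o e f ∣ * X f k)
  NewAt X k e V = X e k ≈ parity (int o′ e) * ŵ e * ∑ (O′.outEdges V) (λ f → parity ∣ wind o′ e f ∣ * X f k)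

  module _ {X X̂ : EdgeSystem} (related : Related X X̂) (k : Fin n) where
    open Related related

    module _ {e f : Edge} (e∈ : e ∈ Q) (f∈ : f ∈ Q) (eq : target e ≡ source f) where
      private
        V = source f
        S = sum (rest V) (λ g → ω e g * X g k)
        Ŝ = sum (rest V) (λ g → ω̂ f g * X̂ g k)
        b = ω̂ f e
        g₁ = g₂ e

        turning : ω e f * (b * (g₁ * g₂ f)) ≈ 1#
        turning = trans (sym (±-xor₄ _ _ _ _)) (trans (reflexive (≡.cong ± (cycle-parity e∈ f∈ eq))) ±-false)

        term : ∀ {g} → g ∈ rest V → ω̂ f g * X̂ g k ≈ - (b * λ± * g₁) * (ω e g * X g k)
        term {g} g∈ = let (eqg , g∉) = rest-elim g∈ in begin
          ω̂ f g * X̂ g k                               ≈⟨ *-congˡ (off g∉ k) ⟩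
          ω̂ f g * (± (odd (γ g)) * X g k)             ≈⟨ unit-drop (±-square _) ⟨
          λ± * λ± * (ω̂ f g * (± (odd (γ g)) * X g k))
            -- Squares of signs are inserted and removed so that the parity at the branch can
            -- replace the index of `g` by data common to all terms.
            ≈⟨ solve 4 (λ L p γ X → L :* L :* (p :* (γ :* X)) := (:- L) :* p :* (:- (L :* γ)) :* X)
                 refl λ± (ω̂ f g) (± (odd (γ g))) (X g k) ⟩
          - λ± * ω̂ f g * - (λ± * ± (odd (γ g))) * X g k
            ≈⟨ *-congʳ (*-congˡ (branch-sign g∉ eqg)) ⟨
          - λ± * ω̂ f g * (b * (ω e g * (ω̂ f g * g₁))) * X g k
            ≈⟨ solve 6 (λ L p b q g X → (:- L) :* p :* (b :* (q :* (p :* g))) :* X :=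
                 p :* p :* ((:- (b :* L :* g)) :* (q :* X))) refl λ± (ω̂ f g) b (ω e g) g₁ (X g k) ⟩
          ω̂ f g * ω̂ f g * (- (b * λ± * g₁) * (ω e g * X g k))   ≈⟨ unit-drop (±-square _) ⟩
          - (b * λ± * g₁) * (ω e g * X g k)            ∎
          where
          branch-sign : ∀ {g} → g ∉ Q → source g ≡ V → b * (ω e g * (ω̂ f g * g₁)) ≈ - (λ± * ± (odd (γ g)))
          branch-sign g∉ eqg = trans (sym (±-xor₄ _ _ _ _)) (trans (reflexive (≡.cong ± (outgoing-parity e∈ f∈ eq g∉ eqg)))
            (trans (±-not _) (-‿cong (±-xor _ _))))

        Ŝ≈ : Ŝ ≈ - (b * λ± * g₁) * S
        Ŝ≈ = trans (sum-cong (rest V) term) (sum-scale _ (rest V))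

        old-rhs : parity (int o e) * w e * ∑ (outEdges V) (λ g → parity ∣ wind o e g ∣ * X g k)
                  ≈ ι e * w e * (ω e f * X f k + S)
        old-rhs = *-cong (*-congʳ (parity-± (int o e))) (trans (out-split _ f∈)
          (+-cong (*-congʳ (parity-± ∣ wind o e f ∣)) (sum-cong (rest V) (λ {g} _ → *-congʳ (parity-± ∣ wind o e g ∣)))))

        new-rhs : parity (int o′ f) * ŵ f * ∑ (O′.outEdges V) (λ g → parity ∣ wind o′ f g ∣ * X̂ g k)
                  ≈ ι f * w f ⁻¹ * (b * X̂ e k + Ŝ)
        new-rhs = *-cong (*-cong (ι-reverse f) (reflexive (ŵ-∈ f∈))) (trans (out-split-reverse _ e∈ eq)
          (+-cong (*-congʳ (parity-± ∣ wind o′ f e ∣)) (sum-cong (rest V) (λ {g} _ → *-congʳ (parity-± ∣ wind o′ f g ∣)))))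

      isolated : OldAt X k e V → ω e f * X f k + S ≈ ι e * w e ⁻¹ * X e k
      isolated old = isolate (±-square _) (w-inverse e) (trans old old-rhs)

      -- The cycle edge arriving at `V` is `e` before the reversal and `f` after it, so the relation
      -- of one edge becomes that of the other.
      cycle-forth : OldAt X k e V → NewAt X̂ k f V
      cycle-forth old = trans (reversed (±-square _) (±-square _) (±-square _) (±-square _) (±-square _) turning
        (index-on e∈) (index-on f∈) (w-inverse f) (on e∈ k) (on f∈ k) Ŝ≈ (isolated old)) (sym new-rhs)

      cycle-back : NewAt X̂ k f V → OldAt X k e V
      cycle-back new = trans (restore (±-square _) (w-inverse e)
        (unreversed (±-square _) (±-square _) (±-square _) (±-square _) (±-square _) turning
          (index-on e∈) (index-on f∈) (w-inverse f) (on e∈ k) (on f∈ k) Ŝ≈ (trans new new-rhs))) (sym old-rhs)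

      module _ {v : Fin m} {h : Edge} (eqV : V ≡ inj₂ v) (h∉ : h ∉ Q) (eqh : target h ≡ V) where
        private
          -- Perfectness enters here: `V` has the two incoming edges `e` and `h`, so it is black and
          -- has a single outgoing edge.
          out-unique : ∀ {g} → source g ≡ V → g ≡ f
          out-unique {g} eqg with colour v in col
          ... | white = ⊥-elim (h∉ (≡.subst (_∈ Q) (length-1-unique (white-in v col)
                  (∈-filter⁺ _ (∈-allFin e) (≡.trans eq eqV)) (∈-filter⁺ _ (∈-allFin h) (≡.trans eqh eqV))) e∈))
          ... | black = length-1-unique (black-out v col)
                  (∈-filter⁺ _ (∈-allFin g) (≡.trans eqg eqV)) (∈-filter⁺ _ (∈-allFin f) eqV)

          rest-empty : ∀ {F} → sum (rest V) F ≈ 0#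
          rest-empty = sum-empty (rest V) λ g∈ → let (eqg , g∉) = rest-elim g∈ in
            g∉ (≡.subst (_∈ Q) (≡.sym (out-unique eqg)) f∈)

          drop-rest : ∀ {x F} → x + sum (rest V) F ≈ x
          drop-rest = trans (+-congˡ rest-empty) (+-identityʳ _)

          branching : ω h f * (ω̂ h e * (ω e f * g₁)) ≈ λ± * ± (odd (γ h))
          branching = trans (sym (±-xor₄ _ _ _ _)) (trans (reflexive (≡.cong ± (incoming-parity e∈ f∈ eq h∉ eqh))) (±-xor _ _))

          old-rhs′ : parity (int o h) * w h * ∑ (outEdges V) (λ g → parity ∣ wind o h g ∣ * X g k)
                     ≈ ι h * w h * (ω h f * X f k)
          old-rhs′ = *-cong (*-congʳ (parity-± (int o h))) (trans (out-split _ f∈)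
            (trans drop-rest (*-congʳ (parity-± ∣ wind o h f ∣))))

          new-rhs′ : parity (int o′ h) * ŵ h * ∑ (O′.outEdges V) (λ g → parity ∣ wind o′ h g ∣ * X̂ g k)
                     ≈ ι h * w h * (ω̂ h e * X̂ e k)
          new-rhs′ = *-cong (*-cong (ι-reverse h) (reflexive (ŵ-∉ h∉)))
            (trans (out-split-reverse _ e∈ eq) (trans drop-rest (*-congʳ (parity-± ∣ wind o′ h e ∣))))

          main : OldAt X k e V → ω e f * X f k ≈ ι e * w e ⁻¹ * X e k
          main old = trans (sym drop-rest) (isolated old)

        -- The relation of `h` involves the vector of `f`, its new counterpart that of `e`; hence
        -- the relation of `e` is also assumed.
        side-forth : OldAt X k e V → OldAt X k h V → NewAt X̂ k h V
        side-forth old old-h = trans (side-reversed (±-square _) (±-square _) (±-square _) (±-square _) (±-square _)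
          branching (index-on e∈) (on e∈ k) (off h∉ k) (main old) (trans old-h old-rhs′)) (sym new-rhs′)

        side-back : OldAt X k e V → NewAt X̂ k h V → OldAt X k h V
        side-back old new-h = trans (side-unreversed (±-square _) (±-square _) (±-square _) (±-square _) (±-square _)
          branching (index-on e∈) (on e∈ k) (off h∉ k) (main old) (trans new-h new-rhs′)) (sym old-rhs′)

    module _ {e : Edge} {V : Vertex} (eq : target e ≡ V) (off-V : ∀ {c} → c ∈ Q → target c ≢ V) where
      private
        source-off : ∀ {c} → c ∈ Q → source c ≢ V
        source-off c∈ eq′ = let (b , b∈ , eq″) = prev c∈ in off-V b∈ (≡.trans eq″ eq′)

        e∉ : e ∉ Q
        e∉ e∈ = off-V e∈ eq

        ε = ± (odd (γ e))

        term : ∀ {f} → f ∈ outEdges V → parity ∣ wind o′ e f ∣ * X̂ f k ≈ ε * (parity ∣ wind o e f ∣ * X f k)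
        term {f} f∈out = begin
          parity ∣ wind o′ e f ∣ * X̂ f k
            ≈⟨ *-cong (reflexive (≡.cong₂ (λ x y → parity ∣ wind′ x y ∣) (dir-∉ e∉) (dir-∉ f∉))) (off f∉ k) ⟩
          parity ∣ wind o e f ∣ * (± (odd (γ f)) * X f k)
            ≈⟨ *-congˡ (*-congʳ (reflexive (≡.cong ± (≡.sym (off-vertex-index (≡.trans eq (≡.sym eqf)) off-pos))))) ⟩
          parity ∣ wind o e f ∣ * (ε * X f k)
            ≈⟨ solve 3 (λ p ε X → p :* (ε :* X) := ε :* (p :* X)) refl _ ε (X f k) ⟩
          ε * (parity ∣ wind o e f ∣ * X f k)    ∎
          where
          eqf : source f ≡ V
          eqf = proj₂ (∈-filter⁻ (λ f → source f ≟ᵛ V) {xs = allFin r} f∈out)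
          f∉ : f ∉ Q
          f∉ f∈ = source-off f∈ eqf
          off-pos : ¬ OnCycle Q (pos (source f))
          off-pos on-c = let (c , c∈ , inc) = OnCycle-vertex on-c in
            Sum.[ (λ eq′ → source-off c∈ (≡.trans eq′ eqf)) , (λ eq′ → off-V c∈ (≡.trans eq′ eqf)) ] (incident-cases c inc)

        same-out : ∀ F → ∑ (O′.outEdges V) F ≈ ∑ (outEdges V) F
        same-out F = sum-filter-≐ _ _ F {allFin r} λ {f} _ → forth , λ eq′ →
          ≡.trans (source-∉ (λ f∈ → source-off f∈ eq′)) eq′
          where
          forth : ∀ {f} → O′.source f ≡ V → source f ≡ V
          forth {f} eq′ with f ∈ₑ? Q
          ... | yes f∈ = ⊥-elim (off-V f∈ eq′)
          ... | no f∉  = eq′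

        new-rhs : parity (int o′ e) * ŵ e * ∑ (O′.outEdges V) (λ f → parity ∣ wind o′ e f ∣ * X̂ f k)
                  ≈ ε * (parity (int o e) * w e * ∑ (outEdges V) (λ f → parity ∣ wind o e f ∣ * X f k))
        new-rhs = trans (*-cong (*-cong (reflexive (≡.cong parity (int-reverse e))) (reflexive (ŵ-∉ e∉)))
            (trans (same-out _) (trans (sum-cong (outEdges V) term) (sum-scale ε (outEdges V)))))
          (solve 4 (λ i w ε S → i :* w :* (ε :* S) := ε :* (i :* w :* S)) refl _ (w e) ε _)

      -- All edges at `V` have indices of one parity, so the whole relation is multiplied by a
      -- single sign.
      off-forth : OldAt X k e V → NewAt X̂ k e V
      off-forth old = trans (off e∉ k) (trans (*-congˡ old) (sym new-rhs))

      off-back : NewAt X̂ k e V → OldAt X k e V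
      off-back new = unit-cancel (±-square (odd (γ e))) (trans (sym (off e∉ k)) (trans new new-rhs))

  -- Transfer of solutions and of uniqueness.

  module _ {X X̂ : EdgeSystem} (related : Related X X̂) where
    open Related related

    private
      on-cycle? : ∀ V → Dec (∃[ c ] c ∈ Q × target c ≡ V)
      on-cycle? V with any? (λ c → target c ≟ᵛ V) Q
      ... | yes p = yes (let (c , c∈ , eq) = find p in c , c∈ , eq)
      ... | no ¬p = no λ (c , c∈ , eq) → ¬p (lose c∈ eq)

      at : ∀ {A : Vertex → Set ℓ₁} {u v} → u ≡ v → A u → A v
      at {A} = ≡.subst A

      sink-index-± : ∀ {e j} → target e ≡ inj₁ j → ± (odd (γ e)) ≈ 1#
      sink-index-± eq = trans (reflexive (≡.cong ± (sink-index eq))) ±-false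

      sink-∉ : ∀ {e j} → target e ≡ inj₁ j → e ∉ Q
      sink-∉ eq e∈ = cycle-avoids-boundary no-loop degree-boundary e∈ eq

    solves-forth : ∀ {B} → Solves o w B X → Solves o′ ŵ B X̂
    solves-forth {B} solves = record { atInternal = internal-eq ; atSink = sink-eq }
      where
      open Solves solves
      old : ∀ {V} e v k → target e ≡ V → V ≡ inj₂ v → OldAt X k e V
      old e v k eq ≡.refl = atInternal e v eq k

      internal-eq : ∀ e v → O′.target e ≡ inj₂ v → ∀ k → NewAt X̂ k e (inj₂ v)
      internal-eq e v eq k = cases (e ∈ₑ? Q) (on-cycle? (inj₂ v))
        where
        cases : Dec (e ∈ Q) → Dec (∃[ c ] c ∈ Q × target c ≡ inj₂ v) → NewAt X̂ k e (inj₂ v)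
        -- A reversed cycle edge ends at its former start, where the old relation to use is that of
        -- its predecessor.
        cases (yes e∈) _ = let (b , b∈ , eqb) = prev e∈; eqV = ≡.trans (≡.sym (target-∈ e∈)) eq in
          at {λ V → NewAt X̂ k e V} eqV (cycle-forth related k b∈ e∈ eqb (old b v k eqb eqV))
        cases (no e∉) (no off-V) = let eq′ = ≡.trans (≡.sym (target-∉ e∉)) eq in
          off-forth related k eq′ (λ c∈ eq″ → off-V (_ , c∈ , eq″)) (old e v k eq′ ≡.refl)
        cases (no e∉) (yes (b , b∈ , eqb)) =
          let eq′ = ≡.trans (≡.sym (target-∉ e∉)) eq; (f , f∈ , eqf) = next b∈; eqV = ≡.trans eqf eqb in
          at {λ V → NewAt X̂ k e V} eqV (side-forth related k b∈ f∈ (≡.sym eqf) eqV e∉ (≡.trans eq′ (≡.sym eqV))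
            (old b v k (≡.sym eqf) eqV) (old e v k (≡.trans eq′ (≡.sym eqV)) eqV))

      sink-eq : ∀ e j → O′.target e ≡ inj₁ j → ∀ k → X̂ e k ≈ parity (int o′ e) * ŵ e * B j k
      sink-eq e j eq k = trans (off e∉ k) (trans (*-cong (sink-index-± eq′) (atSink e j eq′ k))
          (trans (*-identityˡ _) (*-congʳ (*-cong (reflexive (≡.cong parity (≡.sym (int-reverse e))))
            (reflexive (≡.sym (ŵ-∉ e∉)))))))
        where
        e∉ : e ∉ Q
        e∉ e∈ with cycle-source-internal no-loop degree-boundary e∈
        ... | _ , eq″ with () ← ≡.trans (≡.sym eq) (≡.trans (target-∈ e∈) eq″)
        eq′ : target e ≡ inj₁ j
        eq′ = ≡.trans (≡.sym (target-∉ e∉)) eq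

    solves-back : ∀ {B} → Solves o′ ŵ B X̂ → Solves o w B X
    solves-back {B} solves = record { atInternal = internal-eq ; atSink = sink-eq }
      where
      open Solves solves
      new-∈ : ∀ {V} f v k → f ∈ Q → source f ≡ V → V ≡ inj₂ v → NewAt X̂ k f V
      new-∈ f v k f∈ eq ≡.refl = atInternal f v (≡.trans (target-∈ f∈) eq) k
      new-∉ : ∀ {V} e v k → e ∉ Q → target e ≡ V → V ≡ inj₂ v → NewAt X̂ k e V
      new-∉ e v k e∉ eq ≡.refl = atInternal e v (≡.trans (target-∉ e∉) eq) k

      internal-eq : ∀ e v → target e ≡ inj₂ v → ∀ k → OldAt X k e (inj₂ v)
      internal-eq e v eq k = cases (e ∈ₑ? Q) (on-cycle? (inj₂ v))
        where
        cases : Dec (e ∈ Q) → Dec (∃[ c ] c ∈ Q × target c ≡ inj₂ v) → OldAt X k e (inj₂ v)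
        cases (yes e∈) _ = let (f , f∈ , eqf) = next e∈; eqV = ≡.trans eqf eq in
          at {λ V → OldAt X k e V} eqV (cycle-back related k e∈ f∈ (≡.sym eqf) (new-∈ f v k f∈ ≡.refl eqV))
        cases (no e∉) (no off-V) = off-back related k eq (λ c∈ eq′ → off-V (_ , c∈ , eq′)) (new-∉ e v k e∉ eq ≡.refl)
        cases (no e∉) (yes (b , b∈ , eqb)) = let (f , f∈ , eqf) = next b∈; eqV = ≡.trans eqf eqb in
          at {λ V → OldAt X k e V} eqV (side-back related k b∈ f∈ (≡.sym eqf) eqV e∉ (≡.trans eq (≡.sym eqV))
            -- The old relation of the incoming cycle edge is recovered before that of the third
            -- edge, which depends on it.
            (cycle-back related k b∈ f∈ (≡.sym eqf) (new-∈ f v k f∈ ≡.refl eqV))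
            (new-∉ e v k e∉ (≡.trans eq (≡.sym eqV)) eqV))

      sink-eq : ∀ e j → target e ≡ inj₁ j → ∀ k → X e k ≈ parity (int o e) * w e * B j k
      sink-eq e j eq k = trans (sym (unit-drop (sink-index-± eq))) (trans (sym (off (sink-∉ eq) k))
        (trans (atSink e j (≡.trans (target-∉ (sink-∉ eq)) eq) k)
          (*-congʳ (*-cong (reflexive (≡.cong parity (int-reverse e))) (reflexive (ŵ-∉ (sink-∉ eq)))))))

  transform-related : ∀ X → Related X (transform Q γ w X)
  transform-related X = record { on = on-Q ; off = off-Q }
    where
    on-Q : ∀ {e} → e ∈ Q → ∀ k → transform Q γ w X e k ≈ ± (odd (γ e)) * w e ⁻¹ * X e k
    on-Q {e} e∈ k with e ∈ₑ? Q
    ... | yes _ = *-congʳ (*-congʳ (parity-± (γ e)))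
    ... | no e∉ = ⊥-elim (e∉ e∈)
    off-Q : ∀ {e} → e ∉ Q → ∀ k → transform Q γ w X e k ≈ ± (odd (γ e)) * X e k
    off-Q {e} e∉ k with e ∈ₑ? Q
    ... | yes e∈ = ⊥-elim (e∉ e∈)
    ... | no _   = *-congʳ (parity-± (γ e))

  -- The inverse of the transformation: the sign is its own inverse, and the weight cancels the
  -- inverse weight.
  untransform : EdgeSystem → EdgeSystem
  untransform Y e k = if does (e ∈ₑ? Q) then ± (odd (γ e)) * w e * Y e k else ± (odd (γ e)) * Y e k

  untransform-related : ∀ Y → Related (untransform Y) Y
  untransform-related Y = record { on = on-Q ; off = off-Q }
    where
    on-Q : ∀ {e} → e ∈ Q → ∀ k → Y e k ≈ ± (odd (γ e)) * w e ⁻¹ * untransform Y e k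
    on-Q {e} e∈ k with e ∈ₑ? Q
    ... | no e∉ = ⊥-elim (e∉ e∈)
    ... | yes _ = sym (trans (solve 4 (λ g w v Y → g :* v :* (g :* w :* Y) := (g :* g) :* (w :* v) :* Y) refl _ (w e) (w e ⁻¹) (Y e k))
                    (unit-drop (unit-* (±-square _) (w-inverse e))))
    off-Q : ∀ {e} → e ∉ Q → ∀ k → Y e k ≈ ± (odd (γ e)) * untransform Y e k
    off-Q {e} e∉ k with e ∈ₑ? Q
    ... | yes e∈ = ⊥-elim (e∉ e∈)
    ... | no _   = sym (trans (sym (*-assoc _ _ _)) (unit-drop (±-square _)))

  related-unique : ∀ {X X′ X̂ X̂′} → Related X X̂ → Related X′ X̂′ → (∀ e k → X′ e k ≈ X e k) → ∀ e k → X̂′ e k ≈ X̂ e k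
  related-unique rel rel′ same e k = cases (e ∈ₑ? Q)
    where
    cases : Dec (e ∈ Q) → _
    cases (yes e∈) = trans (Related.on rel′ e∈ k) (trans (*-congˡ (same e k)) (sym (Related.on rel e∈ k)))
    cases (no e∉)  = trans (Related.off rel′ e∉ k) (trans (*-congˡ (same e k)) (sym (Related.off rel e∉ k)))

  reversal : ∀ {B E} → IsSystemOfEdgeVectors o w B E → IsSystemOfEdgeVectors o′ ŵ B (transform Q γ w E)
  reversal {B} {E} system = record
    { solves = solves-forth (transform-related E) solves
    -- A competing solution is pulled back to the old network, identified there by uniqueness, and
    -- pushed forward again.
    ; unique = λ Y solves-Y → related-unique (transform-related E) (untransform-related Y)
        (unique (untransform Y) (solves-back (untransform-related Y) solves-Y))
    }
    where open IsSystemOfEdgeVectors system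

lemma4p7 : ∀ {c ℓ₁ ℓ₂ d : Level} (K : OrderedField c ℓ₁ ℓ₂) (disk : Disk K d)
    {n m r : ℕ} (G : PlabicGraph disk n m r) (gauge : GaugeDirection G) →
    let open OrderedField K
        open PlabicGraph G
        open EdgeVectors G gauge
    in
    (o : Orientation r) → Oriented.IsPerfect o colour →
    (w : Weight) → (∀ e → 0# < w e) →
    (E : EdgeSystem) → IsSystemOfEdgeVectors o w basis E →
    (Q : List Edge) → Oriented.IsSimpleCycle o Q →
    (regions : Regions Q) →
    (γ : Edge → ℕ) → (∀ e → IsIndex Q o regions e (γ e)) →
    IsSystemOfEdgeVectors (reverse Q o) (reweight Q w) basis (transform Q γ w E)
lemma4p7 K disk G gauge o perfect w w-positive E system Q cycle regions γ index =
  Reversal.reversal K disk G gauge o Q cycle regions γ index perfect w w-positive system
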